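{- Let $(G,F)$ be a framed graph and let $\mathscr{L}_{G,F}$ be its framing poset. Then $\mathscr{L}_{G,F}$ is an $\mathcal{H}\mathcal{H}$-lattice. Hence it is semidistributive, congruence uniform, and polygonal. Furthermore, its polygons consist only of squares, pentagons or hexagons (i.e. polygons whose two maximal chains have length $2$ or $3$).
   Context: A flow graph $G$ is a finite directed acyclic multigraph whose vertices are linearly ordered (e.g. vertex set $[n]$), every edge directed from a smaller to a larger vertex, with a unique source $s$ and unique sink $t$. A route is a directed path from $s$ to $t$. A framing $F$ of $G$ consists, for each vertex $v$, of a linear order $\le_{\mathrm{In}(v)}$ on the set of edges entering $v$ and a linear order $\le_{\mathrm{Out}(v)}$ on the set of edges leaving $v$; $(G,F)$ is a framed graph. For a path $P$ through $v$, $Pv$ (resp. $vP$) is the maximal subpath of $P$ ending (resp. starting) at $v$. For paths $Pv,Qv$ ending at $v$, let $w$ be the first vertex after which they coincide; if $w$ is the first vertex of $Pv$ or $Qv$ they are declared equal, otherwise $Pv<_{\mathscr I(v)}Qv$ iff the edge of $P$ entering $w$ precedes the edge of $Q$ entering $w$ in $\le_{\mathrm{In}(w)}$. Dually, for $vP,vQ$ starting at $v$, let $w'$ be the last vertex before which they coincide; if $w'$ is the last vertex of $vP$ or $vQ$ they are equal, otherwise $vP<_{\mathscr O(v)}vQ$ iff the edge of $P$ leaving $w'$ precedes that of $Q$ in $\le_{\mathrm{Out}(w')}$. A vertex of a path is inner if it is neither its first nor its last vertex. For paths $P,Q$ with common inner vertex $v$, write $P<_v^{cw}Q$ if $Pv<_{\mathscr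 I(v)}Qv$ and $vQ<_{\mathscr O(v)}vP$; $P,Q$ are incoherent at $v$ if $P<_v^{cw}Q$ or $Q<_v^{cw}P$, and coherent if they are not incoherent at any common inner vertex. A clique is a set of pairwise coherent routes. For maximal cliques $C,C'$ write $C\lessdot C'$ if $C'=(C\setminus\{R\})\cup\{R'\}$ for routes $R\ne R'$ with $R<_v^{cw}R'$ for some vertex $v$. The framing poset $\mathscr{L}_{G,F}$ is the set of maximal cliques ordered by the reflexive-transitive closure of $\lessdot$. A polygon in a lattice is an interval $[x,y]$ that is the union of two maximal chains from $x$ to $y$ which are disjoint except at $x$ and $y$. A lattice is polygonal if whenever distinct $y_1,y_2$ cover a common element $x$, $[x,y_1\vee y_2]$ is a polygon, and whenever distinct $y_1,y_2$ are covered by a common element $x$, $[y_1\wedge y_2,x]$ is a polygon. A lattice $\mathscr L$ is an $\mathcal{H}\mathcal{H}$-lattice if it is finite, semidistributive and polygonal and there exist a labeling $\ell$ of its cover relations by a set of labels $\mathcal L$ and a function $r:\mathcal L\to\mathbb N$ such that for every polygon $[x,y]$, with $x_1,x_2$ the elements covering $x$ and $y_1,y_2$ the elements covered by $y$, $x_1,y_1$ lying on one maximal chain and $x_2,y_2$ on the other: (1) $\ell(x,x_1)=\ell(y_2,y)$ and $\ell(x,x_2)=\ell(y_1,y)$; (2) if $t_1,\dots,t_k$ are the labels along a maximal chain of the polygon, then $r(t_1),r(t_k)<r(t_2),r(t_{k-1})<\cdots<r(t_{(k+1)/2})$ if $k$ is odd, and $r(t_1),r(t_k)<\cdots<r(t_{k/2}),r(t_{k/2+1})$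 if $k$ is even. A lattice is congruence uniform if it can be obtained from the one-element lattice by a sequence of doublings of intervals.
   Formalization: A polygon is additionally required to have its two maximal chains nontrivial, with inner elements of one incomparable to inner elements of the other; otherwise a product of a 2-chain and a 3-chain would count as a polygon and the labeling conditions would fail. -}

module Defs where

open import Level using (Level; 0ℓ)
open import Data.Nat as ℕ using (ℕ; zero; suc; _∸_; _⊓_)
open import Data.Fin as Fin using (Fin; toℕ; _≟_)
open import Data.Bool as Bool using (Bool; true; false; if_then_else_)
open import Data.Unit using (⊤; tt)
open import Data.Empty using (⊥)
open import Data.Product using (Σ; Σ-syntax; ∃; ∃-syntax; _×_; _,_; proj₁; proj₂; map₁)
open import Data.Sum using (_⊎_; inj₁; inj₂)
open import Data.Maybe as Maybe using (Maybe; just; nothing)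
open import Data.List as List using (List; []; _∷_; _++_; reverse; zipWith; length; lookup)
open import Data.List.NonEmpty as List⁺ using (List⁺; head; last; toList)
open import Data.List.Relation.Unary.Any using (Any)
open import Data.List.Relation.Unary.All using (All)
open import Data.List.Membership.Propositional using (_∈_)
open import Relation.Nullary using (¬_; does)
open import Relation.Binary using (Rel)
open import Relation.Binary.Structures using (IsPartialOrder)
open import Relation.Binary.Lattice.Structures using (IsLattice)
open import Relation.Binary.PropositionalEquality using (_≡_; _≢_; refl)
open import Relation.Binary.Construct.Closure.ReflexiveTransitive using (Star)
open import Function.Bundles using (_⇔_)

record FlowGraph : Set where
  field
    n m      : ℕ
    src tgt  : Fin m → Fin n
    forward  : ∀ e → src e Fin.< tgt e
    s t      : Fin n
    s-source : ∀ e → tgt e ≢ s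
    s-unique : ∀ v → (∀ e → tgt e ≢ v) → v ≡ s
    t-sink   : ∀ e → src e ≢ t
    t-unique : ∀ v → (∀ e → src e ≢ v) → v ≡ t

  Vertex : Set
  Vertex = Fin n

  Edge : Set
  Edge = Fin m

-- A framing: for every vertex v a linear order on In(v) and on Out(v).
-- A linear order on the finite set In(v) is given by a ranking of the
-- edges which is injective on In(v):  e ≤_In(v) e'  iff  inRank e ≤ inRank e'.
-- (Every linear order on a finite set arises this way.)
record Framing (G : FlowGraph) : Set where
  open FlowGraph G
  field
    inRank     : Edge → ℕ
    inRank-inj : ∀ e e' → tgt e ≡ tgt e' → inRank e ≡ inRank e' → e ≡ e'
    outRank     : Edge → ℕ
    outRank-inj : ∀ e e' → src e ≡ src e' → outRank e ≡ outRank e' → e ≡ e'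

record Pos : Set₁ where
  field
    Carrier : Set
    _≈_     : Rel Carrier 0ℓ
    _≤_     : Rel Carrier 0ℓ

module PosNotions (P : Pos) where
  open Pos P

  _<_ : Rel Carrier 0ℓ
  x < y = x ≤ y × ¬ (x ≈ y)

  _⋖_ : Rel Carrier 0ℓ
  x ⋖ y = x < y × (∀ z → x ≤ z → z ≤ y → (z ≈ x) ⊎ (z ≈ y))

  CoverPath : Carrier → List Carrier → Carrier → Set
  CoverPath x []       y = x ⋖ y
  CoverPath x (c ∷ cs) y = x ⋖ c × CoverPath c cs y

  _∈≈_ : Carrier → List Carrier → Set
  z ∈≈ cs = Any (z ≈_) cs

  -- [x,y] is a polygon: union of two maximal chains x ⋖ … ⋖ y with inner
  -- parts inner₁, inner₂ (each nonempty, so the chains are distinct)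
  -- meeting only in x and y; the inner elements of the two chains are
  -- pairwise incomparable.
  record Polygon (x y : Carrier) : Set where
    field
      inner₁ inner₂ : List⁺ Carrier
      chain₁ : CoverPath x (toList inner₁) y
      chain₂ : CoverPath x (toList inner₂) y
      union  : ∀ z → x ≤ z → z ≤ y →
               (z ≈ x) ⊎ (z ≈ y) ⊎ (z ∈≈ toList inner₁) ⊎ (z ∈≈ toList inner₂)
      disjoint : ∀ a b → a ∈ toList inner₁ → b ∈ toList inner₂ → ¬ (a ≈ b)
      separate : ∀ a b → a ∈ toList inner₁ → b ∈ toList inner₂ → ¬ (a ≤ b) × ¬ (b ≤ a)

  labelsAlong : {Lab : Set} → (Carrier → Carrier → Lab) →
                Carrier → List Carrier → Carrier → List Lab
  labelsAlong ℓ x cs y = zipWith ℓ (x ∷ cs) (cs ++ y ∷ [])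

  -- r(t₁), r(tₖ) < r(t₂), r(tₖ₋₁) < … : ranks strictly increase from
  -- both ends towards the middle; depth of position i (0-based) in a
  -- list of length k is min(i, k-1-i).
  RankCondition : {Lab : Set} → (Lab → ℕ) → List Lab → Set
  RankCondition r ts =
    ∀ (i j : Fin (length ts)) →
      (toℕ i ⊓ (length ts ∸ suc (toℕ i))) ℕ.< (toℕ j ⊓ (length ts ∸ suc (toℕ j))) →
      r (lookup ts i) ℕ.< r (lookup ts j)

  Finite : Set
  Finite = Σ[ xs ∈ List Carrier ] (∀ x → x ∈≈ xs)

  record IsHHLattice : Set₁ where
    field
      finite   : Finite
      _∨_ _∧_  : Carrier → Carrier → Carrier
      isLattice : IsLattice _≈_ _≤_ _∨_ _∧_
      join-semidistrib : ∀ x y z → (x ∨ y) ≈ (x ∨ z) → (x ∨ (y ∧ z)) ≈ (x ∨ y)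
      meet-semidistrib : ∀ x y z → (x ∧ y) ≈ (x ∧ z) → (x ∧ (y ∨ z)) ≈ (x ∧ y)
      polygonal-up   : ∀ x y₁ y₂ → x ⋖ y₁ → x ⋖ y₂ → ¬ (y₁ ≈ y₂) → Polygon x (y₁ ∨ y₂)
      polygonal-down : ∀ x y₁ y₂ → y₁ ⋖ x → y₂ ⋖ x → ¬ (y₁ ≈ y₂) → Polygon (y₁ ∧ y₂) x
      Label  : Set
      ℓ      : Carrier → Carrier → Label
      ℓ-cong : ∀ x x' y y' → x ≈ x' → y ≈ y' → ℓ x y ≡ ℓ x' y'
      r      : Label → ℕ
      hh1 : ∀ x y (p : Polygon x y) →
              let open Polygon p in
              ℓ x (head inner₁) ≡ ℓ (last inner₂) y ×
              ℓ x (head inner₂) ≡ ℓ (last inner₁) y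
      hh2 : ∀ x y (p : Polygon x y) →
              let open Polygon p in
              RankCondition r (labelsAlong ℓ x (toList inner₁) y) ×
              RankCondition r (labelsAlong ℓ x (toList inner₂) y)

  -- every polygon is a square, pentagon or hexagon: each of its two
  -- maximal chains has length 2 or 3 (i.e. 1 or 2 inner elements)
  PolygonsAreSmall : Set
  PolygonsAreSmall =
    ∀ x y (p : Polygon x y) →
      let open Polygon p in
      (List⁺.length inner₁ ≡ 1 ⊎ List⁺.length inner₁ ≡ 2) ×
      (List⁺.length inner₂ ≡ 1 ⊎ List⁺.length inner₂ ≡ 2)

record OrderIso (P Q : Pos) : Set where
  module P = Pos P
  module Q = Pos Q
  field
    to      : P.Carrier → Q.Carrier
    from    : Q.Carrier → P.Carrier
    to-cong   : ∀ {x y} → x P.≈ y → to x Q.≈ to y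
    from-cong : ∀ {x y} → x Q.≈ y → from x P.≈ from y
    to-from : ∀ y → to (from y) Q.≈ y
    from-to : ∀ x → from (to x) P.≈ x
    order   : ∀ x y → x P.≤ y ⇔ (to x Q.≤ to y)

onePos : Pos
onePos = record { Carrier = ⊤ ; _≈_ = λ _ _ → ⊤ ; _≤_ = λ _ _ → ⊤ }

-- Day's doubling P[I] of the interval I = [a,b]:
-- elements (x,0) for all x, and (x,1) for x ∈ I;
-- (x,i) ≤ (y,j) iff x ≤ y and, when x,y ∈ I, i ≤ j.
double : (P : Pos) → Pos.Carrier P → Pos.Carrier P → Pos
double P a b = record
  { Carrier = Σ[ xi ∈ Pos.Carrier P × Bool ] (proj₂ xi ≡ true → InI (proj₁ xi))
  ; _≈_ = λ { ((x , i) , _) ((y , j) , _) → (x ≈ y) × (i ≡ j) }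
  ; _≤_ = λ { ((x , i) , _) ((y , j) , _) → (x ≤ y) × (InI x → InI y → i Bool.≤ j) }
  }
  where
  open Pos P
  InI : Carrier → Set
  InI x = (a ≤ x) × (x ≤ b)

data ObtainedByDoublings : Pos → Set₁ where
  base  : ObtainedByDoublings onePos
  step  : ∀ {P} → ObtainedByDoublings P →
          (a b : Pos.Carrier P) → Pos._≤_ P a b →
          ObtainedByDoublings (double P a b)

CongruenceUniform : Pos → Set₁
CongruenceUniform L = Σ[ P ∈ Pos ] (ObtainedByDoublings P × OrderIso P L)

module Framed (G : FlowGraph) (F : Framing G) where
  open FlowGraph G
  open Framing F

  Walk : Vertex → List Edge → Vertex → Set
  Walk u []       w = u ≡ w
  Walk u (e ∷ es) w = (src e ≡ u) × Walk (tgt e) es w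

  IsRoute : List Edge → Set
  IsRoute es = Walk s es t

  splitAt : Vertex → Vertex → List Edge → Maybe (List Edge × List Edge)
  splitAt v u []       = if does (u ≟ v) then just ([] , []) else nothing
  splitAt v u (e ∷ es) =
    if does (u ≟ v) then just ([] , e ∷ es)
    else Maybe.map (map₁ (e ∷_)) (splitAt v (tgt e) es)

  lexLT : (Edge → ℕ) → List Edge → List Edge → Set
  lexLT rk []      _       = ⊥
  lexLT rk (_ ∷ _) []      = ⊥
  lexLT rk (a ∷ p) (b ∷ q) = ((a ≡ b) × lexLT rk p q) ⊎ ((a ≢ b) × (rk a ℕ.< rk b))

  -- Pv <_I(v) Qv : compare edge lists read backwards from v
  -- vP <_O(v) vQ : compare edge lists read forwards from v
  -- P <ᶜʷ_v Q  for paths P, Q (starting at s) with common inner vertex v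
  _<cw[_]_ : List Edge → Vertex → List Edge → Set
  P <cw[ v ] Q =
    Σ[ pP ∈ List Edge ] Σ[ sP ∈ List Edge ] Σ[ pQ ∈ List Edge ] Σ[ sQ ∈ List Edge ]
      (splitAt v s P ≡ just (pP , sP)) × (splitAt v s Q ≡ just (pQ , sQ)) ×
      (pP ≢ []) × (sP ≢ []) × (pQ ≢ []) × (sQ ≢ []) ×
      lexLT inRank (reverse pP) (reverse pQ) × lexLT outRank sQ sP

  Coherent : List Edge → List Edge → Set
  Coherent P Q = ∀ v → ¬ (P <cw[ v ] Q) × ¬ (Q <cw[ v ] P)

  record MaxClique : Set where
    field
      routes    : List (List Edge)
      areRoutes : All IsRoute routes
      coherent  : ∀ P Q → P ∈ routes → Q ∈ routes → Coherent P Q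
      maximal   : ∀ P → IsRoute P → (∀ Q → Q ∈ routes → Coherent P Q) → P ∈ routes
  open MaxClique

  _≈C_ : Rel MaxClique 0ℓ
  C ≈C C' = ∀ P → (P ∈ routes C) ⇔ (P ∈ routes C')

  Flip : Rel MaxClique 0ℓ
  Flip C C' = Σ[ R ∈ List Edge ] Σ[ R' ∈ List Edge ] Σ[ v ∈ Vertex ]
    (R ∈ routes C) × (R ≢ R') × (R <cw[ v ] R') ×
    (∀ P → (P ∈ routes C') ⇔ (((P ∈ routes C) × (P ≢ R)) ⊎ (P ≡ R')))

  -- reflexive-transitive closure (on cliques taken up to set equality)
  _≤C_ : Rel MaxClique 0ℓ
  _≤C_ = Star (λ C C' → (C ≈C C') ⊎ Flip C C')

  framingPoset : Pos
  framingPoset = record { Carrier = MaxClique ; _≈_ = _≈C_ ; _≤_ = _≤C_ }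

FramingPoset : (G : FlowGraph) → Framing G → Pos
FramingPoset G F = Framed.framingPoset G F

{-# OPTIONS --safe #-}
-- A string is a path p together with a gap between two consecutive edges entering its first
-- vertex and a gap between two consecutive edges leaving its last vertex.  Two routes are
-- incoherent exactly when they cross some string in opposite directions: downwards (entering
-- above the first gap, leaving below the second) and upwards.  A string may itself be crossed by
-- a longer one, as a quotient when downwards and as a sub when upwards, and a maximal clique C
-- behaves like a torsion pair (T , F) of strings: going through the strings from short to long, a
-- string all of whose proper quotients are in T and all of whose proper subs are in F is put in T
-- or in F according to the way in which C crosses it, and this choice is free; every other
-- string is forced.  A route belongs to C if and only if the strings it crosses downwards are
-- in T and those it crosses upwards are in F.  A flip upwards enlarges T, and conversely a cover
-- in the inclusion order of the classes T exchanges a single route, so the framing poset is this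
-- inclusion order.  The free choices exhibit it as an iterated doubling of intervals, one string
-- at a time; meets intersect the T and joins intersect the F, which gives semidistributivity.
-- A cover is labelled by the unique string passing from F to T.  In a polygon with bottom labels
-- σ₁ and σ₂, an inner label on the side beginning with σ₁ is a concatenation of σ₁ and σ₂ with
-- σ₁ as quotient, and there is at most one such string.
module Submission where

open import Defs
open import Data.Bool as Bool using (Bool; true; false; not; _∧_; f≤t; b≤b; _∨_; if_then_else_)
open import Data.Empty using (⊥; ⊥-elim)
open import Data.Fin as Fin using (Fin; zero; suc; toℕ)
open import Data.Fin.Induction using (<-wellFounded; Acc; acc)
import Data.Fin.Properties as Finₚ
open import Data.List as List using (List; []; _∷_; _++_; _∷ʳ_; map; filter; allFin; lookup; length; deduplicate; cartesianProduct; cartesianProductWith; initLast; _∷ʳ′_; reverse)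
open import Data.List.Membership.Propositional using (_∈_; lose; find)
open import Data.List.Membership.Propositional.Properties using (∈-filter⁺; ∈-filter⁻; ∈-allFin; ∈-map⁺; ∈-map⁻; ∈-deduplicate⁺; ∈-deduplicate⁻; ∈-lookup; ∈-cartesianProduct⁺; ∈-cartesianProductWith⁺)
open import Data.List.NonEmpty as List⁺ using (List⁺; _∷_; head; last; toList)
open import Data.List.Properties using (++-assoc; ++-identityʳ; ++-cancelˡ; ∷-injective; ∷ʳ-injective; length-++; ≡-dec; reverse-involutive; reverse-++; unfold-reverse)
open import Data.List.Relation.Binary.Permutation.Propositional using (↭⇒↭ₛ; ↭-sym)
open import Data.List.Relation.Binary.Permutation.Propositional.Properties using (∈-resp-↭)
import Data.List.Relation.Binary.Permutation.Setoid.Properties as ↭ₛ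
open import Data.List.Relation.Unary.All as All using (All; []; _∷_)
open import Data.List.Relation.Unary.All.Properties using (all-filter)
open import Data.List.Relation.Unary.AllPairs using ([]; _∷_)
open import Data.List.Relation.Unary.Any using (here; there; index; Any; any?)
open import Data.List.Relation.Unary.Any.Properties as Anyₚ using (lookup-index)
open import Data.List.Relation.Unary.Sorted.TotalOrder.Properties using (lookup-mono-≤)
open import Data.List.Relation.Unary.Unique.DecPropositional.Properties using (deduplicate-!)
open import Data.List.Relation.Unary.Unique.Propositional using (Unique)
open import Data.List.Reverse using (Reverse; reverseView; []; _∶_∶ʳ_)
import Data.List.Sort as Sort
open import Data.Maybe as Maybe using (Maybe; just; nothing; _<∣>_)
open import Data.Nat as ℕ using (ℕ; zero; suc; z≤n; s≤s)
import Data.Nat.Induction as ℕᵢ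
import Data.Nat.Properties as ℕₚ
open import Data.Product using (Σ; Σ-syntax; ∃; ∃-syntax; _×_; _,_; proj₁; proj₂; map₁)
open import Data.Product.Properties using () renaming (≡-dec to ×-≡-dec)
open import Data.Sum using (_⊎_; inj₁; inj₂; [_,_]′; swap)
open import Data.Unit using (tt)
open import Level using (0ℓ)
open import Function using (_∘_; id; flip)
open import Function.Bundles using (_⇔_; mk⇔; Equivalence)
open import Relation.Binary.Bundles using (DecTotalOrder)
open import Relation.Binary.Construct.Closure.ReflexiveTransitive as Star using (Star; ε; _◅_; _◅◅_)
import Relation.Binary.Construct.On as On
open import Relation.Binary.Definitions using (tri<; tri≈; tri>; DecidableEquality)
open import Relation.Binary.Lattice.Structures using (IsLattice)
open import Relation.Binary.PropositionalEquality using (_≡_; _≢_; refl; sym; trans; cong; subst; cong₂; setoid; module ≡-Reasoning; subst₂)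
open import Relation.Nullary using (¬_; Dec; yes; no; does; contradiction)
open import Relation.Nullary.Decidable using (_×-dec_; ¬?; decidable-stable; _→-dec_; dec-true; dec-false; _⊎-dec_; map′; does-⇔)

-- The obstacle to speaking of quotients and subs is a pair of strings on the same path with
-- different gaps: if `σ` crosses `τ` downwards along that path, then `τ` crosses `σ` upwards, and
-- neither is canonically the smaller one. The enumeration by length breaks such ties arbitrarily,
-- `Q` and `U` keep only the pairs with increasing index, and `T-D̄` and `label-D̄` recover the
-- closure properties on the other side of the tie. A pair (T , F) need not exhaust the strings: one
-- with a quotient outside T and a sub outside F lies in neither. Hence the recurring choice of a
-- least bad string: its quotients (or subs) are good, so that it is decided after all. There are
-- two symmetries. Turning all letter orders upside down exchanges T with F and dualises the
-- lattice; reading walks backwards exchanges left with right. The interfaces `System`, `Geo` and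
-- `Linked` are closed under them, so that an argument given for one of the four situations is
-- available in the others as an instance.

-- Induction and counting on finite index sets

strongInduction : ∀ {n} (P : Fin n → Set) → (∀ i → (∀ j → j Fin.< i → P j) → P i) → ∀ i → P i
strongInduction P ind i = go i (<-wellFounded i)
  where
  go : ∀ i → Acc Fin._<_ i → P i
  go i (acc rs) = ind i (λ j j<i → go j (rs j<i))

least : ∀ {n} {P : Fin n → Set} → (∀ i → Dec (P i)) → ∀ i → P i →
        ∃[ j ] (P j × (∀ k → k Fin.< j → ¬ P k))
least {P = P} P? = strongInduction _ λ i rec pi →
  case-any i rec pi (Finₚ.any? (λ j → (j Finₚ.<? i) ×-dec P? j))
  where
  case-any : ∀ i → (∀ j → j Fin.< i → P j → _) → P i → Dec _ → _
  case-any i rec pi (yes (j , j<i , pj)) = rec j j<i pj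
  case-any i rec pi (no none) = i , pi , λ k k<i pk → none (k , k<i , pk)

count : ∀ {n} {P : Fin n → Set} → (∀ i → Dec (P i)) → ℕ
count {zero} P? = 0
count {suc n} P? with P? zero
... | yes _ = suc (count (P? ∘ suc))
... | no  _ = count (P? ∘ suc)

count-mono : ∀ {n} {P R : Fin n → Set} (P? : ∀ i → Dec (P i)) (R? : ∀ i → Dec (R i)) →
             (∀ i → P i → R i) → count P? ℕ.≤ count R?
count-mono {zero} P? R? P⊆R = z≤n
count-mono {suc n} P? R? P⊆R with P? zero | R? zero
... | yes p | yes _ = s≤s (count-mono (P? ∘ suc) (R? ∘ suc) (P⊆R ∘ suc))
... | yes p | no ¬r = contradiction (P⊆R zero p) ¬r
... | no _  | yes _ = ℕₚ.m≤n⇒m≤1+n (count-mono (P? ∘ suc) (R? ∘ suc) (P⊆R ∘ suc))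
... | no _  | no _  = count-mono (P? ∘ suc) (R? ∘ suc) (P⊆R ∘ suc)

count-strict : ∀ {n} {P R : Fin n → Set} (P? : ∀ i → Dec (P i)) (R? : ∀ i → Dec (R i)) →
               (∀ i → P i → R i) → ∀ k → R k → ¬ P k → count P? ℕ.< count R?
count-strict {suc n} P? R? P⊆R zero r ¬p with P? zero | R? zero
... | yes p | _ = contradiction p ¬p
... | no _ | yes _ = s≤s (count-mono (P? ∘ suc) (R? ∘ suc) (P⊆R ∘ suc))
... | no _ | no ¬r = contradiction r ¬r
count-strict {suc n} P? R? P⊆R (suc k) r ¬p with P? zero | R? zero
... | yes p | yes _ = s≤s (count-strict (P? ∘ suc) (R? ∘ suc) (P⊆R ∘ suc) k r ¬p)
... | yes p | no ¬r = contradiction (P⊆R zero p) ¬r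
... | no _  | yes _ = ℕₚ.m<n⇒m<1+n (count-strict (P? ∘ suc) (R? ∘ suc) (P⊆R ∘ suc) k r ¬p)
... | no _  | no _  = count-strict (P? ∘ suc) (R? ∘ suc) (P⊆R ∘ suc) k r ¬p

-- A combinatorial model of a lattice of torsion classes.  The indices are the bricks,
-- Q ρ σ and U ρ σ say that ρ is a proper quotient, resp. a proper sub, of σ, and an
-- element x is the torsion pair (T x , F x).  A brick all of whose proper quotients are in
-- T x and all of whose proper subs are in F x may be put on either side independently of
-- everything before it: this is what mk expresses.
record System : Set₁ where
  field
    N       : ℕ
    X       : Set
    Q U     : Fin N → Fin N → Set
    Q?      : ∀ ρ σ → Dec (Q ρ σ)
    U?      : ∀ ρ σ → Dec (U ρ σ)
    Q-<     : ∀ {ρ σ} → Q ρ σ → ρ Fin.< σ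
    U-<     : ∀ {ρ σ} → U ρ σ → ρ Fin.< σ
    Q-trans : ∀ {ρ σ τ} → Q ρ σ → Q σ τ → Q ρ τ
    U-trans : ∀ {ρ σ τ} → U ρ σ → U σ τ → U ρ τ
    QU⊥     : ∀ {ρ σ} → Q ρ σ → U ρ σ → ⊥
    T F     : X → Fin N → Set
    T?      : ∀ x σ → Dec (T x σ)
    F?      : ∀ x σ → Dec (F x σ)
    TF⊥     : ∀ {x σ} → T x σ → F x σ → ⊥
    T-Q     : ∀ {x ρ σ} → T x σ → Q ρ σ → T x ρ
    F-U     : ∀ {x ρ σ} → F x σ → U ρ σ → F x ρ
    Q-TF    : ∀ {x σ} → (∀ ρ → Q ρ σ → T x ρ) → T x σ ⊎ F x σ
    U-TF    : ∀ {x σ} → (∀ ρ → U ρ σ → F x ρ) → T x σ ⊎ F x σ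
    mk      : (Fin N → Bool) → X
    mk-T    : ∀ c {σ} → c σ ≡ true  → (∀ ρ → Q ρ σ → T (mk c) ρ) → T (mk c) σ
    mk-F    : ∀ c {σ} → c σ ≡ false → (∀ ρ → U ρ σ → F (mk c) ρ) → F (mk c) σ

dual : System → System
dual S = record
  { N = N ; X = X ; Q = U ; U = Q ; Q? = U? ; U? = Q? ; Q-< = U-< ; U-< = Q-<
  ; Q-trans = U-trans ; U-trans = Q-trans ; QU⊥ = λ u q → QU⊥ q u
  ; T = F ; F = T ; T? = F? ; F? = T? ; TF⊥ = λ f t → TF⊥ t f
  ; T-Q = F-U ; F-U = T-Q ; Q-TF = swap ∘ U-TF ; U-TF = swap ∘ Q-TF
  ; mk = λ c → mk (not ∘ c)
  ; mk-T = λ c eq → mk-F (not ∘ c) (cong not eq)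
  ; mk-F = λ c eq → mk-T (not ∘ c) (cong not eq) }
  where open System S

-- Order, meets and joins of torsion pairs

module Order (S : System) where
  open System S

  infix 4 _⊑_ _≋_
  _⊑_ : X → X → Set
  x ⊑ y = ∀ σ → T x σ → T y σ

  _≋_ : X → X → Set
  x ≋ y = (x ⊑ y) × (y ⊑ x)

  _⊑?_ : ∀ x y → Dec (x ⊑ y)
  x ⊑? y = Finₚ.all? (λ σ → T? x σ →-dec T? y σ)

  ⊑-trans : ∀ {x y z} → x ⊑ y → y ⊑ z → x ⊑ z
  ⊑-trans p q σ = q σ ∘ p σ

  AllQ AllU : X → Fin N → Set
  AllQ x σ = ∀ ρ → Q ρ σ → T x ρ
  AllU x σ = ∀ ρ → U ρ σ → F x ρ

  T≢F : ∀ {x ρ σ} → T x ρ → F x σ → ρ ≢ σ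
  T≢F t f refl = TF⊥ t f

  ¬Q-refl : ∀ {σ} → ¬ Q σ σ
  ¬Q-refl = ℕₚ.<-irrefl refl ∘ Q-<

  -- By induction the subs of `σ` are in `F x`, so `U-TF` decides `σ` in `x`, and `x ⊑ y` excludes
  -- the side `T`. With the dual statement, enlarging `T` is the same as shrinking `F`, although the
  -- two need not be complementary.
  ⊑⇒F : ∀ {x y} → x ⊑ y → ∀ σ → F y σ → F x σ
  ⊑⇒F {x} {y} x⊑y = strongInduction _ λ σ rec fy →
    [ (λ tx → ⊥-elim (TF⊥ (x⊑y σ tx) fy)) , id ]′
    (U-TF (λ ρ u → rec ρ (U-< u) (F-U fy u)))

  leastNonT : ∀ {x σ} → ¬ AllQ x σ → ∃[ ρ ] (Q ρ σ × ¬ T x ρ × AllQ x ρ)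
  leastNonT {x} {σ} ¬all with Finₚ.any? (λ ρ → Q? ρ σ ×-dec ¬? (T? x ρ))
  ... | no none = ⊥-elim (¬all λ ρ q → decidable-stable (T? x ρ) (λ ¬t → none (ρ , q , ¬t)))
  ... | yes (ρ , qt) with least (λ ρ → Q? ρ σ ×-dec ¬? (T? x ρ)) ρ qt
  ...   | ρ , (q , ¬t) , min =
    ρ , q , ¬t , λ κ qκ → decidable-stable (T? x κ) λ ¬tκ → min κ (Q-< qκ) (Q-trans qκ q , ¬tκ)

  allQ? : ∀ x σ → Dec (AllQ x σ)
  allQ? x σ = Finₚ.all? (λ ρ → Q? ρ σ →-dec T? x ρ)

module Lattice (S : System) where
  open System S
  open Order S public
  private module D = Order (dual S)

  F⇒⊑ : ∀ {x y} → (∀ σ → F y σ → F x σ) → x ⊑ y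
  F⇒⊑ = D.⊑⇒F

  -- The quotients of a brick of `T x` are in `T x` again, so the condition in `mk-T` is met by
  -- induction and `c` is consulted on `T x` only.
  ⊑-mk : ∀ {x} c → (∀ σ → T x σ → c σ ≡ true) → x ⊑ mk c
  ⊑-mk c h = strongInduction _ λ σ rec t → mk-T c (h σ t) λ ρ q → rec ρ (Q-< q) (T-Q t q)

  mk-⊑ : ∀ {x} c → (∀ σ → F x σ → c σ ≡ false) → mk c ⊑ x
  mk-⊑ c h = F⇒⊑ (strongInduction _ λ σ rec f → mk-F c (h σ f) λ ρ u → rec ρ (U-< u) (F-U f u))

  infixl 7 _⊓_
  _⊓_ : X → X → X
  x ⊓ y = mk (λ σ → does (T? x σ ×-dec T? y σ))

  ⊓-lb₁ : ∀ x y → x ⊓ y ⊑ x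
  ⊓-lb₁ x y = mk-⊑ _ λ σ f → dec-false (T? x σ ×-dec T? y σ) (λ (t , _) → TF⊥ t f)

  ⊓-lb₂ : ∀ x y → x ⊓ y ⊑ y
  ⊓-lb₂ x y = mk-⊑ _ λ σ f → dec-false (T? x σ ×-dec T? y σ) (λ (_ , t) → TF⊥ t f)

  T-⊓ : ∀ {x y} σ → T x σ → T y σ → T (x ⊓ y) σ
  T-⊓ {x} {y} = strongInduction _ λ σ rec tx ty →
    mk-T _ (dec-true (T? x σ ×-dec T? y σ) (tx , ty)) λ ρ q → rec ρ (Q-< q) (T-Q tx q) (T-Q ty q)

  ⊓-glb : ∀ {x y z} → z ⊑ x → z ⊑ y → z ⊑ x ⊓ y
  ⊓-glb p q σ t = T-⊓ σ (p σ t) (q σ t)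

module Joins (S : System) where
  open System S
  open Lattice S
  module Dᴸ = Lattice (dual S)

  infixl 6 _⊔_
  _⊔_ : X → X → X
  _⊔_ = Dᴸ._⊓_

  ⊔-ub₁ : ∀ x y → x ⊑ x ⊔ y
  ⊔-ub₁ x y = F⇒⊑ (Dᴸ.⊓-lb₁ x y)

  ⊔-ub₂ : ∀ x y → y ⊑ x ⊔ y
  ⊔-ub₂ x y = F⇒⊑ (Dᴸ.⊓-lb₂ x y)

  F-⊔ : ∀ {x y} σ → F x σ → F y σ → F (x ⊔ y) σ
  F-⊔ = Dᴸ.T-⊓

  ⊔-lub : ∀ {x y z} → x ⊑ z → y ⊑ z → x ⊔ y ⊑ z
  ⊔-lub p q = F⇒⊑ λ σ f → F-⊔ σ (⊑⇒F p σ f) (⊑⇒F q σ f)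

  -- Joins a of x, y and b of x, z, and a meet m of y, z, are given by their defining
  -- properties only, so that the dual statement is an instance.
  semidistributive : ∀ {x y z a b m} → x ⊑ a → y ⊑ a → (∀ σ → F x σ → F y σ → F a σ) →
                     z ⊑ b → (∀ σ → F x σ → F z σ → F b σ) → a ≋ b →
                     (∀ σ → T y σ → T z σ → T m σ) → ∀ σ → F x σ → F m σ → F a σ
  semidistributive {x} {y} {z} {a} {b} {m} x⊑a y⊑a F-a z⊑b F-b (a⊑b , b⊑a) T-m =
    strongInduction _ λ σ rec fx fm →
      -- The subs of `σ` are in `F a` by induction, hence in `F y`, and in `F z` because `a ≋ b`. So
      -- `σ` is decided both in `y` and in `z`; if either puts it in F, the corresponding join does
      -- too.
      let fa : ∀ ρ → U ρ σ → F a ρ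
          fa ρ u = rec ρ (U-< u) (F-U fx u) (F-U fm u)
      in cases σ fx fm (U-TF {y} λ ρ u → ⊑⇒F y⊑a ρ (fa ρ u))
                       (U-TF {z} λ ρ u → ⊑⇒F z⊑b ρ (⊑⇒F b⊑a ρ (fa ρ u)))
    where
    cases : ∀ σ → F x σ → F m σ → T y σ ⊎ F y σ → T z σ ⊎ F z σ → F a σ
    cases σ fx fm (inj₂ fy) _ = F-a σ fx fy
    cases σ fx fm (inj₁ _) (inj₂ fz) = ⊑⇒F a⊑b σ (F-b σ fx fz)
    cases σ fx fm (inj₁ ty) (inj₁ tz) = ⊥-elim (TF⊥ (T-m σ ty tz) fm)

-- Covers and their labels

-- A cover described by what moves: `σ` changes sides, any other brick leaving F has `σ` as a sub,
-- and any other brick entering T has `σ` as a quotient. `Cov⇒⋖` and `⋖⇒Cov` identify this with the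
-- covering relation of the order.
record Cov (S : System) (x y : System.X S) (σ : Fin (System.N S)) : Set where
  open System S
  field
    below : Order._⊑_ S x y
    Fσ    : F x σ
    Tσ    : T y σ
    Qσ    : Order.AllQ S x σ
    Uσ    : Order.AllU S y σ
    ΔF    : ∀ ρ → F x ρ → ¬ F y ρ → ρ ≡ σ ⊎ U σ ρ
    ΔT    : ∀ ρ → T y ρ → ¬ T x ρ → ρ ≡ σ ⊎ Q σ ρ

Cov-undual : ∀ S {x y σ} → Cov (dual S) y x σ → Cov S x y σ
Cov-undual S c = record
  { below = Lattice.F⇒⊑ S below ; Fσ = Tσ ; Tσ = Fσ ; Qσ = Uσ ; Uσ = Qσ ; ΔF = ΔT ; ΔT = ΔF }
  where open Cov c

Cov-dual : ∀ S {x y σ} → Cov S x y σ → Cov (dual S) y x σ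
Cov-dual S c = record
  { below = Order.⊑⇒F S below ; Fσ = Tσ ; Tσ = Fσ ; Qσ = Uσ ; Uσ = Qσ ; ΔF = ΔT ; ΔT = ΔF }
  where open Cov c

module Cover (S : System) where
  open System S
  open Lattice S
  open Cov

  -- All quotients of `ρ` are also in `T y`, so `y` decides `ρ`. If it went to `T y`, then `ΔF` and
  -- `ΔT` would make `σ` both a sub and a quotient of `ρ`, unless `ρ` is `σ`.
  F-free : ∀ {x y σ} → Cov S x y σ → ∀ ρ → AllQ x ρ → F x ρ → ρ ≡ σ ⊎ F y ρ
  F-free {x} {y} {σ} c ρ allQ fx with F? y ρ
  ... | yes fy = inj₂ fy
  ... | no ¬fy with Q-TF {y} (λ κ q → below c κ (allQ κ q))
  ...   | inj₂ fy = inj₂ fy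
  ...   | inj₁ ty with ΔF c ρ fx ¬fy | ΔT c ρ ty (λ t → TF⊥ t fx)
  ...     | inj₁ eq | _ = inj₁ eq
  ...     | inj₂ u  | inj₁ eq = inj₁ eq
  ...     | inj₂ u  | inj₂ q = ⊥-elim (QU⊥ q u)

  label-unique : ∀ {x y σ} → Cov S x y σ → ∀ ρ → F x ρ → T y ρ → ρ ≡ σ
  label-unique c ρ fx ty with ΔF c ρ fx (TF⊥ ty) | ΔT c ρ ty (λ t → TF⊥ t fx)
  ... | inj₁ eq | _ = eq
  ... | inj₂ _  | inj₁ eq = eq
  ... | inj₂ u  | inj₂ q = ⊥-elim (QU⊥ q u)

  -- A brick of `F z` outside `F y` is `σ` or has `σ` as a sub, and `F z` is closed under subs. Thus
  -- `y` is least above `x` with `σ` in T; dually, `below-cover` makes `x` greatest below `y`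
  -- without it.
  above-cover : ∀ {x y z σ} → Cov S x y σ → x ⊑ z → T z σ → y ⊑ z
  above-cover {x} {y} {z} {σ} c x⊑z tz = F⇒⊑ go
    where
    go : ∀ ρ → F z ρ → F y ρ
    go ρ fz = decidable-stable (F? y ρ) λ ¬fy →
      [ (λ { refl → TF⊥ tz fz }) , (λ u → TF⊥ tz (F-U fz u)) ]′ (ΔF c ρ (⊑⇒F x⊑z ρ fz) ¬fy)

  below-cover : ∀ {x y z σ} → Cov S x y σ → z ⊑ y → ¬ T z σ → z ⊑ x
  below-cover {x} {y} {z} {σ} c z⊑y ¬tz ρ tz = decidable-stable (T? x ρ) λ ¬tx →
      [ (λ { refl → ¬tz tz }) , (λ q → ¬tz (T-Q tz q)) ]′ (ΔT c ρ (z⊑y ρ tz) ¬tx)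

  Cov⇒⋖ : ∀ {x y σ} → Cov S x y σ → ∀ z → x ⊑ z → z ⊑ y → z ≋ x ⊎ z ≋ y
  Cov⇒⋖ {σ = σ} c z x⊑z z⊑y with T? z σ
  ... | yes t = inj₂ (z⊑y , above-cover c x⊑z t)
  ... | no ¬t = inj₁ (below-cover c z⊑y ¬t , x⊑z)

  Cov⇒⋢ : ∀ {x y σ} → Cov S x y σ → ¬ (y ⊑ x)
  Cov⇒⋢ {σ = σ} c y⊑x = TF⊥ (y⊑x σ (Tσ c)) (Fσ c)

  -- Quotients in T persist upwards and subs in F persist downwards, so `σ` is free at every element
  -- between `x` and `y`.
  record Separates (x y : X) (σ : Fin N) : Set where
    constructor separates
    field
      F-lo : F x σ
      T-hi : T y σ
      Q-lo : AllQ x σ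
      U-hi : AllU y σ

  -- The witness is the least brick on which x and y disagree.
  separate : ∀ {x y} → x ⊑ y → ¬ (y ⊑ x) → ∃[ σ ] Separates x y σ
  separate {x} {y} x⊑y y⋢x with Finₚ.any? (λ σ → T? y σ ×-dec ¬? (T? x σ))
  ... | no none = ⊥-elim (y⋢x λ σ t → decidable-stable (T? x σ) λ ¬t → none (σ , t , ¬t))
  ... | yes (σ₀ , h) with least (λ σ → T? y σ ×-dec ¬? (T? x σ)) σ₀ h
  ...   | σ , (ty , ¬tx) , min = σ , separates fx ty allQ allU
    where
    T-below : ∀ ρ → ρ Fin.< σ → T y ρ → T x ρ
    T-below ρ ρ<σ t = decidable-stable (T? x ρ) λ ¬t → min ρ ρ<σ (t , ¬t)
    allQ : AllQ x σ
    allQ ρ q = T-below ρ (Q-< q) (T-Q ty q)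
    fx : F x σ
    fx = [ (λ t → ⊥-elim (¬tx t)) , id ]′ (Q-TF allQ)
    F-below : ∀ ρ → ρ Fin.< σ → F x ρ → F y ρ
    F-below = strongInduction _ λ ρ rec ρ<σ f →
      [ (λ t → ⊥-elim (TF⊥ (T-below ρ ρ<σ t) f)) , id ]′
      (U-TF λ κ u → rec κ (U-< u) (Finₚ.<-trans (U-< u) ρ<σ) (F-U f u))
    allU : AllU y σ
    allU ρ u = F-below ρ (U-< u) (F-U fx u)

  -- Here `x` and `y` may be incomparable, so the least brick is sought in `T x` and `F y`. If there
  -- is none, then inductively each brick of `T x` has its quotients in `T y`, is decided by `y`,
  -- and must be in `T y`.
  disagree : ∀ {x y} → ¬ (x ⊑ y) →
             ∃[ ρ ] (T x ρ × F y ρ × AllU x ρ × AllQ y ρ)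
  disagree {x} {y} x⋢y with Finₚ.any? (λ σ → T? x σ ×-dec F? y σ)
  ... | no none = ⊥-elim (x⋢y (strongInduction _ λ σ rec t →
          [ id , (λ f → ⊥-elim (none (σ , t , f))) ]′ (Q-TF λ ρ q → rec ρ (Q-< q) (T-Q t q))))
  ... | yes (σ₀ , h) with least (λ σ → T? x σ ×-dec F? y σ) σ₀ h
  ...   | σ , (tx , fy) , min = σ , tx , fy , allU , allQ
    where
    F-below : ∀ ρ → ρ Fin.< σ → F y ρ → F x ρ
    F-below = strongInduction _ λ ρ rec ρ<σ f →
      [ (λ t → ⊥-elim (min ρ ρ<σ (t , f))) , id ]′
      (U-TF λ κ u → rec κ (U-< u) (Finₚ.<-trans (U-< u) ρ<σ) (F-U f u))
    T-below : ∀ ρ → ρ Fin.< σ → T x ρ → T y ρ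
    T-below = strongInduction _ λ ρ rec ρ<σ t →
      [ id , (λ f → ⊥-elim (min ρ ρ<σ (t , f))) ]′
      (Q-TF λ κ q → rec κ (Q-< q) (Finₚ.<-trans (Q-< q) ρ<σ) (T-Q t q))
    allU : AllU x σ
    allU ρ u = F-below ρ (U-< u) (F-U fy u)
    allQ : AllQ y σ
    allQ ρ q = T-below ρ (Q-< q) (T-Q tx q)

  -- `lo` is the greatest element below `y` without `σ` in T, and `hi` differs from it by the choice
  -- at `σ` alone. Hence every separating brick is the label of a cover inside the interval.
  module Between {x y : X} {σ : Fin N} (x⊑y : x ⊑ y) (sep : Separates x y σ) where
    open Separates sep

    lo-choice : Fin N → Bool
    lo-choice ρ = does (T? y ρ ×-dec ¬? (ρ Finₚ.≟ σ))

    lo : X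
    lo = mk lo-choice

    hi-choice : Fin N → Bool
    hi-choice ρ = does (T? lo ρ ⊎-dec (ρ Finₚ.≟ σ))

    hi : X
    hi = mk hi-choice

    x⊑lo : x ⊑ lo
    x⊑lo = ⊑-mk lo-choice λ ρ t →
      dec-true (T? y ρ ×-dec ¬? (ρ Finₚ.≟ σ)) (x⊑y ρ t , T≢F t F-lo)

    lo⊑y : lo ⊑ y
    lo⊑y = mk-⊑ lo-choice λ ρ f → dec-false (T? y ρ ×-dec ¬? (ρ Finₚ.≟ σ)) (λ (t , _) → TF⊥ t f)

    F-lo-σ : F lo σ
    F-lo-σ = mk-F lo-choice (dec-false (T? y σ ×-dec ¬? (σ Finₚ.≟ σ)) (λ (_ , n) → n refl))
                  (λ ρ u → ⊑⇒F lo⊑y ρ (U-hi ρ u))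

    lo⊑hi : lo ⊑ hi
    lo⊑hi = ⊑-mk hi-choice λ ρ t → dec-true (T? lo ρ ⊎-dec (ρ Finₚ.≟ σ)) (inj₁ t)

    allQ : AllQ lo σ
    allQ ρ q = x⊑lo ρ (Q-lo ρ q)

    T-hi-σ : T hi σ
    T-hi-σ = mk-T hi-choice (dec-true (T? lo σ ⊎-dec (σ Finₚ.≟ σ)) (inj₂ refl))
                  (λ ρ q → lo⊑hi ρ (allQ ρ q))

    -- A brick leaves F either because one of its subs does, and then induction and transitivity of
    -- `U` lead back to `σ`, or by a change of choice, and `σ` is the only one.
    ΔF-lo-hi : ∀ ρ → F lo ρ → ¬ F hi ρ → ρ ≡ σ ⊎ U σ ρ
    ΔF-lo-hi = strongInduction _ λ ρ rec f ¬f → go ρ rec f ¬f (Finₚ.any? λ κ → U? κ ρ ×-dec ¬? (F? hi κ))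
      where
      go : ∀ ρ → (∀ κ → κ Fin.< ρ → F lo κ → ¬ F hi κ → κ ≡ σ ⊎ U σ κ) → F lo ρ → ¬ F hi ρ →
           Dec (∃[ κ ] (U κ ρ × ¬ F hi κ)) → ρ ≡ σ ⊎ U σ ρ
      go ρ rec f ¬f (yes (κ , u , ¬fκ)) =
        inj₂ ([ (λ { refl → u }) , (λ u′ → U-trans u′ u) ]′ (rec κ (U-< u) (F-U f u) ¬fκ))
      go ρ rec f ¬f (no none) with ρ Finₚ.≟ σ
      ... | yes eq = inj₁ eq
      ... | no ρ≢σ = ⊥-elim (¬f (mk-F hi-choice
              (dec-false (T? lo ρ ⊎-dec (ρ Finₚ.≟ σ)) [ (λ t → TF⊥ t f) , ρ≢σ ]′)
              (λ κ u → decidable-stable (F? hi κ) λ ¬fκ → none (κ , u , ¬fκ))))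

    hi⊑y : hi ⊑ y
    hi⊑y = F⇒⊑ λ ρ f → decidable-stable (F? hi ρ) λ ¬f →
      [ (λ { refl → TF⊥ T-hi f }) , (λ u → TF⊥ T-hi (F-U f u)) ]′ (ΔF-lo-hi ρ (⊑⇒F lo⊑y ρ f) ¬f)

    ΔT-lo-hi : ∀ ρ → T hi ρ → ¬ T lo ρ → ρ ≡ σ ⊎ Q σ ρ
    ΔT-lo-hi = strongInduction _ λ ρ rec t ¬t → go ρ rec t ¬t (Finₚ.any? λ κ → Q? κ ρ ×-dec ¬? (T? lo κ))
      where
      go : ∀ ρ → (∀ κ → κ Fin.< ρ → T hi κ → ¬ T lo κ → κ ≡ σ ⊎ Q σ κ) → T hi ρ → ¬ T lo ρ →
           Dec (∃[ κ ] (Q κ ρ × ¬ T lo κ)) → ρ ≡ σ ⊎ Q σ ρ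
      go ρ rec t ¬t (yes (κ , q , ¬tκ)) =
        inj₂ ([ (λ { refl → q }) , (λ q′ → Q-trans q′ q) ]′ (rec κ (Q-< q) (T-Q t q) ¬tκ))
      go ρ rec t ¬t (no none) with ρ Finₚ.≟ σ
      ... | yes eq = inj₁ eq
      ... | no ρ≢σ = ⊥-elim (¬t (mk-T lo-choice
              (dec-true (T? y ρ ×-dec ¬? (ρ Finₚ.≟ σ)) (hi⊑y ρ t , ρ≢σ))
              (λ κ q → decidable-stable (T? lo κ) λ ¬tκ → none (κ , q , ¬tκ))))

    cov : Cov S lo hi σ
    cov = record
      { below = lo⊑hi ; Fσ = F-lo-σ ; Tσ = T-hi-σ ; Qσ = allQ
      ; Uσ = λ ρ u → ⊑⇒F hi⊑y ρ (U-hi ρ u) ; ΔF = ΔF-lo-hi ; ΔT = ΔT-lo-hi }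

  Cov-resp : ∀ {x x′ y y′ σ} → x ≋ x′ → y ≋ y′ → Cov S x y σ → Cov S x′ y′ σ
  Cov-resp {x} {x′} {y} {y′} {σ} (x⊑x′ , x′⊑x) (y⊑y′ , y′⊑y) c = record
    { below = λ ρ t → y⊑y′ ρ (below c ρ (x′⊑x ρ t))
    ; Fσ = ⊑⇒F x′⊑x σ (Fσ c) ; Tσ = y⊑y′ σ (Tσ c)
    ; Qσ = λ ρ q → x⊑x′ ρ (Qσ c ρ q) ; Uσ = λ ρ u → ⊑⇒F y′⊑y ρ (Uσ c ρ u)
    ; ΔF = λ ρ f ¬f → ΔF c ρ (⊑⇒F x⊑x′ ρ f) (λ f′ → ¬f (⊑⇒F y′⊑y ρ f′))
    ; ΔT = λ ρ t ¬t → ΔT c ρ (y′⊑y ρ t) (λ t′ → ¬t (x⊑x′ ρ t′)) }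

  ⋖⇒Cov : ∀ {x y} → x ⊑ y → ¬ (y ⊑ x) → (∀ z → x ⊑ z → z ⊑ y → z ≋ x ⊎ z ≋ y) →
          ∃[ σ ] Cov S x y σ
  ⋖⇒Cov {x} {y} x⊑y y⋢x cover with separate x⊑y y⋢x
  ... | σ , sep = σ , Cov-resp lo≋x hi≋y cov
    where
    open Between x⊑y sep
    lo≋x : lo ≋ x
    lo≋x with cover lo x⊑lo lo⊑y
    ... | inj₁ e = e
    ... | inj₂ (_ , y⊑lo) = ⊥-elim (TF⊥ (y⊑lo σ (Separates.T-hi sep)) F-lo-σ)
    hi≋y : hi ≋ y
    hi≋y with cover hi (⊑-trans x⊑lo lo⊑hi) hi⊑y
    ... | inj₂ e = e
    ... | inj₁ (hi⊑x , _) = ⊥-elim (TF⊥ (hi⊑x σ T-hi-σ) (Separates.F-lo sep))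

  Step : X → X → Set
  Step x y = x ≋ y ⊎ ∃[ σ ] Cov S x y σ

  private
    gap : X → X → ℕ
    gap x y = count (λ ρ → T? y ρ ×-dec ¬? (T? x ρ))

  -- The interval is split at a cover labelled by a separating brick `σ`. Below the cover `σ` has
  -- not yet entered T and above it `σ` has already entered, so `gap` drops on both parts.
  ⊑⇒Star : ∀ {x y} → x ⊑ y → Star Step x y
  ⊑⇒Star {x} {y} x⊑y = go x y x⊑y (ℕᵢ.<-wellFounded (gap x y))
    where
    go : ∀ x y → x ⊑ y → Acc ℕ._<_ (gap x y) → Star Step x y
    go x y x⊑y (acc rec) with y ⊑? x
    ... | yes y⊑x = inj₁ (x⊑y , y⊑x) ◅ ε
    ... | no y⋢x with separate x⊑y y⋢x
    ...   | σ , sep =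
      go x lo x⊑lo (rec smaller₁) ◅◅ inj₂ (σ , cov) ◅ go hi y hi⊑y (rec smaller₂)
      where
      open Between x⊑y sep
      open Separates sep
      ¬Tx : ¬ T x σ
      ¬Tx t = TF⊥ t F-lo
      smaller₁ : gap x lo ℕ.< gap x y
      smaller₁ = count-strict _ _ (λ ρ (t , ¬t) → lo⊑y ρ t , ¬t) σ (T-hi , ¬Tx) (λ (t , _) → TF⊥ t F-lo-σ)
      smaller₂ : gap hi y ℕ.< gap x y
      smaller₂ = count-strict _ _ (λ ρ (t , ¬t) → t , λ t′ → ¬t (lo⊑hi ρ (x⊑lo ρ t′)))
                              σ (T-hi , ¬Tx) (λ (_ , ¬t) → ¬t T-hi-σ)

-- Polygons of torsion pairs

-- The coatoms `m₁`, `m₂` are recorded along with the atoms to make the data self-dual. `F-y` and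
-- `T-x` say that `y` is the join of the atoms and `x` the meet of the coatoms, without naming the
-- operations. The crossed labels of `down₁` and `down₂` are the first condition on the labeling.
record PolyData (S : System) : Set where
  open System S
  open Order S
  field
    x y y₁ y₂ m₁ m₂ : X
    σ₁ σ₂ : Fin N
    σ₁≢σ₂ : σ₁ ≢ σ₂
    up₁   : Cov S x y₁ σ₁
    up₂   : Cov S x y₂ σ₂
    down₁ : Cov S m₁ y σ₂
    down₂ : Cov S m₂ y σ₁
    y₁⊑m₁ : y₁ ⊑ m₁
    y₂⊑m₂ : y₂ ⊑ m₂
    F-y   : ∀ ρ → F y₁ ρ → F y₂ ρ → F y ρ
    T-x   : ∀ ρ → T m₁ ρ → T m₂ ρ → T x ρ

PolyData-swap : ∀ {S} → PolyData S → PolyData S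
PolyData-swap d = record
  { x = x ; y = y ; y₁ = y₂ ; y₂ = y₁ ; m₁ = m₂ ; m₂ = m₁ ; σ₁ = σ₂ ; σ₂ = σ₁
  ; σ₁≢σ₂ = λ eq → σ₁≢σ₂ (sym eq)
  ; up₁ = up₂ ; up₂ = up₁ ; down₁ = down₂ ; down₂ = down₁ ; y₁⊑m₁ = y₂⊑m₂ ; y₂⊑m₂ = y₁⊑m₁
  ; F-y = λ ρ f g → F-y ρ g f ; T-x = λ ρ f g → T-x ρ g f }
  where open PolyData d

PolyData-dual : ∀ S → PolyData S → PolyData (dual S)
PolyData-dual S d = record
  { x = y ; y = x ; y₁ = m₁ ; y₂ = m₂ ; m₁ = y₁ ; m₂ = y₂ ; σ₁ = σ₂ ; σ₂ = σ₁
  ; σ₁≢σ₂ = λ eq → σ₁≢σ₂ (sym eq)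
  ; up₁ = Cov-dual S down₁ ; up₂ = Cov-dual S down₂ ; down₁ = Cov-dual S up₁ ; down₂ = Cov-dual S up₂
  ; y₁⊑m₁ = Order.⊑⇒F S y₁⊑m₁ ; y₂⊑m₂ = Order.⊑⇒F S y₂⊑m₂ ; F-y = T-x ; T-x = F-y }
  where open PolyData d

PolyData-undual : ∀ S → PolyData (dual S) → PolyData S
PolyData-undual S d = record
  { x = y ; y = x ; y₁ = m₁ ; y₂ = m₂ ; m₁ = y₁ ; m₂ = y₂ ; σ₁ = σ₂ ; σ₂ = σ₁
  ; σ₁≢σ₂ = λ eq → σ₁≢σ₂ (sym eq)
  ; up₁ = Cov-undual S down₁ ; up₂ = Cov-undual S down₂ ; down₁ = Cov-undual S up₁ ; down₂ = Cov-undual S up₂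
  ; y₁⊑m₁ = Lattice.F⇒⊑ S y₁⊑m₁ ; y₂⊑m₂ = Lattice.F⇒⊑ S y₂⊑m₂ ; F-y = T-x ; T-x = F-y }
  where open PolyData d

module Polygons (S : System) where
  open System S
  open Lattice S
  open Cover S
  open Cov

  module Up {x y₁ y₂ y : X} {σ₁ σ₂ : Fin N} (σ₁≢σ₂ : σ₁ ≢ σ₂) (c₁ : Cov S x y₁ σ₁) (c₂ : Cov S x y₂ σ₂)
            (y₁⊑y : y₁ ⊑ y) (y₂⊑y : y₂ ⊑ y) (F-y : ∀ ρ → F y₁ ρ → F y₂ ρ → F y ρ) where
    y-least : ∀ {z} → y₁ ⊑ z → y₂ ⊑ z → y ⊑ z
    y-least p q = F⇒⊑ λ ρ f → F-y ρ (⊑⇒F p ρ f) (⊑⇒F q ρ f)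

    -- A brick separating `x` from `z` is free in `x`. Being neither `σ₁` nor `σ₂`, it stays in F
    -- along both covers by `F-free`, hence it is in `F y`, which contradicts `z ⊑ y`.
    bottom : ∀ z → x ⊑ z → z ⊑ y → ¬ T z σ₁ → ¬ T z σ₂ → z ⊑ x
    bottom z x⊑z z⊑y ¬t₁ ¬t₂ with z ⊑? x
    ... | yes z⊑x = z⊑x
    ... | no z⋢x with separate x⊑z z⋢x
    ...   | σ , separates fx tz allQ allU
          with F-free c₁ σ allQ fx | F-free c₂ σ allQ fx
    ...     | inj₁ refl | _ = ⊥-elim (¬t₁ tz)
    ...     | inj₂ _ | inj₁ refl = ⊥-elim (¬t₂ tz)
    ...     | inj₂ f₁ | inj₂ f₂ = ⊥-elim (TF⊥ (z⊑y σ tz) (F-y σ f₁ f₂))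

    private
      -- `F-free` keeps `σ₂` in `F y₁`, so it separates `y₁` from `y` and labels a cover between
      -- them. The top of that cover is `y`, since an element above `x` with `σ₂` in T is above
      -- `y₂`. The bottom is the coatom of this side.
      module Side {y₁ y₂ : X} {σ₁ σ₂ : Fin N} (σ₁≢σ₂ : σ₁ ≢ σ₂) (c₁ : Cov S x y₁ σ₁) (c₂ : Cov S x y₂ σ₂)
                  (y₁⊑y : y₁ ⊑ y) (y₂⊑y : y₂ ⊑ y)
                  (F-y : ∀ ρ → F y₁ ρ → F y₂ ρ → F y ρ)
                  (least-y : ∀ {z} → y₁ ⊑ z → y₂ ⊑ z → y ⊑ z) where
        F-y₁-σ₂ : F y₁ σ₂
        F-y₁-σ₂ = [ (λ eq → ⊥-elim (σ₁≢σ₂ (sym eq))) , id ]′ (F-free c₁ σ₂ (Qσ c₂) (Fσ c₂))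

        sep : Separates y₁ y σ₂
        sep = separates F-y₁-σ₂ (y₂⊑y σ₂ (Tσ c₂)) (λ ρ q → below c₁ ρ (Qσ c₂ ρ q))
                        (λ ρ u → F-y ρ (F-U F-y₁-σ₂ u) (Uσ c₂ ρ u))

        open Between y₁⊑y sep public

        top : hi ≋ y
        top = hi⊑y , least-y (⊑-trans x⊑lo lo⊑hi)
          (above-cover c₂ (⊑-trans (below c₁) (⊑-trans x⊑lo lo⊑hi)) T-hi-σ)

        down : Cov S lo y σ₂
        down = Cov-resp ((λ _ t → t) , (λ _ t → t)) top cov

      module S₁ = Side σ₁≢σ₂ c₁ c₂ y₁⊑y y₂⊑y F-y y-least
      module S₂ = Side (λ eq → σ₁≢σ₂ (sym eq)) c₂ c₁ y₂⊑y y₁⊑y (λ ρ f g → F-y ρ g f) (λ p q → y-least q p)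

    polyData : PolyData S
    polyData = record
      { x = x ; y = y ; y₁ = y₁ ; y₂ = y₂ ; m₁ = S₁.lo ; m₂ = S₂.lo ; σ₁ = σ₁ ; σ₂ = σ₂
      ; σ₁≢σ₂ = σ₁≢σ₂ ; up₁ = c₁ ; up₂ = c₂ ; down₁ = S₁.down ; down₂ = S₂.down
      ; y₁⊑m₁ = S₁.x⊑lo ; y₂⊑m₂ = S₂.x⊑lo ; F-y = F-y
      ; T-x = λ ρ t₁ t₂ → bottom (S₁.lo ⊓ S₂.lo)
          (⊓-glb (⊑-trans (below c₁) S₁.x⊑lo) (⊑-trans (below c₂) S₂.x⊑lo))
          (⊑-trans (⊓-lb₁ _ _) S₁.lo⊑y)
          (λ t → TF⊥ (⊓-lb₂ _ _ σ₁ t) S₂.F-lo-σ)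
          (λ t → TF⊥ (⊓-lb₁ _ _ σ₂ t) S₁.F-lo-σ) ρ (T-⊓ ρ t₁ t₂) }

  module Poly (d : PolyData S) where
    open PolyData d

    y₁⊑y : y₁ ⊑ y
    y₁⊑y = ⊑-trans y₁⊑m₁ (below down₁)

    y₂⊑y : y₂ ⊑ y
    y₂⊑y = ⊑-trans y₂⊑m₂ (below down₂)

    y-least : ∀ {z} → y₁ ⊑ z → y₂ ⊑ z → y ⊑ z
    y-least p q = F⇒⊑ λ ρ f → F-y ρ (⊑⇒F p ρ f) (⊑⇒F q ρ f)

    x-greatest : ∀ {z} → z ⊑ m₁ → z ⊑ m₂ → z ⊑ x
    x-greatest p q ρ t = T-x ρ (p ρ t) (q ρ t)

    -- `τ` is not in `F y`, so by `F-y` it has left F on the way from `x` to `y₂`; `ΔF` of that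
    -- cover exhibits `σ₂` inside it. Together with the dual `side-Q`, an inner label contains both
    -- bottom labels.
    side-U : ∀ τ → F y₁ τ → T m₁ τ → U σ₂ τ
    side-U τ f t with ΔF up₂ τ (⊑⇒F (below up₁) τ f)
                                (λ f₂ → TF⊥ (below down₁ τ t) (F-y τ f f₂))
    ... | inj₁ refl = ⊥-elim (TF⊥ t (Fσ down₁))
    ... | inj₂ u = u

    side-Q : ∀ τ → F y₁ τ → T m₁ τ → Q σ₁ τ
    side-Q τ f t with ΔT down₂ τ (below down₁ τ t)
                                (λ t₂ → TF⊥ (below up₁ τ (T-x τ t t₂)) f)
    ... | inj₁ refl = ⊥-elim (TF⊥ (Tσ up₁) f)
    ... | inj₂ q = q

    -- Each z in the polygon lies on one side according to which of σ₁, σ₂ it contains.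
    locate : ∀ z → x ⊑ z → z ⊑ y →
             (z ≋ x) ⊎ (z ≋ y) ⊎ (y₁ ⊑ z × z ⊑ m₁) ⊎ (y₂ ⊑ z × z ⊑ m₂)
    locate z x⊑z z⊑y with T? z σ₁ | T? z σ₂
    ... | yes t₁ | yes t₂ = inj₂ (inj₁ (z⊑y , y-least (above-cover up₁ x⊑z t₁) (above-cover up₂ x⊑z t₂)))
    ... | yes t₁ | no ¬t₂ = inj₂ (inj₂ (inj₁ (above-cover up₁ x⊑z t₁ , below-cover down₁ z⊑y ¬t₂)))
    ... | no ¬t₁ | yes t₂ = inj₂ (inj₂ (inj₂ (above-cover up₂ x⊑z t₂ , below-cover down₂ z⊑y ¬t₁)))
    ... | no ¬t₁ | no ¬t₂ = inj₁ (x-greatest (below-cover down₁ z⊑y ¬t₂) (below-cover down₂ z⊑y ¬t₁) , x⊑z)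

  -- Were `lo` strictly above `a`, or `hi` strictly below `b`, a brick separating them would again
  -- be in `F a` and `T b`, hence equal to `τ`; but `τ` moves only between `lo` and `hi`.
  short : ∀ {a b} → a ⊑ b → (∀ τ τ′ → F a τ → T b τ → F a τ′ → T b τ′ → τ ≡ τ′) →
          b ⊑ a ⊎ ∃[ τ ] (Cov S a b τ)
  short {a} {b} a⊑b uniq with b ⊑? a
  ... | yes b⊑a = inj₁ b⊑a
  ... | no b⋢a with separate a⊑b b⋢a
  ...   | τ , sep = inj₂ (τ , Cov-resp lo≋a hi≋b cov)
    where
    open Between a⊑b sep
    open Separates sep
    lo≋a : lo ≋ a
    lo≋a with lo ⊑? a
    ... | yes lo⊑a = lo⊑a , x⊑lo
    ... | no lo⋢a with separate x⊑lo lo⋢a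
    ...   | τ′ , separates f t _ _ with uniq τ τ′ F-lo T-hi f (lo⊑y τ′ t)
    ...     | refl = ⊥-elim (TF⊥ t F-lo-σ)
    hi≋b : hi ≋ b
    hi≋b with b ⊑? hi
    ... | yes b⊑hi = hi⊑y , b⊑hi
    ... | no b⋢hi with separate hi⊑y b⋢hi
    ...   | τ′ , separates f t _ _ with uniq τ τ′ F-lo T-hi (⊑⇒F (⊑-trans x⊑lo lo⊑hi) τ′ f) t
    ...     | refl = ⊥-elim (TF⊥ T-hi-σ f)

dec-true⁻¹ : ∀ {P : Set} (p? : Dec P) → does p? ≡ true → P
dec-true⁻¹ (yes p) _ = p

-- Congruence uniformity by doubling intervals

module Truncated (S : System) (k : ℕ) where
  open System S

  infix 4 _⊑ₖ_
  _⊑ₖ_ : X → X → Set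
  x ⊑ₖ y = ∀ ρ → toℕ ρ ℕ.< k → T x ρ → T y ρ

  ⊑ₖ⇒F : ∀ {x y} → x ⊑ₖ y → ∀ ρ → toℕ ρ ℕ.< k → F y ρ → F x ρ
  ⊑ₖ⇒F p = strongInduction _ λ ρ rec ρ<k f →
    [ (λ t → ⊥-elim (TF⊥ (p ρ ρ<k t) f)) , id ]′
    (U-TF λ κ u → rec κ (U-< u) (ℕₚ.<-trans (U-< u) ρ<k) (F-U f u))

  ⊑ₖ-trans : ∀ {x y z} → x ⊑ₖ y → y ⊑ₖ z → x ⊑ₖ z
  ⊑ₖ-trans p q ρ ρ<k = q ρ ρ<k ∘ p ρ ρ<k

-- Stage k is the lattice of torsion pairs restricted to the first k bricks; adding the next
-- brick doubles the interval of those restricted pairs for which it is free.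
module Doubling (S : System) where
  open System S
  open Lattice S

  module _ (k : ℕ) where
    open Truncated S k
    private module D = Truncated (dual S) k

    _≋ₖ_ : X → X → Set
    x ≋ₖ y = x ⊑ₖ y × y ⊑ₖ x

    -- Truncated torsion pairs have no type of their own: `P` is compared with all of `X` under the
    -- preorder `⊑ₖ`, where elements that agree on the first `k` bricks become equivalent.
    record Stage : Set₁ where
      field
        P    : Pos
        doublings : ObtainedByDoublings P
        π    : X → Pos.Carrier P
        ι    : Pos.Carrier P → X
        ≤⇔   : ∀ z w → Pos._≤_ P z w ⇔ (ι z ⊑ₖ ι w)
        ≈⇔   : ∀ z w → Pos._≈_ P z w ⇔ (ι z ≋ₖ ι w)
        ιπ   : ∀ x → ι (π x) ≋ₖ x

    F⇒⊑ₖ : ∀ {x y} → (∀ ρ → toℕ ρ ℕ.< k → F y ρ → F x ρ) → x ⊑ₖ y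
    F⇒⊑ₖ = D.⊑ₖ⇒F

  open Stage

  stage-zero : Stage 0
  stage-zero = record
    { P = onePos ; doublings = base ; π = λ _ → tt ; ι = λ _ → mk (λ _ → false)
    ; ≤⇔ = λ _ _ → mk⇔ (λ _ _ ()) (λ _ → tt)
    ; ≈⇔ = λ _ _ → mk⇔ (λ _ → (λ _ ()) , (λ _ ())) (λ _ → tt)
    ; ιπ = λ _ → (λ _ ()) , (λ _ ()) }

  module Next (k : ℕ) (k<N : k ℕ.< N) (st : Stage k) where
    open Truncated S k
    private
      module Suc = Truncated S (suc k)
      P₀ = P st

      σ : Fin N
      σ = Fin.fromℕ< k<N

      σ≡k : toℕ σ ≡ k
      σ≡k = Finₚ.toℕ-fromℕ< k<N

      <σ⇒<k : ∀ {ρ : Fin N} → ρ Fin.< σ → toℕ ρ ℕ.< k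
      <σ⇒<k {ρ} = subst (toℕ ρ ℕ.<_) σ≡k

      ≡k⇒≡σ : ∀ {ρ : Fin N} → toℕ ρ ≡ k → ρ ≡ σ
      ≡k⇒≡σ eq = Finₚ.toℕ-injective (trans eq (sym σ≡k))

      Q<k : ∀ {ρ} → Q ρ σ → toℕ ρ ℕ.< k
      Q<k = <σ⇒<k ∘ Q-<

      U<k : ∀ {ρ} → U ρ σ → toℕ ρ ℕ.< k
      U<k = <σ⇒<k ∘ U-<

      AllU-anti : ∀ {x y} → x ⊑ₖ y → AllU y σ → AllU x σ
      AllU-anti p all ρ u = ⊑ₖ⇒F p ρ (U<k u) (all ρ u)

      AllQ-mono : ∀ {x y} → x ⊑ₖ y → AllQ x σ → AllQ y σ
      AllQ-mono p all ρ q = p ρ (Q<k q) (all ρ q)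

      Free : X → Set
      Free x = AllQ x σ × AllU x σ

      Free? : ∀ x → Dec (Free x)
      Free? x = allQ? x σ ×-dec Order.allQ? (dual S) x σ

      Free-resp : ∀ {x y} → x ⊑ₖ y → y ⊑ₖ x → Free x → Free y
      Free-resp p q (allQ , allU) = AllQ-mono p allQ , AllU-anti q allU

      -- Ends of the interval to be doubled: `a` is least with all proper quotients of `σ` in T, and
      -- `b` is greatest with all its proper subs in F. No brick is both, so the quotients are also
      -- in `T b`, which gives `a ⊑ b`.
      a b : X
      a = mk (λ ρ → does (Q? ρ σ))
      b = mk (λ ρ → not (does (U? ρ σ)))

      AllQ-a : AllQ a σ
      AllQ-a = strongInduction _ λ ρ rec q →
        mk-T _ (dec-true (Q? ρ σ) q) λ κ q′ → rec κ (Q-< q′) (Q-trans q′ q)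

      AllQ-b : AllQ b σ
      AllQ-b = strongInduction _ λ ρ rec q →
        mk-T _ (cong not (dec-false (U? ρ σ) (QU⊥ q))) λ κ q′ → rec κ (Q-< q′) (Q-trans q′ q)

      AllU-b : AllU b σ
      AllU-b = strongInduction _ λ ρ rec u →
        mk-F _ (cong not (dec-true (U? ρ σ) u)) λ κ u′ → rec κ (U-< u′) (U-trans u′ u)

      a⊑ : ∀ {x} → AllQ x σ → a ⊑ x
      a⊑ {x} all = mk-⊑ _ λ ρ f → dec-false (Q? ρ σ) λ q → TF⊥ (all ρ q) f

      ⊑b : ∀ {x} → AllU x σ → x ⊑ b
      ⊑b {x} all = ⊑-mk _ λ ρ t → cong not (dec-false (U? ρ σ) λ u → TF⊥ t (all ρ u))

      ⊑⇒⊑ₖ : ∀ {x y} → x ⊑ y → x ⊑ₖ y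
      ⊑⇒⊑ₖ p ρ _ = p ρ

      open Pos P₀ using () renaming (Carrier to Z; _≤_ to _≤₀_)

      ≤₀⇒ : ∀ {z w} → z ≤₀ w → ι st z ⊑ₖ ι st w
      ≤₀⇒ {z} {w} = Equivalence.to (≤⇔ st z w)

      ⇒≤₀ : ∀ {z w} → ι st z ⊑ₖ ι st w → z ≤₀ w
      ⇒≤₀ {z} {w} = Equivalence.from (≤⇔ st z w)

      πa≤πb : π st a ≤₀ π st b
      πa≤πb = ⇒≤₀ (⊑ₖ-trans (proj₁ (ιπ st a)) (⊑ₖ-trans (⊑⇒⊑ₖ (a⊑ AllQ-b)) (proj₂ (ιπ st b))))

      InI : Z → Set
      InI z = (π st a ≤₀ z) × (z ≤₀ π st b)

      InI⇒Free : ∀ {z} → InI z → Free (ι st z)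
      InI⇒Free (p , q) =
        AllQ-mono (⊑ₖ-trans (proj₂ (ιπ st a)) (≤₀⇒ p)) AllQ-a ,
        AllU-anti (⊑ₖ-trans (≤₀⇒ q) (proj₁ (ιπ st b))) AllU-b

      Free⇒InI : ∀ {z} → Free (ι st z) → InI z
      Free⇒InI (allQ , allU) =
        ⇒≤₀ (⊑ₖ-trans (proj₁ (ιπ st a)) (⊑⇒⊑ₖ (a⊑ allQ))) ,
        ⇒≤₀ (⊑ₖ-trans (⊑⇒⊑ₖ (⊑b allU)) (proj₂ (ιπ st b)))

      P₁ : Pos
      P₁ = double P₀ (π st a) (π st b)

      -- If `σ` is in `T x`, its quotients are in `T y`, so `y` decides it. Should it fall into
      -- `F y`, its subs are in F of both elements and it is free in both: only there has the new
      -- brick to be compared.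
      extend : ∀ {x y} → x ⊑ₖ y → (Free x → Free y → T x σ → T y σ) → x Suc.⊑ₖ y
      extend {x} {y} p atσ ρ ρ<1+k t with ℕₚ.m<1+n⇒m<n∨m≡n ρ<1+k
      ... | inj₁ ρ<k = p ρ ρ<k t
      ... | inj₂ ρ≡k with ≡k⇒≡σ ρ≡k
      ...   | refl with Q-TF {y} (AllQ-mono p (λ κ q → T-Q t q))
      ...     | inj₁ ty = ty
      ...     | inj₂ fy = atσ ((λ κ q → T-Q t q) , AllU-anti p (λ κ u → F-U fy u))
                              (AllQ-mono p (λ κ q → T-Q t q) , (λ κ u → F-U fy u)) t

      restrict : ∀ {x y} → x Suc.⊑ₖ y → x ⊑ₖ y
      restrict p ρ ρ<k = p ρ (ℕₚ.m<n⇒m<1+n ρ<k)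

      atσ : ∀ {x y} → x Suc.⊑ₖ y → T x σ → T y σ
      atσ p = p σ (subst (ℕ._< suc k) (sym σ≡k) ℕₚ.≤-refl)

      choice? : ∀ z i ρ → Dec ((toℕ ρ ℕ.< k × T (ι st z) ρ) ⊎ (ρ ≡ σ × i ≡ true))
      choice? z i ρ = ((toℕ ρ ℕₚ.<? k) ×-dec T? (ι st z) ρ) ⊎-dec ((ρ Finₚ.≟ σ) ×-dec (i Bool.≟ true))

      ext : Z → Bool → X
      ext z i = mk (λ ρ → does (choice? z i ρ))

      ext-⊒ : ∀ z i → ι st z ⊑ₖ ext z i
      ext-⊒ z i = strongInduction _ λ ρ rec ρ<k t →
        mk-T _ (dec-true (choice? z i ρ) (inj₁ (ρ<k , t)))
             λ κ q → rec κ (Q-< q) (ℕₚ.<-trans (Q-< q) ρ<k) (T-Q t q)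

      ext-⊑ : ∀ z i → ext z i ⊑ₖ ι st z
      ext-⊑ z i = F⇒⊑ₖ k (strongInduction _ λ ρ rec ρ<k f →
        mk-F _ (dec-false (choice? z i ρ)
                 [ (λ (_ , t) → TF⊥ t f)
                 , (λ { (refl , _) → ℕₚ.<-irrefl σ≡k ρ<k }) ]′)
             λ κ u → rec κ (U-< u) (ℕₚ.<-trans (U-< u) ρ<k) (F-U f u))

      ext-true : ∀ z → Free (ext z true) → T (ext z true) σ
      ext-true z (allQ , _) = mk-T _ (dec-true (choice? z true σ) (inj₂ (refl , refl))) allQ

      ext-false : ∀ z → Free (ext z false) → F (ext z false) σ
      ext-false z (_ , allU) = mk-F _ (dec-false (choice? z false σ)
        [ (λ (σ<k , _) → ℕₚ.<-irrefl σ≡k σ<k) , (λ { (_ , ()) }) ]′) allU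

      ext-Free : ∀ z i → Free (ι st z) → Free (ext z i)
      ext-Free z i = Free-resp (ext-⊒ z i) (ext-⊑ z i)

      Free-ext : ∀ z i → Free (ext z i) → Free (ι st z)
      Free-ext z i = Free-resp (ext-⊑ z i) (ext-⊒ z i)

      ext-mono : ∀ z i w j → ι st z ⊑ₖ ι st w → (Free (ι st z) → Free (ι st w) → i Bool.≤ j) →
                 ext z i Suc.⊑ₖ ext w j
      ext-mono z i w j p i≤j = extend (⊑ₖ-trans (ext-⊑ z i) (⊑ₖ-trans p (ext-⊒ w j)))
        λ fz fw t → go i j fz fw t (i≤j (Free-ext z i fz) (Free-ext w j fw))
        where
        go : ∀ i j → Free (ext z i) → Free (ext w j) → T (ext z i) σ → i Bool.≤ j → T (ext w j) σ
        go i     true  fz fw t _ = ext-true w fw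
        go false false fz fw t b≤b = ⊥-elim (TF⊥ t (ext-false z fz))

      ext-mono⁻¹ : ∀ z i w j → ext z i Suc.⊑ₖ ext w j →
                   (ι st z ⊑ₖ ι st w) × (Free (ι st z) → Free (ι st w) → i Bool.≤ j)
      ext-mono⁻¹ z i w j p =
        ⊑ₖ-trans (ext-⊒ z i) (⊑ₖ-trans (restrict p) (ext-⊑ w j)) , go i j p
        where
        go : ∀ i j → ext z i Suc.⊑ₖ ext w j → Free (ι st z) → Free (ι st w) → i Bool.≤ j
        go false false _ _ _ = b≤b
        go false true  _ _ _ = f≤t
        go true  true  _ _ _ = b≤b
        go true  false p fz fw =
          ⊥-elim (TF⊥ (atσ p (ext-true z (ext-Free z true fz))) (ext-false w (ext-Free w false fw)))

      ≤-antisym : ∀ {i j} → i Bool.≤ j → j Bool.≤ i → i ≡ j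
      ≤-antisym b≤b _ = refl

      -- The doubling has only the false copy outside the interval, so a brick that is forced into T
      -- also gets the bit false.
      bit? : ∀ x → Dec (Free x × T x σ)
      bit? x = Free? x ×-dec T? x σ

      π₁ : X → Pos.Carrier P₁
      π₁ x = (π st x , does (bit? x)) , λ eq →
        Free⇒InI (Free-resp (proj₂ (ιπ st x)) (proj₁ (ιπ st x)) (proj₁ (dec-true⁻¹ (bit? x) eq)))

      ι₁ : Pos.Carrier P₁ → X
      ι₁ ((z , i) , _) = ext z i

      ιπ₁ : ∀ x → (ext (π st x) (does (bit? x)) Suc.⊑ₖ x) × (x Suc.⊑ₖ ext (π st x) (does (bit? x)))
      ιπ₁ x = extend (⊑ₖ-trans (ext-⊑ (π st x) (does (bit? x))) (proj₁ (ιπ st x)))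
                (λ fr _ → lower (does (bit? x)) (λ eq → proj₂ (dec-true⁻¹ (bit? x) eq)) fr) ,
              extend (⊑ₖ-trans (proj₂ (ιπ st x)) (ext-⊒ (π st x) (does (bit? x))))
                (λ fx fr t → upper (does (bit? x)) (dec-true (bit? x) (fx , t)) fr)
        where
        lower : ∀ i → (i ≡ true → T x σ) → Free (ext (π st x) i) → T (ext (π st x) i) σ → T x σ
        lower true  h _  _ = h refl
        lower false _ fr t = ⊥-elim (TF⊥ t (ext-false (π st x) fr))
        upper : ∀ i → i ≡ true → Free (ext (π st x) i) → T (ext (π st x) i) σ
        upper true _ = ext-true (π st x)

      ≈₁⇒ : ∀ p q → Pos._≈_ P₁ p q → (ι₁ p Suc.⊑ₖ ι₁ q) × (ι₁ q Suc.⊑ₖ ι₁ p)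
      ≈₁⇒ ((z , i) , _) ((w , .i) , _) (z≈w , refl) =
        let (p , q) = Equivalence.to (≈⇔ st z w) z≈w
        in ext-mono z i w i p (λ _ _ → b≤b) , ext-mono w i z i q (λ _ _ → b≤b)

      ⇒≈₁ : ∀ p q → (ι₁ p Suc.⊑ₖ ι₁ q) × (ι₁ q Suc.⊑ₖ ι₁ p) → Pos._≈_ P₁ p q
      ⇒≈₁ ((z , i) , pz) ((w , j) , pw) (p , q) = Equivalence.from (≈⇔ st z w) (z⊑w , w⊑z) , bits
        where
        z⊑w = proj₁ (ext-mono⁻¹ z i w j p)
        w⊑z = proj₁ (ext-mono⁻¹ w j z i q)
        both : Free (ι st z) → i ≡ j
        both fr = ≤-antisym (proj₂ (ext-mono⁻¹ z i w j p) fr (Free-resp z⊑w w⊑z fr))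
                            (proj₂ (ext-mono⁻¹ w j z i q) (Free-resp z⊑w w⊑z fr) fr)
        -- A true bit certifies that `σ` is free, and then the order determines the bits; the one
        -- remaining case is two false bits.
        bit-cases : ∀ i j → (i ≡ true → Free (ι st z)) → (j ≡ true → Free (ι st z)) →
                    (Free (ι st z) → i ≡ j) → i ≡ j
        bit-cases true  _     h _ b = b (h refl)
        bit-cases false true  _ h b = b (h refl)
        bit-cases false false _ _ _ = refl
        bits : i ≡ j
        bits = bit-cases i j (λ eq → InI⇒Free (pz eq))
                             (λ eq → Free-resp w⊑z z⊑w (InI⇒Free (pw eq))) both

    stage-suc : Stage (suc k)
    stage-suc = record
      { P = P₁ ; doublings = step (doublings st) (π st a) (π st b) πa≤πb ; π = π₁ ; ι = ι₁
      ; ≤⇔ = λ { ((z , i) , _) ((w , j) , _) → mk⇔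
          (λ (z≤w , i≤j) → ext-mono z i w j (≤₀⇒ z≤w) (λ fz fw → i≤j (Free⇒InI fz) (Free⇒InI fw)))
          (λ p → ⇒≤₀ (proj₁ (ext-mono⁻¹ z i w j p)) ,
                 λ iz iw → proj₂ (ext-mono⁻¹ z i w j p) (InI⇒Free iz) (InI⇒Free iw)) }
      ; ≈⇔ = λ p q → mk⇔ (≈₁⇒ p q) (⇒≈₁ p q)
      ; ιπ = ιπ₁ }

  stage : ∀ k → k ℕ.≤ N → Stage k
  stage zero _ = stage-zero
  stage (suc k) k<N = Next.stage-suc k k<N (stage k (ℕₚ.<⇒≤ k<N))

  full : Stage N
  full = stage N ℕₚ.≤-refl

  ⊑ₙ⇒⊑ : ∀ {x y} → Truncated._⊑ₖ_ S N x y → x ⊑ y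
  ⊑ₙ⇒⊑ p ρ = p ρ (Finₚ.toℕ<n ρ)

-- Abstract geometry of letters, segments and strings

record LetterOrder : Set₁ where
  infix 4 _≼_
  field
    _≼_      : ℕ → ℕ → Set
    ≼-refl   : ∀ {a} → a ≼ a
    ≼-trans  : ∀ {a b c} → a ≼ b → b ≼ c → a ≼ c
    ≼-antisym : ∀ {a b} → a ≼ b → b ≼ a → a ≡ b
    ≼-total  : ∀ a b → a ≼ b ⊎ b ≼ a
    ≼?       : ∀ a b → Dec (a ≼ b)

-- A word that stops at a vertex without a letter lies on neither side of the gaps there, whence the
-- value at `nothing`.
At : (ℕ → ℕ → Set) → Maybe ℕ → ℕ → Set
At _≼_ (just a) b = a ≼ b
At _≼_ nothing  b = ⊥

Occurrence : Set → Set₁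
Occurrence Seg = Seg → Seg → Maybe ℕ → Maybe ℕ → Set

record Snoc {Seg : Set} (Occ : Occurrence Seg) (room : Seg → ℕ) (q : Seg) (h : ℕ) : Set where
  field
    ext   : Seg
    occ   : Occ q ext nothing (just h)
    room< : room ext ℕ.< room q
    split : ∀ {p l k} → Occ p ext l (just k) → Occ p q l (just k) ⊎ (Occ p q l nothing × k ≡ h)

data Diverge (_≼_ : ℕ → ℕ → Set) (gaps : List ℕ) : Maybe ℕ → Maybe ℕ → Set where
  end₁  : ∀ {r} → Diverge _≼_ gaps nothing r
  end₂  : ∀ {r} → Diverge _≼_ gaps r nothing
  fork₁ : ∀ {h k f} → f ∈ gaps → h ≼ f → f ≼ k → Diverge _≼_ gaps (just h) (just k)
  fork₂ : ∀ {h k f} → f ∈ gaps → k ≼ f → f ≼ h → Diverge _≼_ gaps (just h) (just k)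

-- What is needed of segments of routes at their right ends.  Occ p q l r says that the segment
-- p occurs in q, preceded by the edge at position l and followed by the edge at position r;
-- nothing means that p is an initial, resp. final, part of q.  The letters at a vertex are
-- its edges and the gaps between consecutive edges.
record Half (Seg : Set) (Occ : Occurrence Seg) : Set₁ where
  field order : LetterOrder
  open LetterOrder order public
  infix 4 _⊴_
  field
    _⊴_       : Seg → Seg → Set
    ⊴-trans   : ∀ {p q r} → p ⊴ q → q ⊴ r → p ⊴ r
    ⊴-total   : ∀ p q → p ⊴ q ⊎ q ⊴ p
    occ-⊴     : ∀ {p q l r} → Occ p q l r → p ⊴ q
    occ-end   : ∀ {p q l} → Occ p q l nothing → q ⊴ p
    occ-inner : ∀ {p q l h} → Occ p q l (just h) → ¬ (q ⊴ p)
    gaps      : Seg → List ℕ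
    gaps-up   : ∀ {p q l f} → Occ p q l nothing → f ∈ gaps p → f ∈ gaps q
    gaps-down : ∀ {p q l f} → Occ p q l nothing → f ∈ gaps q → f ∈ gaps p
    gap-edge  : ∀ {p q l h} → Occ p q l (just h) → ¬ (h ∈ gaps p)
    truncate  : ∀ {p q l r} → Occ p q l r → ∃[ p′ ] (Occ p′ q nothing r × Occ p p′ l nothing)

  field
    common : ∀ {p q₁ q₂ l₁ r₁ l₂ r₂} → Occ p q₁ l₁ r₁ → Occ p q₂ l₂ r₂ →
             ∃[ p′ ] ∃[ r ] ∃[ s₁ ] ∃[ s₂ ]
               (Occ p p′ nothing r × Occ p′ q₁ l₁ s₁ × Occ p′ q₂ l₂ s₂ × Diverge _≼_ (gaps p′) s₁ s₂)
    Terminal      : Seg → Set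
    terminal-up   : ∀ {p q l} → Occ p q l nothing → Terminal p → Terminal q
    terminal-down : ∀ {p q l} → Occ p q l nothing → Terminal q → Terminal p
    terminal-max  : ∀ {p q l h} → Terminal p → ¬ Occ p q l (just h)
    room          : Seg → ℕ
    extend        : ∀ q → Terminal q ⊎ ∃[ h ] Snoc Occ room q h
    -- The edge supplied is adjacent to the gap `f`: no other gap lies between them. `leave-below`
    -- depends on this.
    extend-≼      : ∀ {q f} → f ∈ gaps q →
                    ∃[ h ] (Snoc Occ room q h × h ≼ f × (∀ {g} → g ∈ gaps q → h ≼ g → f ≼ g))
    extend-≽      : ∀ {q f} → f ∈ gaps q →
                    ∃[ h ] (Snoc Occ room q h × f ≼ h × (∀ {g} → g ∈ gaps q → g ≼ h → g ≼ f))

flipOrder : LetterOrder → LetterOrder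
flipOrder o = record
  { _≼_ = λ a b → b ≼ a ; ≼-refl = ≼-refl ; ≼-trans = λ p q → ≼-trans q p
  ; ≼-antisym = λ p q → ≼-antisym q p ; ≼-total = λ a b → ≼-total b a ; ≼? = λ a b → ≼? b a }
  where open LetterOrder o

flipDiverge : ∀ {_≼_ gaps r s} → Diverge _≼_ gaps r s → Diverge (λ a b → b ≼ a) gaps r s
flipDiverge end₁ = end₁
flipDiverge end₂ = end₂
flipDiverge (fork₁ f a b) = fork₂ f b a
flipDiverge (fork₂ f a b) = fork₁ f b a

flipHalf : ∀ {Seg} {Occ : Occurrence Seg} → Half Seg Occ → Half Seg Occ
flipHalf {Seg} {Occ} H = record
  { order = flipOrder order ; _⊴_ = _⊴_ ; ⊴-trans = ⊴-trans ; ⊴-total = ⊴-total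
  ; occ-⊴ = occ-⊴ ; occ-end = occ-end ; occ-inner = occ-inner ; gaps = gaps ; gaps-up = gaps-up
  ; gaps-down = gaps-down ; gap-edge = gap-edge ; truncate = truncate ; common = common′
  ; Terminal = Terminal ; terminal-up = terminal-up ; terminal-down = terminal-down
  ; terminal-max = terminal-max ; room = room ; extend = extend
  ; extend-≼ = extend-≽ ; extend-≽ = extend-≼ }
  where
  open Half H
  common′ : ∀ {p q₁ q₂ l₁ r₁ l₂ r₂} → Occ p q₁ l₁ r₁ → Occ p q₂ l₂ r₂ → _
  common′ o₁ o₂ with common o₁ o₂
  ... | p′ , r , s₁ , s₂ , o , o₁′ , o₂′ , div = p′ , r , s₁ , s₂ , o , o₁′ , o₂′ , flipDiverge div

record Geo (N : ℕ) : Set₁ where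
  field
    Seg         : Set
    Occ         : Occurrence Seg
    occ-refl    : ∀ p → Occ p p nothing nothing
    occ-trans   : ∀ {p q s l r l′ r′} → Occ p q l r → Occ q s l′ r′ → Occ p s (l <∣> l′) (r <∣> r′)
    occ-unique  : ∀ {p q l r l′ r′} → Occ p q l r → Occ p q l′ r′ → l ≡ l′ × r ≡ r′
    occ-antisym : ∀ {p q} → Occ p q nothing nothing → p ≡ q
    occ?        : ∀ p q → Dec (∃[ l ] ∃[ r ] Occ p q l r)
    right       : Half Seg Occ
    left        : Half Seg (λ p q l r → Occ p q r l)
  module R = Half right
  module L = Half left
  field
    nest      : ∀ {p p′ q l r l′ r′} → Occ p q l r → Occ p′ q l′ r′ → p L.⊴ p′ → p R.⊴ p′ →
                ∃[ k ] ∃[ s ] Occ p p′ k s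
    seg       : Fin N → Seg
    lft rgt   : Fin N → ℕ
    lft-gap   : ∀ σ → lft σ ∈ L.gaps (seg σ)
    rgt-gap   : ∀ σ → rgt σ ∈ R.gaps (seg σ)
    string    : ∀ {p e f} → e ∈ L.gaps p → f ∈ R.gaps p → ∃[ σ ] (seg σ ≡ p × lft σ ≡ e × rgt σ ≡ f)
    string-injective : ∀ {σ τ} → seg σ ≡ seg τ → lft σ ≡ lft τ → rgt σ ≡ rgt τ → σ ≡ τ
    shorter   : ∀ {σ τ l r} → Occ (seg τ) (seg σ) l r → τ Fin.< σ ⊎ seg τ ≡ seg σ

  -- A word is a segment together with an optional letter at each end.  It crosses σ down
  -- if it runs through σ, entering and leaving it on the small side of its two gaps.
  Down Up : Maybe ℕ → Seg → Maybe ℕ → Fin N → Set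
  Down a q b σ = ∃[ l ] ∃[ r ] (Occ (seg σ) q l r ×
                   At L._≼_ (l <∣> a) (lft σ) × At R._≼_ (r <∣> b) (rgt σ))
  Up a q b σ = ∃[ l ] ∃[ r ] (Occ (seg σ) q l r ×
                   At (λ x y → y L.≼ x) (l <∣> a) (lft σ) × At (λ x y → y R.≼ x) (r <∣> b) (rgt σ))

  -- Weak forms of quotient and sub: they include `σ` itself and the strings on the path of `σ` of
  -- whatever index.
  D̄ Ū : Fin N → Fin N → Set
  D̄ σ = Down (just (lft σ)) (seg σ) (just (rgt σ))
  Ū σ = Up (just (lft σ)) (seg σ) (just (rgt σ))

flipGeo : ∀ {N} → Geo N → Geo N
flipGeo G = record
  { Seg = Seg ; Occ = Occ ; occ-refl = occ-refl ; occ-trans = occ-trans ; occ-unique = occ-unique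
  ; occ-antisym = occ-antisym ; occ? = occ? ; right = flipHalf right ; left = flipHalf left
  ; nest = nest ; seg = seg ; lft = lft ; rgt = rgt ; lft-gap = lft-gap ; rgt-gap = rgt-gap
  ; string = string ; string-injective = string-injective ; shorter = shorter }
  where open Geo G

revGeo : ∀ {N} → Geo N → Geo N
revGeo G = record
  { Seg = Seg ; Occ = λ p q l r → Occ p q r l ; occ-refl = occ-refl ; occ-trans = occ-trans
  ; occ-unique = λ o o′ → let (a , b) = occ-unique o o′ in b , a
  ; occ-antisym = occ-antisym
  ; occ? = λ p q → map′ (λ (l , r , o) → r , l , o) (λ (l , r , o) → r , l , o) (occ? p q)
  ; right = left ; left = right
  ; nest = λ o o′ a b → let (k , s , o″) = nest o o′ b a in s , k , o″
  ; seg = seg ; lft = rgt ; rgt = lft ; lft-gap = rgt-gap ; rgt-gap = lft-gap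
  ; string = λ e f → let (σ , a , b , c) = string f e in σ , a , c , b
  ; string-injective = λ a b c → string-injective a c b
  ; shorter = shorter }
  where open Geo G

-- Bricks and strings identified: quotients are the strings crossed down, subs those crossed up.
record Linked : Set₁ where
  field
    S : System
    G : Geo (System.N S)
  open System S public
  open Lattice S public
  open Geo G public
  field
    Q⇒ : ∀ {τ σ} → Q τ σ → D̄ σ τ
    ⇒Q : ∀ {τ σ} → D̄ σ τ → τ Fin.< σ → Q τ σ
    U⇒ : ∀ {τ σ} → U τ σ → Ū σ τ
    ⇒U : ∀ {τ σ} → Ū σ τ → τ Fin.< σ → U τ σ

flipLinked : Linked → Linked
flipLinked Λ = record { S = dual S ; G = flipGeo G ; Q⇒ = U⇒ ; ⇒Q = ⇒U ; U⇒ = Q⇒ ; ⇒U = ⇒Q }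
  where open Linked Λ

Down-rev : ∀ {N} (G : Geo N) {a q b σ} → Geo.Down (revGeo G) b q a σ → Geo.Down G a q b σ
Down-rev G (l , r , o , x , y) = r , l , o , y , x

Up-rev : ∀ {N} (G : Geo N) {a q b σ} → Geo.Up (revGeo G) b q a σ → Geo.Up G a q b σ
Up-rev G (l , r , o , x , y) = r , l , o , y , x

revLinked : Linked → Linked
revLinked Λ = record
  { S = S ; G = revGeo G
  ; Q⇒ = λ q → Down-rev (revGeo G) (Q⇒ q) ; ⇒Q = λ d → ⇒Q (Down-rev G d)
  ; U⇒ = λ u → Up-rev (revGeo G) (U⇒ u) ; ⇒U = λ d → ⇒U (Up-rev G d) }
  where open Linked Λ

-- Words crossing strings, and closure of torsion pairs

module _ (o : LetterOrder) where
  open LetterOrder o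

  At-≼ : ∀ {m a b} → At _≼_ m a → a ≼ b → At _≼_ m b
  At-≼ {just _} p q = ≼-trans p q

  At-trans : ∀ l {m a b} → At _≼_ (l <∣> just a) b → At _≼_ m a → At _≼_ (l <∣> m) b
  At-trans (just _) p q = p
  At-trans nothing {m} p q = At-≼ {m} q p

  At? : ∀ m a → Dec (At _≼_ m a)
  At? (just x) a = ≼? x a
  At? nothing  a = no id

  At-through : ∀ {m a b} → At _≼_ m a → At (flip _≼_) m b → b ≼ a
  At-through {just _} p q = ≼-trans q p

  minimum : {P : ℕ → Set} → (∀ a → Dec (P a)) → ∀ ys → (∀ {c} → c ∈ ys → ¬ P c) ⊎
            ∃[ b ] (b ∈ ys × P b × ∀ {c} → c ∈ ys → P c → b ≼ c)
  minimum P? [] = inj₁ λ ()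
  minimum P? (y ∷ ys) with P? y | minimum P? ys
  ... | no ¬p | inj₁ none = inj₁ λ { (here refl) → ¬p ; (there m) → none m }
  ... | no ¬p | inj₂ (b , b∈ , pb , min) =
    inj₂ (b , there b∈ , pb , λ { (here refl) p → ⊥-elim (¬p p) ; (there m) p → min m p })
  ... | yes p | inj₁ none =
    inj₂ (y , here refl , p , λ { (here refl) _ → ≼-refl ; (there m) q → ⊥-elim (none m q) })
  ... | yes p | inj₂ (b , b∈ , pb , min) with ≼-total y b
  ...   | inj₁ y≼b = inj₂ (y , here refl , p , λ { (here refl) _ → ≼-refl ; (there m) q → ≼-trans y≼b (min m q) })
  ...   | inj₂ b≼y = inj₂ (b , there b∈ , pb , λ { (here refl) _ → b≼y ; (there m) q → min m q })

module Crossings {N : ℕ} (G : Geo N) where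
  open Geo G

  Down-trans : ∀ {a q b σ τ} → D̄ σ τ → Down a q b σ → Down a q b τ
  Down-trans {a} {q} {b} (l , r , o , x , y) (l′ , r′ , o′ , x′ , y′) =
    l <∣> l′ , r <∣> r′ , occ-trans o o′ ,
    subst (λ m → At L._≼_ m _) (assoc l l′ a) (At-trans L.order l x x′) ,
    subst (λ m → At R._≼_ m _) (assoc r r′ b) (At-trans R.order r y y′)
    where
    assoc : ∀ (l m n : Maybe ℕ) → l <∣> (m <∣> n) ≡ (l <∣> m) <∣> n
    assoc (just _) m n = refl
    assoc nothing  m n = refl

  D̄-refl : ∀ σ → D̄ σ σ
  D̄-refl σ = nothing , nothing , occ-refl (seg σ) , L.≼-refl , R.≼-refl

  occ-equal : ∀ {p q l r} → p ≡ q → Occ p q l r → l ≡ nothing × r ≡ nothing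
  occ-equal refl o = occ-unique o (occ-refl _)

  -- On a common path both sides say that the gaps of `σ` precede those of `τ`. This is the tie that
  -- the index order breaks.
  D̄⇒Ū : ∀ {σ τ} → seg τ ≡ seg σ → D̄ σ τ → Ū τ σ
  D̄⇒Ū {σ} {τ} eq (l , r , o , x , y) with occ-equal eq o
  ... | refl , refl = nothing , nothing ,
    subst (λ s → Occ s (seg τ) nothing nothing) eq (occ-refl (seg τ)) , x , y

  Down? : ∀ a q b σ → Dec (Down a q b σ)
  Down? a q b σ with occ? (seg σ) q
  ... | no none = no λ (l , r , o , _) → none (l , r , o)
  ... | yes (l , r , o) = map′ (λ (x , y) → l , r , o , x , y) back
                               (At? L.order (l <∣> a) (lft σ) ×-dec At? R.order (r <∣> b) (rgt σ))
    where
    back : Down a q b σ → At L._≼_ (l <∣> a) (lft σ) × At R._≼_ (r <∣> b) (rgt σ)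
    back (l′ , r′ , o′ , x , y) with occ-unique o o′
    ... | refl , refl = x , y

module Closure (Λ : Linked) where
  open Linked Λ
  open Crossings G public

  -- The critical case is a later string `τ` on the path of `σ`, of which `σ` is then a sub.
  -- Inductively its quotients are in `T x`, so `τ` is decided, and `F x τ` would force `σ` into
  -- `F x`.
  T-D̄ : ∀ {x σ} τ → T x σ → D̄ σ τ → T x τ
  T-D̄ {x} {σ} = strongInduction _ go
    where
    go : ∀ τ → (∀ ρ → ρ Fin.< τ → T x σ → D̄ σ ρ → T x ρ) → T x σ → D̄ σ τ → T x τ
    go τ rec t d@(l , r , o , _) with Finₚ.<-cmp τ σ
    ... | tri< τ<σ _ _ = T-Q t (⇒Q d τ<σ)
    ... | tri≈ _ refl _ = t
    ... | tri> τ≮σ _ σ<τ with shorter o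
    ...   | inj₁ τ<σ = ⊥-elim (τ≮σ τ<σ)
    ...   | inj₂ eq with Q-TF {x} {τ} (λ ρ q → rec ρ (Q-< q) t (Down-trans (Q⇒ q) d))
    ...     | inj₁ tτ = tτ
    ...     | inj₂ fτ = ⊥-elim (TF⊥ t (F-U fτ (⇒U (D̄⇒Ū eq d) σ<τ)))

  -- In the critical case `τ` is a later string on the path of `σ`. If it were in `F x`, it would
  -- stay in `F y` by `F-free`, and so would its sub `σ`, which is in `T y`.
  label-D̄ : ∀ {x y σ} → Cov S x y σ → ∀ τ → D̄ σ τ → τ ≢ σ → T x τ
  label-D̄ {x} {y} {σ} c = strongInduction _ go
    where
    open Cover S
    open Cov c
    go : ∀ τ → (∀ ρ → ρ Fin.< τ → D̄ σ ρ → ρ ≢ σ → T x ρ) → D̄ σ τ → τ ≢ σ → T x τ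
    go τ rec d@(l , r , o , _) τ≢σ with Finₚ.<-cmp τ σ
    ... | tri< τ<σ _ _ = Qσ τ (⇒Q d τ<σ)
    ... | tri≈ _ eq _ = ⊥-elim (τ≢σ eq)
    ... | tri> τ≮σ _ σ<τ with shorter o
    ...   | inj₁ τ<σ = ⊥-elim (τ≮σ τ<σ)
    ...   | inj₂ eq = decide (Q-TF allQ)
      where
      σUτ : U σ τ
      σUτ = ⇒U (D̄⇒Ū eq d) σ<τ
      allQ : AllQ x τ
      allQ ρ q = rec ρ (Q-< q) (Down-trans (Q⇒ q) d) λ { refl → QU⊥ q σUτ }
      decide : T x τ ⊎ F x τ → T x τ
      decide (inj₁ t) = t
      decide (inj₂ f) with F-free c τ allQ f
      ... | inj₁ eq = ⊥-elim (τ≢σ eq)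
      ... | inj₂ fy = ⊥-elim (TF⊥ Tσ (F-U fy σUτ))

  Downs⊆T : X → Maybe ℕ → Seg → Maybe ℕ → Set
  Downs⊆T x a q b = ∀ σ → Down a q b σ → T x σ

  Downs⊆T? : ∀ x a q b → Dec (Downs⊆T x a q b)
  Downs⊆T? x a q b = Finₚ.all? (λ σ → Down? a q b σ →-dec T? x σ)

  leastBad : ∀ {x a q b} → ¬ Downs⊆T x a q b → ∃[ σ ] (Down a q b σ × ¬ T x σ × AllQ x σ)
  leastBad {x} {a} {q} {b} ¬all with Finₚ.any? (λ σ → Down? a q b σ ×-dec ¬? (T? x σ))
  ... | no none = ⊥-elim (¬all λ σ d → decidable-stable (T? x σ) λ ¬t → none (σ , d , ¬t))
  ... | yes (σ , h) with least (λ σ → Down? a q b σ ×-dec ¬? (T? x σ)) σ h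
  ...   | σ , (d , ¬t) , min = σ , d , ¬t , λ ρ q′ → decidable-stable (T? x ρ) λ ¬tρ →
            min ρ (Q-< q′) (Down-trans (Q⇒ q′) d , ¬tρ)

  leastBadF : ∀ {x a q b} → ¬ Downs⊆T x a q b → ∃[ σ ] (Down a q b σ × F x σ × AllQ x σ)
  leastBadF ¬all with leastBad ¬all
  ... | σ , d , ¬t , allQ = σ , d , [ (λ t → ⊥-elim (¬t t)) , id ]′ (Q-TF allQ) , allQ

module Nesting (Λ : Linked) where
  open Linked Λ
  open Closure Λ

  private
    nest-At : ∀ (o : LetterOrder) k {l′ l a c d} → let open LetterOrder o in k <∣> l′ ≡ l →
              At _≼_ (l <∣> a) c → At (λ x y → y ≼ x) (l′ <∣> a) d → At _≼_ (k <∣> just d) c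
    nest-At o (just g) refl x y = x
    nest-At o nothing {l′} {_} {a} refl x y = At-through o {l′ <∣> a} x y

  -- At an end where `σ` lies strictly inside `τ`, the edge met there is the one met by the word. At
  -- a common end the letter of the word lies between the two gaps, that of `τ` being on the small
  -- side.
  nested : ∀ {a q b σ τ} → Down a q b σ → Up a q b τ → seg σ L.⊴ seg τ → seg σ R.⊴ seg τ → D̄ τ σ
  nested (l , r , o , x , y) (l′ , r′ , o′ , x′ , y′) σ⊴ₗτ σ⊴ᵣτ with nest o o′ σ⊴ₗτ σ⊴ᵣτ
  ... | k , s , o″ with occ-unique (occ-trans o″ o′) o
  ...   | eqₗ , eqᵣ = k , s , o″ , nest-At L.order k eqₗ x x′ , nest-At R.order s eqᵣ y y′

-- Extending segments to routes of a torsion pair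

module Extension₀ (Λ : Linked) where
  open Linked Λ
  open Closure Λ
  open Nesting Λ
  private
    module C* = Closure (flipLinked Λ)
    module N* = Nesting (flipLinked Λ)

  Ups⊆F : X → Maybe ℕ → Seg → Maybe ℕ → Set
  Ups⊆F x a q b = ∀ σ → Up a q b σ → F x σ

  Good : X → Maybe ℕ → Seg → Maybe ℕ → Set
  Good x a q b = Downs⊆T x a q b × Ups⊆F x a q b

  -- Goodness of `q` takes care of strings that end before `q` does. A bad string `σ` crossed down
  -- and a bad `τ` crossed up would therefore both end where `q` ends, so one is nested in the other
  -- and `nested` makes the two sides clash.
  side : ∀ {x a q} → Good x a q nothing → ∀ f → Downs⊆T x a q (just f) ⊎ Ups⊆F x a q (just f)
  side {x} {a} {q} (down , up) f with Downs⊆T? x a q (just f) | C*.Downs⊆T? x a q (just f)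
  ... | yes A | _ = inj₁ A
  ... | no _  | yes B = inj₂ B
  ... | no ¬A | no ¬B with leastBadF ¬A | C*.leastBadF ¬B
  ...   | σ , dσ , fσ , _ | τ , uτ , tτ , _ = ⊥-elim (clash dσ uτ)
    where
    clash : Down a q (just f) σ → Up a q (just f) τ → ⊥
    clash (l , just k , o , x′ , y) _ = TF⊥ (down σ (l , just k , o , x′ , y)) fσ
    clash (l , nothing , o , _) (l′ , just k , o′ , x′ , y) = TF⊥ tτ (up τ (l′ , just k , o′ , x′ , y))
    clash d@(l , nothing , o , _) u@(l′ , nothing , o′ , _) with L.⊴-total (seg σ) (seg τ)
    ... | inj₁ σ⊴τ = TF⊥ (T-D̄ σ tτ (nested d u σ⊴τ (R.⊴-trans (R.occ-⊴ o) (R.occ-end o′)))) fσ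
    ... | inj₂ τ⊴σ = TF⊥ tτ (C*.T-D̄ τ fσ (N*.nested u d τ⊴σ (R.⊴-trans (R.occ-⊴ o′) (R.occ-end o))))

  Down-weaken : ∀ {a q f g σ} → f R.≼ g → Down a q (just g) σ → Down a q (just f) σ
  Down-weaken f≼g (l , just k , o , x , y) = l , just k , o , x , y
  Down-weaken f≼g (l , nothing , o , x , y) = l , nothing , o , x , R.≼-trans f≼g y

  good-letter : ∀ {x a q h} → Good x a q nothing →
                (∀ {f} → f ∈ R.gaps q → h R.≼ f → Downs⊆T x a q (just f)) →
                (∀ {f} → f ∈ R.gaps q → f R.≼ h → Ups⊆F x a q (just f)) → Good x a q (just h)
  good-letter (down , up) A B =
    (λ { σ (l , just k , o , x , y) → down σ (l , just k , o , x , y)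
       ; σ (l , nothing , o , x , y) →
           A (R.gaps-up o (rgt-gap σ)) y σ (l , nothing , o , x , R.≼-refl) }) ,
    (λ { σ (l , just k , o , x , y) → up σ (l , just k , o , x , y)
       ; σ (l , nothing , o , x , y) →
           B (R.gaps-up o (rgt-gap σ)) y σ (l , nothing , o , x , R.≼-refl) })

  -- Among the gaps up to `f` that may be passed below, take the smallest one `b` and the edge `h`
  -- just below it. Gaps above `h` are at least `b` and inherit the permission; those below `h` lack
  -- it by minimality, so `side` lets them be passed above.
  leave-below : ∀ {x a q f} → Good x a q nothing → f ∈ R.gaps q → Downs⊆T x a q (just f) →
                ∃[ h ] (Snoc Occ R.room q h × h R.≼ f × Good x a q (just h))
  leave-below {x} {a} {q} {f} good f∈ Af
    with minimum R.order (λ c → R.≼? c f ×-dec Downs⊆T? x a q (just c)) (R.gaps q)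
  ... | inj₁ none = ⊥-elim (none f∈ (R.≼-refl , Af))
  ... | inj₂ (b , b∈ , (b≼f , Ab) , min) with R.extend-≼ b∈
  ...   | h , sn , h≼b , above = h , sn , R.≼-trans h≼b b≼f , good-letter good A B
    where
    A : ∀ {g} → g ∈ R.gaps q → h R.≼ g → Downs⊆T x a q (just g)
    A g∈ h≼g σ d = Ab σ (Down-weaken (above g∈ h≼g) d)
    B : ∀ {g} → g ∈ R.gaps q → g R.≼ h → Ups⊆F x a q (just g)
    B {g} g∈ g≼h with side good g
    ... | inj₂ Bg = Bg
    ... | inj₁ Ag = ⊥-elim (R.gap-edge (Snoc.occ sn) (subst (_∈ R.gaps q) (R.≼-antisym g≼h h≼g) g∈))
      where
      h≼g : h R.≼ g
      h≼g = R.≼-trans h≼b (min g∈ (R.≼-trans g≼h (R.≼-trans h≼b b≼f) , Ag))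

  good-snoc : ∀ {x a q h} (sn : Snoc Occ R.room q h) → Good x a q (just h) → Good x a (Snoc.ext sn) nothing
  good-snoc {x} {a} {q} {h} sn (down , up) = down′ , up′
    where
    down′ : Downs⊆T x a (Snoc.ext sn) nothing
    down′ σ (l , just k , o , u , v) with Snoc.split sn o
    ... | inj₁ o′ = down σ (l , just k , o′ , u , v)
    ... | inj₂ (o′ , refl) = down σ (l , nothing , o′ , u , v)
    up′ : Ups⊆F x a (Snoc.ext sn) nothing
    up′ σ (l , just k , o , u , v) with Snoc.split sn o
    ... | inj₁ o′ = up σ (l , just k , o′ , u , v)
    ... | inj₂ (o′ , refl) = up σ (l , nothing , o′ , u , v)

module Extension₁ (Λ : Linked) where
  open Linked Λ
  open Closure Λ
  open Extension₀ Λ public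
  private module E* = Extension₀ (flipLinked Λ)

  leave-above : ∀ {x a q f} → Good x a q nothing → f ∈ R.gaps q → Ups⊆F x a q (just f) →
                ∃[ h ] (Snoc Occ R.room q h × f R.≼ h × Good x a q (just h))
  leave-above (down , up) f∈ B with E*.leave-below (up , down) f∈ B
  ... | h , sn , f≼h , (up′ , down′) = h , sn , f≼h , (down′ , up′)

  -- Any gap at the end of `q` may be passed on one side by `side`; where there is no gap, no string
  -- ends and every edge is good.
  advance : ∀ {x a q} → Good x a q nothing →
            R.Terminal q ⊎ ∃[ h ] (Snoc Occ R.room q h × Good x a q (just h))
  advance {x} {a} {q} good with R.extend q
  ... | inj₁ t = inj₁ t
  ... | inj₂ (h , sn) = inj₂ (go (R.gaps q) refl)
    where
    go : ∀ gs → R.gaps q ≡ gs → ∃[ h ] (Snoc Occ R.room q h × Good x a q (just h))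
    go [] eq = h , sn , good-letter good (λ f∈ → ⊥-elim (none eq f∈)) (λ f∈ → ⊥-elim (none eq f∈))
      where
      none : ∀ {f gs} → gs ≡ [] → ¬ (f ∈ gs)
      none refl ()
    go (f ∷ _) eq with side good f
    ... | inj₁ A = let (h , sn , _ , g) = leave-below good (subst (f ∈_) (sym eq) (here refl)) A in h , sn , g
    ... | inj₂ B = let (h , sn , _ , g) = leave-above good (subst (f ∈_) (sym eq) (here refl)) B in h , sn , g

  complete : ∀ {x a q} → Good x a q nothing →
             ∃[ q′ ] ∃[ r ] (Good x a q′ nothing × R.Terminal q′ × Occ q q′ nothing r)
  complete {x} {a} {q} good = go q good (ℕᵢ.<-wellFounded (R.room q))
    where
    go : ∀ q → Good x a q nothing → Acc ℕ._<_ (R.room q) →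
         ∃[ q′ ] ∃[ r ] (Good x a q′ nothing × R.Terminal q′ × Occ q q′ nothing r)
    go q good (acc rec) with advance good
    ... | inj₁ t = q , nothing , good , t , occ-refl q
    ... | inj₂ (h , sn , good′) with go (Snoc.ext sn) (good-snoc sn good′) (rec (Snoc.room< sn))
    ...   | q′ , r , good″ , t , o = q′ , just h , good″ , t , occ-trans (Snoc.occ sn) o

  complete-after : ∀ {x a q h} → Snoc Occ R.room q h → Good x a q (just h) →
                   ∃[ q′ ] (Good x a q′ nothing × R.Terminal q′ × Occ q q′ nothing (just h))
  complete-after sn good with complete (good-snoc sn good)
  ... | q′ , r , good′ , t , o = q′ , good′ , t , occ-trans (Snoc.occ sn) o

module Extension (Λ : Linked) where
  open Linked Λ
  open Closure Λ
  open Extension₁ Λ public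
  private
    module E* = Extension₁ (revLinked Λ)
    module C* = Closure (flipLinked Λ)

  record Route (x : X) (q : Seg) : Set where
    constructor route
    field
      startsAtSource : L.Terminal q
      endsAtSink     : R.Terminal q
      good           : Good x nothing q nothing

  Good-rev : ∀ {x a q b} → Good x a q b → E*.Good x b q a
  Good-rev (down , up) = (λ σ d → down σ (Down-rev G d)) , (λ σ u → up σ (Up-rev G u))

  Good-unrev : ∀ {x a q b} → E*.Good x b q a → Good x a q b
  Good-unrev (down , up) = (λ σ d → down σ (Down-rev (revGeo G) d)) , (λ σ u → up σ (Up-rev (revGeo G) u))

  forget-left : ∀ {x a q b} → Good x a q b → Good x nothing q b
  forget-left (down , up) =
    (λ { σ (just k , r , o , x , y) → down σ (just k , r , o , x , y) }) ,
    (λ { σ (just k , r , o , x , y) → up σ (just k , r , o , x , y) })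

  -- Leave the brick on the small side, keeping the gap on its left as a letter while extending
  -- to the right, and only then extend to the left.
  crossing : ∀ {x} σ → T x σ → AllU x σ → ∃[ q ] (Route x q × Down nothing q nothing σ)
  crossing {x} σ t allU =
    let (h , sn , h≼f , good₁) = leave-below start (rgt-gap σ) (λ τ d → T-D̄ τ t d)
        (q₁ , good₂ , term , o₁) = complete-after sn good₁
        (g , sn′ , g≼e , good₃) = E*.leave-below (Good-rev (forget-left good₂)) (L.gaps-up o₁ (lft-gap σ))
                                    (λ τ d → proj₁ good₂ τ (Down-rev G d))
        (q₂ , good₄ , term′ , o₂) = E*.complete-after sn′ good₃
    in q₂ , route term′ (R.terminal-up o₂ term) (Good-unrev good₄) ,
       just g , just h , occ-trans o₁ o₂ , g≼e , h≼f
    where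
    start : Good x (just (lft σ)) (seg σ) nothing
    start = (λ { τ (l , just k , o , a , b) → T-D̄ τ t (l , just k , o , a , b) }) ,
            (λ { τ (l , just k , o , a , b) → proper τ l k o a b })
      where
      -- With no letter on the right, only strings ending before `σ` does are crossed; they are not
      -- on the path of `σ`, so those crossed up are proper subs.
      proper : ∀ τ l k → Occ (seg τ) (seg σ) l (just k) → _ → _ → F x τ
      proper τ l k o a b with shorter o
      ... | inj₁ τ<σ = allU τ (⇒U (l , just k , o , a , b) τ<σ)
      ... | inj₂ eq with occ-equal eq o
      ...   | _ , ()

-- Uniqueness of the route crossing the label of a cover

module Fork (Λ : Linked) where
  open Linked Λ
  open Closure Λ
  open Nesting Λ
  open Extension₀ Λ
  open Cover S using (F-free)
  private
    module C* = Closure (flipLinked Λ)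
    module N* = Nesting (flipLinked Λ)

  -- The string `γ` runs along `p` from the left gap of `σ` to the gap at the fork. It is in `F x`
  -- because `q₂` crosses it up. On the other hand a string `ρ` that `γ` crosses down is in `T x`:
  -- if it starts later, `q₁` crosses it down; if it starts with `σ`, it is nested with `σ`, and the
  -- cover settles it.
  no-fork : ∀ {x y σ p q₁ q₂ g₁ g₂ h₁ h₂ f r} → Cov S x y σ →
            Good x nothing q₁ nothing → Good x nothing q₂ nothing →
            Occ (seg σ) p nothing r → Occ p q₁ (just g₁) (just h₁) → Occ p q₂ (just g₂) (just h₂) →
            lft σ L.≼ g₂ → At (flip R._≼_) (r <∣> just h₁) (rgt σ) →
            f ∈ R.gaps p → h₁ R.≼ f → f R.≼ h₂ → ⊥
  no-fork {x} {y} {σ} {p} {q₁} {q₂} {g₁} {g₂} {h₁} {h₂} {f} {r} c (down₁ , up₁) (down₂ , up₂)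
          o o₁ o₂ e≼g₂ cross f∈ h₁≼f f≼h₂ with string (L.gaps-up o (lft-gap σ)) f∈
  ... | γ , refl , eqₗ , refl = contra (leastBadF (λ all → TF⊥ (all γ (D̄-refl γ)) F-γ))
    where
    open Cov c
    F-γ : F x γ
    F-γ = up₂ γ (just g₂ , just h₂ , o₂ , subst (L._≼ g₂) (sym eqₗ) e≼g₂ , f≼h₂)

    right-letter : ∀ r → At (flip R._≼_) (r <∣> just h₁) (rgt σ) → At (flip R._≼_) (r <∣> just f) (rgt σ)
    right-letter (just k) a = a
    right-letter nothing  a = R.≼-trans a h₁≼f

    σ-sub : Ū γ σ
    σ-sub = nothing , r , o , subst (lft σ L.≼_) (sym eqₗ) L.≼-refl , right-letter r cross

    σ-not-quotient : ¬ D̄ γ σ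
    σ-not-quotient (l′ , r′ , o′ , _ , v) with occ-unique o′ o
    ... | refl , refl = go r o cross v
      where
      go : ∀ r → Occ (seg σ) (seg γ) nothing r → At (flip R._≼_) (r <∣> just h₁) (rgt σ) →
           At R._≼_ (r <∣> just f) (rgt σ) → ⊥
      go (just k) o a v = R.gap-edge o (subst (_∈ R.gaps (seg σ)) (R.≼-antisym a v) (rgt-gap σ))
      go nothing  o a v = R.gap-edge o₁ (subst (_∈ R.gaps (seg γ))
        (R.≼-antisym (R.≼-trans v a) h₁≼f) f∈)

    contra : ∃[ ρ ] (D̄ γ ρ × F x ρ × AllQ x ρ) → ⊥
    contra (ρ , (just k , r′ , o′ , u , v) , fρ , _) =
      TF⊥ (down₁ ρ (just k , r′ <∣> just h₁ , occ-trans o′ o₁ , u , letter r′ v)) fρ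
      where
      letter : ∀ r′ → At R._≼_ (r′ <∣> just f) (rgt ρ) → At R._≼_ ((r′ <∣> just h₁) <∣> nothing) (rgt ρ)
      letter (just _) v = v
      letter nothing  v = R.≼-trans h₁≼f v
    contra (ρ , d@(nothing , r′ , o′ , u , v) , fρ , allQ) with R.⊴-total (seg ρ) (seg σ)
    ... | inj₁ ρ⊴σ = TF⊥ (label-D̄ c ρ (nested d σ-sub (L.⊴-trans (L.occ-⊴ o′) (L.occ-end o)) ρ⊴σ)
                           (λ { refl → σ-not-quotient d })) fρ
    ... | inj₂ σ⊴ρ with F-free c ρ allQ fρ
    ...   | inj₁ refl = σ-not-quotient d
    ...   | inj₂ fy = TF⊥ Tσ (C*.T-D̄ σ fy (N*.nested σ-sub d (L.⊴-trans (L.occ-⊴ o) (L.occ-end o′)) σ⊴ρ))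

  common-tail : ∀ {x y σ q₁ q₂} → Cov S x y σ → R.Terminal q₁ → R.Terminal q₂ →
                Good x nothing q₁ nothing → Good x nothing q₂ nothing →
                Up nothing q₁ nothing σ → Up nothing q₂ nothing σ →
                ∃[ p ] ∃[ r ] ∃[ l₁ ] ∃[ l₂ ]
                  (Occ (seg σ) p nothing r × Occ p q₁ l₁ nothing × Occ p q₂ l₂ nothing)
  common-tail {x} {y} {σ} {q₁} {q₂} c t₁ t₂ good₁ good₂
              (just g₁ , just h₁ , o₁ , a₁ , b₁) (just g₂ , just h₂ , o₂ , a₂ , b₂) with R.common o₁ o₂
  ... | p , r , s₁ , s₂ , o , o₁′ , o₂′ , div = cases s₁ s₂ o₁′ o₂′ div
    where
    letter : ∀ {q g h s} r → Occ (seg σ) p nothing r → Occ p q (just g) (just s) →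
             Occ (seg σ) q (just g) (just h) → rgt σ R.≼ h → At (flip R._≼_) (r <∣> just s) (rgt σ)
    letter (just k) o o′ o″ b with occ-unique (occ-trans o o′) o″
    ... | _ , refl = b
    letter nothing o o′ o″ b with occ-unique (occ-trans o o′) o″
    ... | _ , refl = b
    cases : ∀ s₁ s₂ → Occ p q₁ (just g₁) s₁ → Occ p q₂ (just g₂) s₂ → Diverge R._≼_ (R.gaps p) s₁ s₂ → _
    cases nothing nothing o₁′ o₂′ _ = p , r , _ , _ , o , o₁′ , o₂′
    cases nothing (just _) o₁′ o₂′ end₁ = ⊥-elim (R.terminal-max (R.terminal-down o₁′ t₁) o₂′)
    cases (just _) nothing o₁′ o₂′ end₂ = ⊥-elim (R.terminal-max (R.terminal-down o₂′ t₂) o₁′)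
    cases (just _) (just _) o₁′ o₂′ (fork₁ f∈ u v) =
      ⊥-elim (no-fork c good₁ good₂ o o₁′ o₂′ a₂ (letter r o o₁′ o₁ b₁) f∈ u v)
    cases (just _) (just _) o₁′ o₂′ (fork₂ f∈ u v) =
      ⊥-elim (no-fork c good₂ good₁ o o₂′ o₁′ a₁ (letter r o o₂′ o₂ b₂) f∈ u v)

module Crossing (Λ : Linked) where
  open Linked Λ
  open Closure Λ
  open Extension Λ
  open Fork Λ
  private
    module C* = Closure (flipLinked Λ)
    module F* = Fork (revLinked Λ)

  unique-crossing : ∀ {x y σ q₁ q₂} → Cov S x y σ → Route x q₁ → Route x q₂ →
                    Up nothing q₁ nothing σ → Up nothing q₂ nothing σ → q₁ ≡ q₂
  unique-crossing {x} {y} {σ} {q₁} {q₂} c (route s₁ t₁ good₁) (route s₂ t₂ good₂)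
                  u₁@(just g₁ , just h₁ , o₁ , a₁ , b₁) u₂@(just g₂ , just h₂ , o₂ , a₂ , b₂)
    with F*.common-tail c s₁ s₂ (Good-rev good₁) (Good-rev good₂)
           (Up-rev (revGeo G) u₁) (Up-rev (revGeo G) u₂)
  ... | p , l , _ , _ , o , o₁′ , o₂′ with R.common o₁′ o₂′
  ...   | p′ , r , k₁ , k₂ , o′ , o₁″ , o₂″ , div = cases k₁ k₂ o₁″ o₂″ div
    where
    -- The common part is cut back to start where `σ` starts, the position that `no-fork` requires.
    open Σ (L.truncate (occ-trans o o′)) renaming (proj₁ to p″; proj₂ to occs)
    σ∈p″ : Occ (seg σ) p″ nothing r
    σ∈p″ = proj₂ occs
    fork : ∀ {q₁ q₂ g₁ g₂ k₁ k₂ h₁ h₂ f} → Good x nothing q₁ nothing → Good x nothing q₂ nothing →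
           Occ (seg σ) q₁ (just g₁) (just h₁) → Occ (seg σ) q₂ (just g₂) (just h₂) →
           lft σ L.≼ g₂ → rgt σ R.≼ h₁ →
           Occ p′ q₁ nothing (just k₁) → Occ p′ q₂ nothing (just k₂) →
           f ∈ R.gaps p′ → k₁ R.≼ f → f R.≼ k₂ → ⊥
    fork {q₁} {q₂} {g₁} {g₂} {k₁} {k₂} {h₁} good₁ good₂ oσ₁ oσ₂ a b o₁ o₂ f∈ u v
      with occ-trans (proj₁ occs) o₁ | occ-trans (proj₁ occs) o₂
    ... | w₁ | w₂ with occ-unique (occ-trans σ∈p″ w₁) oσ₁ | occ-unique (occ-trans σ∈p″ w₂) oσ₂
    ...   | e₁ , e₁′ | e₂ , _ =
      no-fork c good₁ good₂ σ∈p″ (subst (λ m → Occ p″ q₁ m (just k₁)) e₁ w₁)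
              (subst (λ m → Occ p″ q₂ m (just k₂)) e₂ w₂) a
              (subst (λ m → At (flip R._≼_) m (rgt σ)) (sym e₁′) b)
              (R.gaps-down (proj₁ occs) f∈) u v
    cases : ∀ k₁ k₂ → Occ p′ q₁ nothing k₁ → Occ p′ q₂ nothing k₂ → Diverge R._≼_ (R.gaps p′) k₁ k₂ → q₁ ≡ q₂
    cases nothing nothing w₁ w₂ _ = trans (sym (occ-antisym w₁)) (occ-antisym w₂)
    cases nothing (just _) w₁ w₂ end₁ = ⊥-elim (R.terminal-max (R.terminal-down w₁ t₁) w₂)
    cases (just _) nothing w₁ w₂ end₂ = ⊥-elim (R.terminal-max (R.terminal-down w₂ t₂) w₁)
    cases (just _) (just _) w₁ w₂ (fork₁ f∈ u v) = ⊥-elim (fork good₁ good₂ o₁ o₂ a₂ b₁ w₁ w₂ f∈ u v)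
    cases (just _) (just _) w₁ w₂ (fork₂ f∈ u v) = ⊥-elim (fork good₂ good₁ o₂ o₁ a₁ b₂ w₂ w₁ f∈ u v)

  -- The strings that leave F are `σ` and strings with `σ` as a sub; a route crossing one of them up
  -- crosses `σ` up as well.
  survives : ∀ {x y σ q} → Cov S x y σ → Route x q → ¬ Up nothing q nothing σ → Route y q
  survives {x} {y} {σ} {q} c (route s t (down , up)) ¬u =
    route s t ((λ τ d → below τ (down τ d)) , λ τ u → decidable-stable (F? y τ) λ ¬f →
      [ (λ { refl → ¬u u }) , (λ σUτ → ¬u (C*.Down-trans (U⇒ σUτ) u)) ]′ (ΔF τ (up τ u) ¬f))
    where open Cov c

  Good-sub : ∀ {x p q l r} → Occ p q l r → Good x nothing q nothing → Good x nothing p nothing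
  Good-sub o (down , up) =
    (λ { τ (just k , just k′ , o′ , u , v) → down τ (just k , just k′ , occ-trans o′ o , u , v) }) ,
    (λ { τ (just k , just k′ , o′ , u , v) → up τ (just k , just k′ , occ-trans o′ o , u , v) })

-- Exchanged routes cross in one direction only

module DoubleCrossing₀ (Λ : Linked) where
  open Linked Λ
  open Closure Λ
  open Nesting Λ
  open Extension Λ
  open Crossing Λ
  private
    module C* = Closure (flipLinked Λ)
    module N* = Nesting (flipLinked Λ)

  -- If ρ ends to the right of σ, follow q up to the end of ρ and leave ρ on the other side:
  -- this gives a route of x different from q which still crosses σ up, and which is therefore
  -- not available in y.
  ends-later : ∀ {x y q σ ρ} → Route x q → (∀ {r} → Route x r → r ≡ q ⊎ Route y r) →
               T y σ → F y ρ → Up nothing q nothing σ → Down nothing q nothing ρ →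
               ¬ (seg ρ R.⊴ seg σ) → ⊥
  ends-later {x} {y} {q} {σ} {ρ} (route s t good) exchange tσ fρ
             (just g , just k , oσ , a , b) (just l , just h , oρ , a′ , b′) ρ⋬σ
    with R.truncate oρ
  ... | p , o₁ , o₂ = split (C*.Downs⊆T? x nothing p (just (rgt ρ)))
    where
    good-p : Good x nothing p nothing
    good-p = Good-sub o₁ good

    σ⊴p : seg σ R.⊴ p
    σ⊴p with R.⊴-total (seg σ) (seg ρ)
    ... | inj₁ σ⊴ρ = R.⊴-trans σ⊴ρ (R.occ-⊴ o₂)
    ... | inj₂ ρ⊴σ = ⊥-elim (ρ⋬σ ρ⊴σ)

    crosses : ∀ {q′ h′} → Occ p q′ nothing (just h′) → Up nothing q′ nothing σ
    crosses {q′} {h′} o with nest oσ o₁ (L.⊴-trans (L.occ-⊴ oσ) (L.occ-end o₁)) σ⊴p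
    ... | m , nothing , o₃ = ⊥-elim (ρ⋬σ (R.⊴-trans (R.occ-⊴ o₂) (R.occ-end o₃)))
    ... | m , just _ , o₃ with occ-unique (occ-trans o₃ o₁) oσ
    ...   | eq , refl = just g , just k ,
            subst (λ l → Occ (seg σ) q′ l (just k)) eq (occ-trans o₃ o) , a , b

    diverted : ∀ {h′ q′} → rgt ρ R.≼ h′ → Occ p q′ nothing (just h′) → Route x q′ → ⊥
    diverted f≼h′ o r with exchange r
    ... | inj₂ r′ = TF⊥ tσ (proj₂ (Route.good r′) σ (crosses o))
    ... | inj₁ refl with occ-unique o o₁
    ...   | _ , refl = R.gap-edge oρ (subst (_∈ R.gaps (seg ρ)) (R.≼-antisym f≼h′ b′) (rgt-gap ρ))

    -- The obstruction to the diversion is a string `κ` of `T x` that ends together with `ρ`. A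
    -- route of `x` crosses `κ` down; it is not `q`, which enters `κ` on the other side, so it is a
    -- route of `y` and `κ` is in `T y`. But `κ` and `ρ` are nested, and `ρ` is in `F y`.
    blocker : ∀ κ l → Occ (seg κ) p l nothing → At (flip L._≼_) (l <∣> nothing) (lft κ) →
              rgt κ R.≼ rgt ρ → ∃[ q′ ] (Route x q′ × Down nothing q′ nothing κ) → ⊥
    blocker κ (just m) o u v (q′ , r′ , down-κ) with exchange r′
    blocker κ (just m) o u v (q′ , r′ , _ , _ , o′ , u′ , _) | inj₁ refl with occ-unique o′ (occ-trans o o₁)
    ... | refl , _ = L.gap-edge o (subst (_∈ L.gaps (seg κ)) (L.≼-antisym u u′) (lft-gap κ))
    blocker κ (just m) o u v (q′ , r′ , down-κ) | inj₂ r″ with L.⊴-total (seg ρ) (seg κ)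
    ... | inj₁ ρ⊴κ = TF⊥ (T-D̄ ρ (proj₁ (Route.good r″) κ down-κ)
                      (nested {nothing} {p} {just (rgt ρ)} (just l , nothing , o₂ , a′ , R.≼-refl) (just m , nothing , o , u , v) ρ⊴κ
                              (R.⊴-trans (R.occ-⊴ o₂) (R.occ-end o)))) fρ
    ... | inj₂ κ⊴ρ = TF⊥ (proj₁ (Route.good r″) κ down-κ)
                      (C*.T-D̄ κ fρ (N*.nested {nothing} {p} {just (rgt ρ)} (just m , nothing , o , u , v) (just l , nothing , o₂ , a′ , R.≼-refl)
                                     κ⊴ρ (R.⊴-trans (R.occ-⊴ o) (R.occ-end o₂))))

    blocked : ∃[ κ ] (Up nothing p (just (rgt ρ)) κ × T x κ × AllU x κ) → ⊥
    blocked (κ , (just m , just n , o , u , v) , tκ , _) =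
      TF⊥ tκ (proj₂ good-p κ (just m , just n , o , u , v))
    blocked (κ , (m , nothing , o , u , v) , tκ , allU) = blocker κ m o u v (crossing κ tκ allU)

    split : Dec (∀ τ → Up nothing p (just (rgt ρ)) τ → F x τ) → ⊥
    split (yes B) =
      after (leave-above good-p (R.gaps-up o₂ (rgt-gap ρ)) B)
      where
      after : ∃[ h′ ] (Snoc Occ R.room p h′ × rgt ρ R.≼ h′ × Good x nothing p (just h′)) → ⊥
      after (h′ , sn , f≼h′ , good₁) with complete-after sn good₁
      ... | q′ , good₂ , t′ , o = diverted f≼h′ o (route (L.terminal-up o (L.terminal-down o₁ s)) t′ good₂)
    split (no ¬B) = blocked (C*.leastBadF ¬B)

module DoubleCrossing (Λ : Linked) where
  open Linked Λ
  open Extension Λ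
  open DoubleCrossing₀ Λ
  private
    module D* = DoubleCrossing₀ (flipLinked Λ)
    module E* = Extension (flipLinked Λ)

  Route-flip : ∀ {x q} → Route x q → E*.Route x q
  Route-flip (route s t (down , up)) = E*.route s t (up , down)

  Route-unflip : ∀ {x q} → E*.Route x q → Route x q
  Route-unflip (E*.route s t (up , down)) = route s t (down , up)

  -- Let `h` and `h′` be the edges by which `q` and `q′` leave the common right end. Then `rgt ρ` ≼
  -- `h′` ≼ `rgt σ` ≼ `h` ≼ `rgt ρ`, so an edge would coincide with a gap.
  same-end : ∀ {q q′ σ ρ} → seg σ L.⊴ seg ρ →
             Up nothing q nothing σ → Down nothing q′ nothing σ →
             Down nothing q nothing ρ → Up nothing q′ nothing ρ →
             seg σ R.⊴ seg ρ → seg ρ R.⊴ seg σ → ⊥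
  same-end {q} {q′} {σ} {ρ} σ⊴ₗρ (just _ , just _ , oσ , _ , b₁) (just _ , just _ , oσ′ , _ , b₂)
           (just _ , just _ , oρ , _ , b₃) (just _ , just _ , oρ′ , _ , b₄) σ⊴ρ ρ⊴σ
    with nest oσ oρ σ⊴ₗρ σ⊴ρ
  ... | _ , just _ , o = R.occ-inner o ρ⊴σ
  ... | _ , nothing , o with occ-unique (occ-trans o oρ) oσ | occ-unique (occ-trans o oρ′) oσ′
  ...   | _ , refl | _ , refl =
    R.gap-edge oρ (subst (_∈ R.gaps (seg ρ)) (R.≼-antisym (R.≼-trans b₄ (R.≼-trans b₂ b₁)) b₃) (rgt-gap ρ))

  not-same-end : ∀ {q q′ σ ρ} → Up nothing q nothing σ → Down nothing q′ nothing σ →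
                 Down nothing q nothing ρ → Up nothing q′ nothing ρ →
                 seg σ R.⊴ seg ρ → seg ρ R.⊴ seg σ → ⊥
  not-same-end {q} {q′} {σ} {ρ} u d′ d u′ a b with L.⊴-total (seg σ) (seg ρ)
  ... | inj₁ c = same-end {q} {q′} c u d′ d u′ a b
  ... | inj₂ c = same-end {q′} {q} c u′ d d′ u b a

  -- Of two strings crossed oppositely, one ends strictly later, and `ends-later` or its flip
  -- excludes it. Hence the direction of a flip at one vertex determines the direction on all
  -- strings.
  no-double-crossing : ∀ {x y q q′ σ ρ} → Route x q → Route y q′ →
                       (∀ {r} → Route x r → r ≡ q ⊎ Route y r) →
                       Up nothing q nothing σ → Down nothing q′ nothing σ →
                       Down nothing q nothing ρ → Up nothing q′ nothing ρ → ⊥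
  no-double-crossing {x} {y} {q} {q′} {σ} {ρ} r r′ exchange u d′ d u′
    with R.⊴-total (seg σ) (seg ρ)
  ... | inj₁ σ⊴ρ = ends-later r exchange tσ fρ u d λ ρ⊴σ → not-same-end {q} {q′} u d′ d u′ σ⊴ρ ρ⊴σ
    where
    tσ = proj₁ (Route.good r′) σ d′
    fρ = proj₂ (Route.good r′) ρ u′
  ... | inj₂ ρ⊴σ = D*.ends-later (Route-flip r) (λ s → [ inj₁ , inj₂ ∘ Route-flip ]′ (exchange (Route-unflip s)))
                     fρ tσ d u λ σ⊴ρ → not-same-end {q} {q′} u d′ d u′ σ⊴ρ ρ⊴σ
    where
    tσ = proj₁ (Route.good r′) σ d′
    fρ = proj₂ (Route.good r′) ρ u′

-- The inner labels of a polygon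

module Words (Λ : Linked) where
  open Linked Λ

  -- The string on `p` is known only up to the equations `seg≡`, `lft≡` and `rgt≡`; the last four
  -- fields carry out the transport along them once and for all.
  record StringOn (p : Seg) (e f : ℕ) : Set where
    field
      name   : Fin N
      seg≡   : seg name ≡ p
      lft≡   : lft name ≡ e
      rgt≡   : rgt name ≡ f
      to-D̄   : ∀ {τ} → Down (just e) p (just f) τ → D̄ name τ
      from-Ū : ∀ {τ} → Ū name τ → Up (just e) p (just f) τ
      down   : ∀ {a q b l r} → Occ p q l r → At L._≼_ (l <∣> a) e → At R._≼_ (r <∣> b) f → Down a q b name
      up     : ∀ {a q b l r} → Occ p q l r → At (flip L._≼_) (l <∣> a) e → At (flip R._≼_) (r <∣> b) f →
               Up a q b name

  stringOn : ∀ {p e f} → e ∈ L.gaps p → f ∈ R.gaps p → StringOn p e f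
  stringOn e∈ f∈ with string e∈ f∈
  ... | σ , refl , refl , refl = record
    { name = σ ; seg≡ = refl ; lft≡ = refl ; rgt≡ = refl ; to-D̄ = id ; from-Ū = id
    ; down = λ o u v → _ , _ , o , u , v ; up = λ o u v → _ , _ , o , u , v }

  Up-prefix : ∀ {a p q b μ h} → Occ p q nothing (just h) → Up a p (just h) μ → Up a q b μ
  Up-prefix o (just k , just s , o′ , u , v) = just k , just s , occ-trans o′ o , u , v
  Up-prefix o (just k , nothing , o′ , u , v) = just k , _ , occ-trans o′ o , u , v
  Up-prefix o (nothing , just s , o′ , u , v) = nothing , just s , occ-trans o′ o , u , v
  Up-prefix o (nothing , nothing , o′ , u , v) = nothing , _ , occ-trans o′ o , u , v

module PolygonSide (Λ : Linked) (d : PolyData (Linked.S Λ)) where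
  open Linked Λ
  open Closure Λ
  open Nesting Λ
  open Words Λ
  open PolyData d
  open Polygons.Poly S d
  open Cov
  private
    module C* = Closure (flipLinked Λ)
    module N* = Nesting (flipLinked Λ)
    module O* = Order (dual S)
    module V* = Cover (dual S)

  -- By induction the quotients of `ν` are in `T y₁`, so `y₁` decides it. In `F y₁` it would contain
  -- `σ₂` by `side-U`, but it ends too early for that.
  avoids-σ₂ : ∀ ν → T m₁ ν → ¬ (seg σ₂ R.⊴ seg ν) → T y₁ ν
  avoids-σ₂ = strongInduction _ λ ν rec t ⋬ →
    [ id , (λ f → ⊥-elim (⋬ (let (_ , _ , o , _) = U⇒ (side-U ν f t) in R.occ-⊴ o))) ]′
    (Q-TF λ ρ q → rec ρ (Q-< q) (T-Q t q)
      λ σ₂⊴ρ → ⋬ (R.⊴-trans σ₂⊴ρ (let (_ , _ , o , _) = Q⇒ q in R.occ-⊴ o)))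

  -- If all subs of `ν` were in `F y₁`, then `ν` would already be in `T x`, and its quotient `σ₁`
  -- too. The least sub outside `F y₁` is in `T y₁`, and it is not `σ₁`, which cannot be both
  -- quotient and sub; so it was in T before the cover.
  old-sub : ∀ {ν} → T y₁ ν → Q σ₁ ν → ∃[ μ ] (Ū ν μ × T x μ)
  old-sub {ν} t q with O*.allQ? y₁ ν
  ... | yes allU = ⊥-elim ([ (λ { refl → ¬Q-refl q }) , (λ tx → TF⊥ (T-Q tx q) (Fσ up₁)) ]′
                            (V*.F-free (Cov-dual S up₁) ν allU t))
  ... | no ¬all with O*.leastNonT ¬all
  ...   | μ , u , ¬f , allU with U-TF allU
  ...     | inj₂ f = ⊥-elim (¬f f)
  ...     | inj₁ t′ with V*.F-free (Cov-dual S up₁) μ allU t′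
  ...       | inj₁ refl = ⊥-elim (QU⊥ q u)
  ...       | inj₂ tx = μ , U⇒ u , tx

  F-Ū-y₁ : ∀ {τ μ} → F y₁ τ → T x μ → ¬ Ū τ μ
  F-Ū-y₁ f t u = TF⊥ (below up₁ _ t) (C*.T-D̄ _ f u)

  T-y : ∀ {μ} → T x μ → T y μ
  T-y t = y₁⊑y _ (below up₁ _ t)

  σ₁-proper : ∀ {g} → Ū σ₁ g → g ≢ σ₁ → F y g
  σ₁-proper = C*.label-D̄ (Cov-dual S down₂) _

  longer : ∀ {τ l r} → Occ (seg σ₁) (seg τ) l r → l ≢ nothing ⊎ r ≢ nothing → σ₁ Fin.< τ
  longer o h with shorter o
  ... | inj₁ lt = lt
  ... | inj₂ eq with occ-equal eq o
  ...   | refl , refl = ⊥-elim ([ (λ n → n refl) , (λ n → n refl) ]′ h)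

  module Start (σ₂⋬σ₁ : ¬ (seg σ₂ R.⊴ seg σ₁)) {τ : Fin N} (fτ : F y₁ τ) (tτ : T m₁ τ) where
    ends-inside : ∀ {l} → ¬ Occ (seg σ₁) (seg τ) l nothing
    ends-inside o with U⇒ (side-U τ fτ tτ)
    ... | _ , _ , o₂ , _ = σ₂⋬σ₁ (R.⊴-trans (R.occ-⊴ o₂) (R.occ-end o))

    -- Cut `τ` at the right gap of `σ₁`. The resulting string `ν` is in `T m₁` and stops before
    -- `σ₂`, so it is in `T y₁` and `old-sub` gives it a sub `μ` in `T x`. If `μ` stops earlier, `τ`
    -- crosses it up too; otherwise `μ` is nested with `σ₁`. Each case is contradictory.
    not-inside : ∀ {g h} → Occ (seg σ₁) (seg τ) (just g) (just h) → g L.≼ lft σ₁ → h R.≼ rgt σ₁ → ⊥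
    not-inside {g} {h} o u v with R.truncate o
    ... | p , o₁ , o₂ = contra (old-sub ν∈y₁ (⇒Q σ₁∈ν (longer (subst (λ s → Occ _ s _ _) (sym seg≡) o₂) (inj₁ λ ()))))
      where
      open StringOn (stringOn {p} (L.gaps-down o₁ (lft-gap τ)) (R.gaps-up o₂ (rgt-gap σ₁)))
        renaming (name to ν)
      σ₁∈p : Down (just (lft τ)) p (just (rgt σ₁)) σ₁
      σ₁∈p = just g , nothing , o₂ , u , R.≼-refl
      σ₁∈ν : D̄ ν σ₁
      σ₁∈ν = to-D̄ σ₁∈p
      ν∈y₁ : T y₁ ν
      ν∈y₁ = avoids-σ₂ ν (T-D̄ ν tτ (down o₁ L.≼-refl v))
        λ σ₂⊴ν → σ₂⋬σ₁ (R.⊴-trans (subst (seg σ₂ R.⊴_) seg≡ σ₂⊴ν) (R.occ-end o₂))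
      contra : ∃[ μ ] (Ū ν μ × T x μ) → ⊥
      contra (μ , uμ , tμ) with from-Ū uμ
      ... | l , just k , oμ , a , b = F-Ū-y₁ fτ tμ (Up-prefix o₁ (l , just k , oμ , a , b))
      ... | w@(l , nothing , oμ , a , b) with L.⊴-total (seg μ) (seg σ₁)
      ...   | inj₁ μ⊴σ₁ = TF⊥ (T-y tμ) (σ₁-proper
                (N*.nested w σ₁∈p μ⊴σ₁ (R.⊴-trans (R.occ-⊴ oμ) (R.occ-end o₂)))
                (T≢F tμ (Fσ up₁)))
      ...   | inj₂ σ₁⊴μ = TF⊥ (T-D̄ σ₁ tμ
                (nested σ₁∈p w σ₁⊴μ (R.⊴-trans (R.occ-⊴ o₂) (R.occ-end oμ)))) (Fσ up₁)

    -- Otherwise the path of `σ₁` with the left gap of `τ` and the right gap of `σ₁` carries a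
    -- string in `T y`, as `τ` crosses it down, that `σ₁` crosses up; such strings are in `F y`.
    same-start : ∀ {h} → Occ (seg σ₁) (seg τ) nothing (just h) → lft τ L.≼ lft σ₁ → h R.≼ rgt σ₁ →
                 lft τ ≡ lft σ₁
    same-start {h} o u v with lft τ ℕ.≟ lft σ₁
    ... | yes eq = eq
    ... | no lft≢ = ⊥-elim (TF⊥ (below down₁ _ (T-D̄ γ tτ (down o L.≼-refl v)))
                               (σ₁-proper (up (occ-refl _) u R.≼-refl) γ≢σ₁))
      where
      open StringOn (stringOn {seg σ₁} (L.gaps-down o (lft-gap τ)) (rgt-gap σ₁)) renaming (name to γ)
      γ≢σ₁ : γ ≢ σ₁
      γ≢σ₁ eq = lft≢ (trans (sym lft≡) (cong lft eq))

    starts-with-σ₁ : ∃[ h ] (Occ (seg σ₁) (seg τ) nothing (just h) × h R.≼ rgt σ₁ × lft τ ≡ lft σ₁)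
    starts-with-σ₁ with Q⇒ (side-Q τ fτ tτ)
    ... | l , nothing , o , _ = ⊥-elim (ends-inside o)
    ... | just g , just h , o , u , v = ⊥-elim (not-inside o u v)
    ... | nothing , just h , o , u , v = h , o , v , same-start o u v

module PolygonSide₂ (Λ : Linked) (d : PolyData (Linked.S Λ)) where
  open Linked Λ
  open Closure Λ
  open Words Λ
  open PolyData d
  open Polygons.Poly S d
  open PolygonSide Λ d
  open Cov
  private
    -- Flip and reversal together exchange `σ₁` with `σ₂` and start with end, so `Start` also shows
    -- that an inner label ends with `σ₂`.
    module S* = PolygonSide (revLinked (flipLinked Λ)) (PolyData-dual S d)

  module Ordered (σ₂⋬σ₁ : ¬ (seg σ₂ R.⊴ seg σ₁)) (σ₁⋬σ₂ : ¬ (seg σ₁ L.⊴ seg σ₂)) where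
    record Spans (τ : Fin N) : Set where
      field
        {h g} : ℕ
        fτ   : F y₁ τ
        tτ   : T m₁ τ
        occ₁ : Occ (seg σ₁) (seg τ) nothing (just h)
        h≼   : h R.≼ rgt σ₁
        lft≡ : lft τ ≡ lft σ₁
        occ₂ : Occ (seg σ₂) (seg τ) (just g) nothing
        rgt≡ : rgt τ ≡ rgt σ₂

    spans : ∀ {τ} → F y₁ τ → T m₁ τ → Spans τ
    spans f t with Start.starts-with-σ₁ σ₂⋬σ₁ f t | S*.Start.starts-with-σ₁ σ₁⋬σ₂ t f
    ... | h , o , v , eq | g , o′ , v′ , eq′ =
      record { fτ = f ; tτ = t ; occ₁ = o ; h≼ = v ; lft≡ = eq ; occ₂ = o′ ; rgt≡ = eq′ }

    -- Let `ν` run from the left gap of `σ₁` to the gap at the fork; `τ` crosses it down, so it is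
    -- in `T m₁`. If `p` is longer than `σ₁`, a sub of `ν` in `T x` from `old-sub` is crossed up by
    -- `τ`, or by `τ′` when it reaches the fork. If `p` is the path of `σ₁`, then `σ₁` crosses `ν`
    -- up, which puts it in `F y`.
    no-fork : ∀ {τ τ′ p r k k′ f} → Spans τ → Spans τ′ → Occ (seg σ₁) p nothing r →
              Occ p (seg τ) nothing (just k) → Occ p (seg τ′) nothing (just k′) →
              f ∈ R.gaps p → k R.≼ f → f R.≼ k′ → ⊥
    no-fork {τ} {τ′} {p} {r} {k} {k′} {f} s s′ o o₁ o₂ f∈ k≼f f≼k′ = go r o
      where
      module s = Spans s
      module s′ = Spans s′
      open StringOn (stringOn {p} {lft σ₁} (L.gaps-up o (lft-gap σ₁)) f∈) renaming (name to ν)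
      ν∈m₁ : T m₁ ν
      ν∈m₁ = T-D̄ ν s.tτ (down o₁ (subst (L._≼ lft σ₁) (sym s.lft≡) L.≼-refl) k≼f)
      contra : ∃[ μ ] (Ū ν μ × T x μ) → ⊥
      contra (μ , uμ , tμ) with from-Ū uμ
      ... | l , just j , oμ , a , b = F-Ū-y₁ s.fτ tμ
              (subst (λ e → Up (just e) (seg τ) (just (rgt τ)) μ) (sym s.lft≡)
                     (Up-prefix o₁ (l , just j , oμ , a , b)))
      ... | l , nothing , oμ , a , b = F-Ū-y₁ s′.fτ tμ
              (subst (λ e → Up (just e) (seg τ′) (just (rgt τ′)) μ) (sym s′.lft≡)
                     (Up-prefix o₂ (l , nothing , oμ , a , R.≼-trans b f≼k′)))
      go : ∀ r → Occ (seg σ₁) p nothing r → ⊥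
      go (just j) o with occ-unique (occ-trans o o₁) s.occ₁
      ... | _ , refl = contra (old-sub ν∈y₁ (⇒Q (to-D̄ (nothing , just j , o , L.≼-refl , s.h≼))
                         (longer (subst (λ q → Occ _ q _ _) (sym seg≡) o) (inj₂ λ ()))))
        where
        ν∈y₁ : T y₁ ν
        ν∈y₁ = avoids-σ₂ ν ν∈m₁ λ σ₂⊴ν → R.occ-inner o₁
                 (R.⊴-trans (R.occ-end s.occ₂) (subst (seg σ₂ R.⊴_) seg≡ σ₂⊴ν))
      go nothing o with occ-antisym o
      ... | refl with occ-unique o₂ s′.occ₁
      ...   | _ , refl = TF⊥ (below down₁ ν ν∈m₁)
                (σ₁-proper (up (occ-refl _) L.≼-refl (R.≼-trans f≼k′ s′.h≼)) ν≢σ₁)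
        where
        ν≢σ₁ : ν ≢ σ₁
        ν≢σ₁ eq = R.gap-edge o₂ (subst (_∈ R.gaps (seg σ₁))
          (R.≼-antisym f≼k′ (subst (k′ R.≼_) (trans (cong rgt (sym eq)) rgt≡) s′.h≼)) f∈)

    unique : ∀ {τ τ′} → Spans τ → Spans τ′ → τ ≡ τ′
    unique {τ} {τ′} s s′ with R.common (Spans.occ₁ s) (Spans.occ₁ s′)
    ... | p , r , k , k′ , o , o₁ , o₂ , div = cases k k′ o₁ o₂ div
      where
      module s = Spans s
      module s′ = Spans s′
      not-prefix : ∀ {τ τ′ k} → Spans τ → Spans τ′ → Occ p (seg τ) nothing nothing →
                   ¬ Occ p (seg τ′) nothing (just k)
      not-prefix s s′ o₁ o₂ = R.occ-inner o₂
        (R.⊴-trans (R.occ-end (Spans.occ₂ s′)) (R.⊴-trans (R.occ-⊴ (Spans.occ₂ s)) (R.occ-end o₁)))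
      cases : ∀ k k′ → Occ p (seg τ) nothing k → Occ p (seg τ′) nothing k′ →
              Diverge R._≼_ (R.gaps p) k k′ → τ ≡ τ′
      cases nothing nothing o₁ o₂ _ = string-injective (trans (sym (occ-antisym o₁)) (occ-antisym o₂))
        (trans s.lft≡ (sym s′.lft≡)) (trans s.rgt≡ (sym s′.rgt≡))
      cases nothing (just _) o₁ o₂ end₁ = ⊥-elim (not-prefix s s′ o₁ o₂)
      cases (just _) nothing o₁ o₂ end₂ = ⊥-elim (not-prefix s′ s o₂ o₁)
      cases (just _) (just _) o₁ o₂ (fork₁ f∈ a b) = ⊥-elim (no-fork s s′ o o₁ o₂ f∈ a b)
      cases (just _) (just _) o₁ o₂ (fork₂ f∈ a b) = ⊥-elim (no-fork s′ s o o₂ o₁ f∈ a b)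

module PolygonLabels (Λ : Linked) (d : PolyData (Linked.S Λ)) where
  open Linked Λ
  open Closure Λ
  open Nesting Λ
  open PolyData d
  open Polygons.Poly S d
  open Cov
  private
    module C* = Closure (flipLinked Λ)
    module N* = Nesting (flipLinked Λ)
    module A = PolygonSide₂ Λ d
    module B = PolygonSide₂ (revLinked Λ) d

  -- Inside an inner label neither bottom label contains the other, since `nested` would put `σ₁` in
  -- `T x` or `σ₂` in `F y`. So they are staggered, and the two possible orders are mirror images
  -- under reversal.
  inner-label-unique : ∀ {τ τ′} → F y₁ τ → T m₁ τ → F y₁ τ′ → T m₁ τ′ → τ ≡ τ′
  inner-label-unique {τ} {τ′} f t f′ t′ = cases (L.⊴-total (seg σ₁) (seg σ₂)) (R.⊴-total (seg σ₁) (seg σ₂))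
    where
    not-inside₁ : seg σ₁ L.⊴ seg σ₂ → seg σ₁ R.⊴ seg σ₂ → ⊥
    not-inside₁ a b = TF⊥ (label-D̄ up₂ σ₁ (nested (Q⇒ (side-Q τ f t)) (U⇒ (side-U τ f t)) a b) σ₁≢σ₂) (Fσ up₁)
    not-inside₂ : seg σ₂ L.⊴ seg σ₁ → seg σ₂ R.⊴ seg σ₁ → ⊥
    not-inside₂ a b = TF⊥ (Tσ down₁) (C*.label-D̄ (Cov-dual S down₂) σ₂
      (N*.nested (U⇒ (side-U τ f t)) (Q⇒ (side-Q τ f t)) a b) (λ eq → σ₁≢σ₂ (sym eq)))
    cases : seg σ₁ L.⊴ seg σ₂ ⊎ seg σ₂ L.⊴ seg σ₁ → seg σ₁ R.⊴ seg σ₂ ⊎ seg σ₂ R.⊴ seg σ₁ → τ ≡ τ′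
    cases (inj₁ a) (inj₁ b) = ⊥-elim (not-inside₁ a b)
    cases (inj₂ a) (inj₂ b) = ⊥-elim (not-inside₂ a b)
    cases (inj₂ a) (inj₁ b) = unique (spans f t) (spans f′ t′)
      where open A.Ordered (not-inside₂ a) (λ c → not-inside₁ c b)
    cases (inj₁ a) (inj₂ b) = unique (spans f t) (spans f′ t′)
      where open B.Ordered (λ c → not-inside₂ c b) (not-inside₁ a)

-- Enumerating strings and locating gaps

record Enumeration {A : Set} (P : A → Set) (size : A → ℕ) : Set where
  field
    N        : ℕ
    at       : Fin N → A
    valid    : ∀ i → P (at i)
    at-injective : ∀ {i j} → at i ≡ at j → i ≡ j
    indexOf  : ∀ {a} → P a → ∃[ i ] at i ≡ a
    at-mono  : ∀ {i j} → i Fin.≤ j → size (at i) ℕ.≤ size (at j)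

Unique⇒lookup-injective : ∀ {A : Set} {xs : List A} → Unique xs →
                          ∀ {i j} → lookup xs i ≡ lookup xs j → i ≡ j
Unique⇒lookup-injective (_ ∷ _) {zero} {zero} _ = refl
Unique⇒lookup-injective {xs = _ ∷ xs} (x≢ ∷ _) {zero} {suc j} eq = ⊥-elim (All.lookup x≢ (∈-lookup {xs = xs} j) eq)
Unique⇒lookup-injective {xs = _ ∷ xs} (x≢ ∷ _) {suc i} {zero} eq = ⊥-elim (All.lookup x≢ (∈-lookup {xs = xs} i) (sym eq))
Unique⇒lookup-injective (_ ∷ u) {suc i} {suc j} eq = cong suc (Unique⇒lookup-injective u eq)

abstract
  -- Sorting by size gives shorter strings smaller indices, as `shorter` demands; the order within
  -- one length is left to the sort.
  enumerate : ∀ {A : Set} {P : A → Set} (size : A → ℕ) → DecidableEquality A → (∀ a → Dec (P a)) →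
              (xs : List A) → (∀ {a} → P a → a ∈ xs) → Enumeration P size
  enumerate {A} {P} size _≟_ P? xs complete = record
    { N = length sorted ; at = lookup sorted
    ; valid = λ i → proj₂ (∈-filter⁻ P? {xs = xs} (∈-deduplicate⁻ _≟_ (filter P? xs) (∈-resp-↭ (sort-↭ _) (∈-lookup {xs = sorted} i))))
    ; at-injective = Unique⇒lookup-injective
        (↭ₛ.Unique-resp-↭ (setoid A) (↭⇒↭ₛ (↭-sym (sort-↭ _))) (deduplicate-! _≟_ (filter P? xs)))
    ; indexOf = λ p → let m = ∈-resp-↭ (↭-sym (sort-↭ _)) (∈-deduplicate⁺ _≟_ (∈-filter⁺ P? (complete p) p))
                      in index m , sym (lookup-index m)
    ; at-mono = lookup-mono-≤ (DecTotalOrder.totalOrder bySize) (sort-↗ _) }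
    where
    bySize : DecTotalOrder 0ℓ 0ℓ 0ℓ
    bySize = On.decTotalOrder ℕₚ.≤-decTotalOrder size
    open Sort bySize
    sorted : List A
    sorted = sort (deduplicate _≟_ (filter P? xs))

listsUpTo : ∀ {A : Set} → List A → ℕ → List (List A)
listsUpTo xs zero = [] ∷ []
listsUpTo xs (suc k) = [] ∷ cartesianProductWith _∷_ xs (listsUpTo xs k)

∈-listsUpTo : ∀ {A : Set} {xs : List A} → (∀ a → a ∈ xs) → ∀ k as → length as ℕ.≤ k → as ∈ listsUpTo xs k
∈-listsUpTo all zero [] _ = here refl
∈-listsUpTo all (suc k) [] _ = here refl
∈-listsUpTo all (suc k) (a ∷ as) (s≤s le) = there (∈-cartesianProductWith⁺ _∷_ (all a) (∈-listsUpTo all k as le))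

-- The edges on one side of a vertex: an edge of rank r sits at position 2r + 1, and the gap
-- just below it, if it is not the lowest one, at position 2r.

edgePos gapPos : ℕ → ℕ
edgePos r = suc (2 ℕ.* r)
gapPos r = 2 ℕ.* r

gap≤edge : ∀ {r s} → r ℕ.≤ s → gapPos r ℕ.≤ edgePos s
gap≤edge r≤s = ℕₚ.m≤n⇒m≤1+n (ℕₚ.*-monoʳ-≤ 2 r≤s)

gap≤edge⁻¹ : ∀ {r s} → gapPos r ℕ.≤ edgePos s → r ℕ.≤ s
gap≤edge⁻¹ {r} {s} le with ℕₚ.<-cmp r s
... | tri< lt _ _ = ℕₚ.<⇒≤ lt
... | tri≈ _ eq _ = ℕₚ.≤-reflexive eq
... | tri> _ _ gt = ⊥-elim (ℕₚ.<-irrefl refl (ℕₚ.≤-trans (s≤s le)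
      (ℕₚ.≤-trans (ℕₚ.≤-reflexive (sym (ℕₚ.*-suc 2 s))) (ℕₚ.*-monoʳ-≤ 2 gt))))

edge≤gap : ∀ {r s} → r ℕ.< s → edgePos r ℕ.≤ gapPos s
edge≤gap {r} {s} lt = ℕₚ.≤-trans (ℕₚ.n≤1+n _)
  (ℕₚ.≤-trans (ℕₚ.≤-reflexive (sym (ℕₚ.*-suc 2 r))) (ℕₚ.*-monoʳ-≤ 2 lt))

edge≤gap⁻¹ : ∀ {r s} → edgePos r ℕ.≤ gapPos s → r ℕ.< s
edge≤gap⁻¹ {r} {s} lt = ℕₚ.*-cancelˡ-< 2 r s lt

gap≢edge : ∀ {r s} → gapPos r ≢ edgePos s
gap≢edge {r} {s} eq = ℕₚ.<-irrefl refl (ℕₚ.<-≤-trans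
  (edge≤gap⁻¹ {s} {r} (ℕₚ.≤-reflexive (sym eq))) (gap≤edge⁻¹ {r} {s} (ℕₚ.≤-reflexive eq)))

module Fan {n m : ℕ} (end : Fin m → Fin n) (rank : Fin m → ℕ) where

  NonMin : Fin m → Set
  NonMin f = ∃[ g ] (end g ≡ end f × rank g ℕ.< rank f)

  NonMin? : ∀ f → Dec (NonMin f)
  NonMin? f = Finₚ.any? λ g → (end g Finₚ.≟ end f) ×-dec (rank g ℕₚ.<? rank f)

  atVertex? : ∀ v f → Dec (end f ≡ v × NonMin f)
  atVertex? v f = (end f Finₚ.≟ v) ×-dec NonMin? f

  gapsAt : Fin n → List ℕ
  gapsAt v = map (gapPos ∘ rank) (filter (atVertex? v) (allFin m))

  ∈-gapsAt⁺ : ∀ {f} → NonMin f → gapPos (rank f) ∈ gapsAt (end f)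
  ∈-gapsAt⁺ {f} nm = ∈-map⁺ _ (∈-filter⁺ (atVertex? (end f)) (∈-allFin f) (refl , nm))

  ∈-gapsAt⁻ : ∀ {v c} → c ∈ gapsAt v → ∃[ f ] (end f ≡ v × NonMin f × c ≡ gapPos (rank f))
  ∈-gapsAt⁻ {v} c∈ with ∈-map⁻ (gapPos ∘ rank) c∈
  ... | f , f∈ , eq = let (_ , e , nm) = ∈-filter⁻ (atVertex? v) {xs = allFin m} f∈ in f , e , nm , eq

  edge∉gapsAt : ∀ {v r} → ¬ (edgePos r ∈ gapsAt v)
  edge∉gapsAt {v} {r} c∈ with ∈-gapsAt⁻ c∈
  ... | f , _ , _ , eq = gap≢edge {rank f} {r} (sym eq)

  predecessor : ∀ {f} → NonMin f →
                ∃[ g ] (end g ≡ end f × rank g ℕ.< rank f × (∀ h → end h ≡ end f → rank h ℕ.< rank f → rank h ℕ.≤ rank g))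
  predecessor {f} (g , e , lt) = go g e lt (ℕᵢ.<-wellFounded (rank f ℕ.∸ rank g))
    where
    go : ∀ g → end g ≡ end f → rank g ℕ.< rank f → Acc ℕ._<_ (rank f ℕ.∸ rank g) → _
    go g e lt (acc rec) with Finₚ.any? (λ h → (end h Finₚ.≟ end f) ×-dec ((rank h ℕₚ.<? rank f) ×-dec (rank g ℕₚ.<? rank h)))
    ... | yes (h , e′ , lt′ , up) = go h e′ lt′ (rec (ℕₚ.∸-monoʳ-< up (ℕₚ.<⇒≤ lt′)))
    ... | no none = g , e , lt , λ h e′ lt′ → ℕₚ.≮⇒≥ (λ up → none (h , e′ , lt′ , up))

  edgeBelow : ∀ {v c} → c ∈ gapsAt v →
              ∃[ f ] (end f ≡ v × edgePos (rank f) ℕ.≤ c ×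
                      (∀ {g} → g ∈ gapsAt v → edgePos (rank f) ℕ.≤ g → c ℕ.≤ g))
  edgeBelow c∈ with ∈-gapsAt⁻ c∈
  ... | φ , refl , nm , refl with predecessor nm
  ...   | f , e , lt , max = f , e , edge≤gap lt , between
    where
    between : ∀ {g} → g ∈ gapsAt (end φ) → edgePos (rank f) ℕ.≤ g → gapPos (rank φ) ℕ.≤ g
    between g∈ le with ∈-gapsAt⁻ g∈
    ... | χ , e′ , _ , refl = ℕₚ.*-monoʳ-≤ 2 (ℕₚ.≮⇒≥ λ χ<φ →
            ℕₚ.<-irrefl refl (ℕₚ.<-≤-trans (edge≤gap⁻¹ {rank f} {rank χ} le) (max χ e′ χ<φ)))

  edgeAbove : ∀ {v c} → c ∈ gapsAt v →
              ∃[ f ] (end f ≡ v × c ℕ.≤ edgePos (rank f) ×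
                      (∀ {g} → g ∈ gapsAt v → g ℕ.≤ edgePos (rank f) → g ℕ.≤ c))
  edgeAbove c∈ with ∈-gapsAt⁻ c∈
  ... | φ , refl , nm , refl = φ , refl , gap≤edge {rank φ} ℕₚ.≤-refl , between
    where
    between : ∀ {g} → g ∈ gapsAt (end φ) → g ℕ.≤ edgePos (rank φ) → g ℕ.≤ gapPos (rank φ)
    between g∈ le with ∈-gapsAt⁻ g∈
    ... | χ , _ , _ , refl = ℕₚ.*-monoʳ-≤ 2 (gap≤edge⁻¹ {rank χ} {rank φ} le)

≤-letters : LetterOrder
≤-letters = record { _≼_ = ℕ._≤_ ; ≼-refl = ℕₚ.≤-refl ; ≼-trans = ℕₚ.≤-trans
                   ; ≼-antisym = ℕₚ.≤-antisym ; ≼-total = ℕₚ.≤-total ; ≼? = ℕₚ._≤?_ }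

-- Walks and segments of the framed graph

module Walks (G : FlowGraph) (Fr : Framing G) where
  open FlowGraph G
  open Framing Fr
  open Framed G Fr using (Walk)

  inPos outPos : Edge → ℕ
  inPos e = edgePos (inRank e)
  outPos e = edgePos (outRank e)

  module In = Fan tgt inRank
  module Out = Fan src outRank

  walk-irrelevant : ∀ {u} es {w} (a b : Walk u es w) → a ≡ b
  walk-irrelevant [] refl refl = refl
  walk-irrelevant (e ∷ es) (refl , a) (refl , b) = cong (refl ,_) (walk-irrelevant es a b)

  walk-end : ∀ {u} es {v w} → Walk u es v → Walk u es w → v ≡ w
  walk-end [] refl refl = refl
  walk-end (e ∷ es) (_ , a) (_ , b) = walk-end es a b

  walk-++ : ∀ {u} xs {ys v w} → Walk u xs v → Walk v ys w → Walk u (xs ++ ys) w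
  walk-++ [] refl b = b
  walk-++ (x ∷ xs) (eq , a) b = eq , walk-++ xs a b

  walk-split : ∀ {u} xs {ys w} → Walk u (xs ++ ys) w → ∃[ v ] (Walk u xs v × Walk v ys w)
  walk-split [] a = _ , refl , a
  walk-split (x ∷ xs) (eq , a) with walk-split xs a
  ... | v , b , c = v , (eq , b) , c

  walk-≤ : ∀ {u} es {w} → Walk u es w → u Fin.≤ w
  walk-< : ∀ {u} e es {w} → Walk u (e ∷ es) w → u Fin.< w
  walk-≤ [] refl = ℕₚ.≤-refl
  walk-≤ (e ∷ es) a = ℕₚ.<⇒≤ (walk-< e es a)
  walk-< e es (refl , a) = ℕₚ.<-≤-trans (forward e) (walk-≤ es a)

  walk-length : ∀ {u} es {w} → Walk u es w → length es ℕ.+ toℕ u ℕ.≤ toℕ w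
  walk-length [] refl = ℕₚ.≤-refl
  walk-length (e ∷ es) {w} (refl , a) = ℕₚ.≤-trans
    (ℕₚ.≤-trans (ℕₚ.≤-reflexive (sym (ℕₚ.+-suc (length es) _))) (ℕₚ.+-monoʳ-≤ (length es) (forward e)))
    (walk-length es a)

  walk-length≤n : ∀ {u} es {w} → Walk u es w → length es ℕ.≤ n
  walk-length≤n es {w} a = ℕₚ.≤-trans (ℕₚ.m≤m+n _ _) (ℕₚ.≤-trans (walk-length es a) (ℕₚ.<⇒≤ (Finₚ.toℕ<n w)))

  Walk? : ∀ u es w → Dec (Walk u es w)
  Walk? u [] w = u Finₚ.≟ w
  Walk? u (e ∷ es) w = (src e Finₚ.≟ u) ×-dec Walk? (tgt e) es w

  -- Vertices increase along a walk, so of two prefixes of one edge list the one ending at the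
  -- smaller vertex comes first. This also makes occurrences of a segment unique.
  prefix-extend : ∀ {u v w} xs ys {as bs} → xs ++ as ≡ ys ++ bs → Walk u xs v → Walk u ys w → v Fin.≤ w →
                  ∃[ d ] (ys ≡ xs ++ d × as ≡ d ++ bs × Walk v d w)
  prefix-extend [] ys eq refl b _ = ys , refl , eq , b
  prefix-extend (x ∷ xs) [] eq a refl v≤w = ⊥-elim (ℕₚ.<-irrefl refl (ℕₚ.<-≤-trans (walk-< x xs a) v≤w))
  prefix-extend (x ∷ xs) (y ∷ ys) eq (_ , a) (_ , b) v≤w with ∷-injective eq
  ... | refl , eq′ with prefix-extend xs ys eq′ a b v≤w
  ...   | d , e₁ , e₂ , c = d , cong (x ∷_) e₁ , e₂ , c

  prefix-unique : ∀ {u v} xs ys {as bs} → xs ++ as ≡ ys ++ bs → Walk u xs v → Walk u ys v → xs ≡ ys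
  prefix-unique xs ys eq a b with prefix-extend xs ys eq a b ℕₚ.≤-refl
  ... | [] , e , _ , _ = sym (trans e (++-identityʳ xs))
  ... | z ∷ zs , _ , _ , c = ⊥-elim (ℕₚ.<-irrefl refl (walk-< z zs c))

  lastIn headOut : List Edge → Maybe ℕ
  lastIn [] = nothing
  lastIn (e ∷ es) = lastIn es <∣> just (inPos e)
  headOut [] = nothing
  headOut (e ∷ _) = just (outPos e)

  <∣>-assoc : ∀ (l m k : Maybe ℕ) → (l <∣> m) <∣> k ≡ l <∣> (m <∣> k)
  <∣>-assoc (just _) m k = refl
  <∣>-assoc nothing  m k = refl

  lastIn-++ : ∀ xs ys → lastIn (xs ++ ys) ≡ lastIn ys <∣> lastIn xs
  lastIn-++ [] ys with lastIn ys
  ... | just _ = refl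
  ... | nothing = refl
  lastIn-++ (x ∷ xs) ys = trans (cong (_<∣> just (inPos x)) (lastIn-++ xs ys)) (<∣>-assoc (lastIn ys) _ _)

  headOut-++ : ∀ xs ys → headOut (xs ++ ys) ≡ headOut xs <∣> headOut ys
  headOut-++ [] ys = refl
  headOut-++ (x ∷ xs) ys = refl

  lastIn-∷≢ : ∀ e es → lastIn (e ∷ es) ≢ nothing
  lastIn-∷≢ e es eq with lastIn es
  lastIn-∷≢ e es () | just _
  lastIn-∷≢ e es () | nothing

  record Seg : Set where
    constructor segment
    field
      start end : Vertex
      edges     : List Edge
      walk      : Walk start edges end
  open Seg public

  seg-≡ : ∀ {p q} → start p ≡ start q → edges p ≡ edges q → p ≡ q
  seg-≡ {segment s t es a} {segment _ t′ _ b} refl refl with walk-end es a b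
  ... | refl = cong (segment s t es) (walk-irrelevant es a b)

  record Occ (p q : Seg) (l r : Maybe ℕ) : Set where
    constructor occ
    field
      pre post : List Edge
      walk-pre  : Walk (start q) pre (start p)
      walk-post : Walk (end p) post (end q)
      edges≡    : edges q ≡ pre ++ (edges p ++ post)
      l≡        : l ≡ lastIn pre
      r≡        : r ≡ headOut post

  occ-refl : ∀ p → Occ p p nothing nothing
  occ-refl p = occ [] [] refl refl (sym (++-identityʳ (edges p))) refl refl

  occ-trans : ∀ {p q s l r l′ r′} → Occ p q l r → Occ q s l′ r′ → Occ p s (l <∣> l′) (r <∣> r′)
  occ-trans {p} {q} {s} (occ pre post a b e refl refl) (occ pre′ post′ a′ b′ e′ refl refl) =
    occ (pre′ ++ pre) (post ++ post′) (walk-++ pre′ a′ a) (walk-++ post b b′) eq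
        (sym (lastIn-++ pre′ pre)) (sym (headOut-++ post post′))
    where
    open ≡-Reasoning
    eq : edges s ≡ (pre′ ++ pre) ++ (edges p ++ (post ++ post′))
    eq = begin
      edges s                                       ≡⟨ e′ ⟩
      pre′ ++ (edges q ++ post′)                    ≡⟨ cong (λ z → pre′ ++ (z ++ post′)) e ⟩
      pre′ ++ ((pre ++ (edges p ++ post)) ++ post′) ≡⟨ cong (pre′ ++_) (++-assoc pre _ post′) ⟩
      pre′ ++ (pre ++ ((edges p ++ post) ++ post′)) ≡⟨ ++-assoc pre′ pre _ ⟨
      (pre′ ++ pre) ++ ((edges p ++ post) ++ post′) ≡⟨ cong ((pre′ ++ pre) ++_) (++-assoc (edges p) post post′) ⟩
      (pre′ ++ pre) ++ (edges p ++ (post ++ post′)) ∎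

  occ-unique : ∀ {p q l r l′ r′} → Occ p q l r → Occ p q l′ r′ → l ≡ l′ × r ≡ r′
  occ-unique {p} {q} (occ pre post a b e refl refl) (occ pre′ post′ a′ b′ e′ refl refl)
    with prefix-unique pre pre′ (trans (sym e) e′) a a′
  ... | refl with ++-cancelˡ (edges p) post post′ (++-cancelˡ pre _ _ (trans (sym e) e′))
  ...   | refl = refl , refl

  occ-antisym : ∀ {p q} → Occ p q nothing nothing → p ≡ q
  occ-antisym {p} {q} (occ [] [] a b e l r) = seg-≡ (sym a) (sym (trans e (++-identityʳ (edges p))))
  occ-antisym (occ [] (_ ∷ _) a b e l ())
  occ-antisym (occ (x ∷ xs) _ a b e l r) = ⊥-elim (lastIn-∷≢ x xs (sym l))

  prefix? : ∀ (xs ys : List Edge) → Dec (∃[ zs ] ys ≡ xs ++ zs)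
  prefix? [] ys = yes (ys , refl)
  prefix? (x ∷ xs) [] = no λ ()
  prefix? (x ∷ xs) (y ∷ ys) with x Finₚ.≟ y | prefix? xs ys
  ... | yes refl | yes (zs , eq) = yes (zs , cong (x ∷_) eq)
  ... | yes refl | no none = no λ (zs , eq) → none (zs , proj₂ (∷-injective eq))
  ... | no x≢y | _ = no λ (zs , eq) → x≢y (sym (proj₁ (∷-injective eq)))

  findInner : ∀ (p : Seg) u es {w} → Walk u es w →
              Dec (∃[ pre ] ∃[ post ] (es ≡ pre ++ (edges p ++ post) × Walk u pre (start p)))
  findInner p u es a with u Finₚ.≟ start p
  findInner p u es a | yes refl with prefix? (edges p) es
  ... | yes (post , eq) = yes ([] , post , eq , refl)
  ... | no none = no λ { ([] , post , eq , _) → none (post , eq)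
                       ; (x ∷ pre , post , _ , b) → ℕₚ.<-irrefl refl (walk-< x pre b) }
  findInner p u [] a | no u≢ = no λ { ([] , _ , _ , b) → u≢ b }
  findInner p u (e ∷ es) (_ , a) | no u≢ with findInner p (tgt e) es a
  findInner p u (e ∷ es) (eu , a) | no u≢ | yes (pre , post , eq , b) =
    yes (e ∷ pre , post , cong (e ∷_) eq , eu , b)
  ... | no none = no λ { ([] , _ , _ , b) → u≢ b
                       ; (x ∷ pre , post , eq , _ , b) → none (pre , post , proj₂ (∷-injective eq) ,
                           subst (λ z → Walk (tgt z) pre (start p)) (sym (proj₁ (∷-injective eq))) b) }

  occ? : ∀ p q → Dec (∃[ l ] ∃[ r ] Occ p q l r)
  occ? p q = map′ to from (findInner p (start q) (edges q) (walk q))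
    where
    to : ∃[ pre ] ∃[ post ] (edges q ≡ pre ++ (edges p ++ post) × Walk (start q) pre (start p)) →
         ∃[ l ] ∃[ r ] Occ p q l r
    to (pre , post , eq , a) with walk-split pre (subst (λ es → Walk (start q) es (end q)) eq (walk q))
    ... | v , a′ , b with walk-end pre a a′
    ...   | refl with walk-split (edges p) b
    ...     | w , c , d with walk-end (edges p) (walk p) c
    ...       | refl = _ , _ , occ pre post a d eq refl refl
    from : ∃[ l ] ∃[ r ] Occ p q l r → _
    from (_ , _ , occ pre post a _ eq _ _) = pre , post , eq , a

  nest : ∀ {p p′ q l r l′ r′} → Occ p q l r → Occ p′ q l′ r′ →
         start p′ Fin.≤ start p → end p Fin.≤ end p′ → ∃[ k ] ∃[ s ] Occ p p′ k s
  nest {p} {p′} {q} (occ pre post a b e _ _) (occ pre′ post′ a′ b′ e′ _ _) s≤ e≤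
    with prefix-extend pre′ pre (trans (sym e′) e) a′ a s≤
  ... | d , refl , eq , c
    with prefix-extend (d ++ edges p) (edges p′) (trans (++-assoc d (edges p) post) (sym eq))
           (walk-++ d c (walk p)) (walk p′) e≤
  ...   | d′ , eq′ , _ , c′ = _ , _ , occ d d′ c c′ (trans eq′ (++-assoc d (edges p) d′)) refl refl

  common-prefix : ∀ {v} xs ys {a b} → Walk v xs a → Walk v ys b →
    ∃[ c ] ∃[ xs′ ] ∃[ ys′ ] ∃[ w ] (xs ≡ c ++ xs′ × ys ≡ c ++ ys′ × Walk v c w × Walk w xs′ a × Walk w ys′ b ×
      Diverge ℕ._≤_ (Out.gapsAt w) (headOut xs′) (headOut ys′))
  common-prefix [] ys refl b = [] , [] , ys , _ , refl , refl , refl , refl , b , end₁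
  common-prefix (x ∷ xs) [] a refl = [] , x ∷ xs , [] , _ , refl , refl , refl , a , refl , end₂
  common-prefix (x ∷ xs) (y ∷ ys) (refl , a) (ey , b) with x Finₚ.≟ y
  ... | yes refl with common-prefix xs ys a b
  ...   | c , xs′ , ys′ , w , e₁ , e₂ , wc , wa , wb , div =
          x ∷ c , xs′ , ys′ , w , cong (x ∷_) e₁ , cong (x ∷_) e₂ , (refl , wc) , wa , wb , div
  common-prefix (x ∷ xs) (y ∷ ys) (refl , a) (ey , b) | no x≢y =
    [] , x ∷ xs , y ∷ ys , src x , refl , refl , refl , (refl , a) , (ey , b) , fork
    where
    fork : Diverge ℕ._≤_ (Out.gapsAt (src x)) (just (outPos x)) (just (outPos y))
    fork with ℕₚ.<-cmp (outRank x) (outRank y)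
    ... | tri< lt _ _ = fork₁ (subst (λ v → _ ∈ Out.gapsAt v) ey (Out.∈-gapsAt⁺ (x , sym ey , lt)))
                              (edge≤gap lt) (gap≤edge {outRank y} ℕₚ.≤-refl)
    ... | tri≈ _ eq _ = ⊥-elim (x≢y (outRank-inj x y (sym ey) eq))
    ... | tri> _ _ gt = fork₂ (Out.∈-gapsAt⁺ (y , ey , gt)) (edge≤gap gt) (gap≤edge {outRank x} ℕₚ.≤-refl)

  walk-∷ʳ : ∀ {u} xs {x w} → Walk u (xs ∷ʳ x) w → Walk u xs (src x) × tgt x ≡ w
  walk-∷ʳ xs a with walk-split xs a
  ... | v , b , (refl , c) = b , c

  lastIn-∷ʳ : ∀ xs x → lastIn (xs ∷ʳ x) ≡ just (inPos x)
  lastIn-∷ʳ xs x = lastIn-++ xs (x ∷ [])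

  common-suffix : ∀ {v a b} xs ys → Reverse xs → Reverse ys → Walk a xs v → Walk b ys v →
    ∃[ c ] ∃[ xs′ ] ∃[ ys′ ] ∃[ w ] (xs ≡ xs′ ++ c × ys ≡ ys′ ++ c × Walk w c v × Walk a xs′ w × Walk b ys′ w ×
      Diverge (λ x y → y ℕ.≤ x) (In.gapsAt w) (lastIn xs′) (lastIn ys′))
  common-suffix _ ys [] _ refl b = [] , [] , ys , _ , refl , sym (++-identityʳ ys) , refl , refl , b , end₁
  common-suffix xs _ (_ ∶ _ ∶ʳ _) [] a refl = [] , xs , [] , _ , sym (++-identityʳ xs) , refl , refl , a , refl , end₂
  common-suffix _ _ (xs ∶ rx ∶ʳ x) (ys ∶ ry ∶ʳ y) a b with walk-∷ʳ xs a | walk-∷ʳ ys b | x Finₚ.≟ y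
  ... | a′ , refl | b′ , _ | yes refl with common-suffix xs ys rx ry a′ b′
  ...   | c , xs′ , ys′ , w , e₁ , e₂ , wc , wa , wb , div =
    c ∷ʳ x , xs′ , ys′ , w ,
    trans (cong (_∷ʳ x) e₁) (++-assoc xs′ c _) , trans (cong (_∷ʳ x) e₂) (++-assoc ys′ c _) ,
    walk-++ c wc (refl , refl) , wa , wb , div
  common-suffix {v} _ _ (xs ∶ rx ∶ʳ x) (ys ∶ ry ∶ʳ y) a b | a′ , ex | b′ , ey | no x≢y =
    [] , xs ∷ʳ x , ys ∷ʳ y , v , sym (++-identityʳ _) , sym (++-identityʳ _) , refl , a , b ,
    subst (λ l → Diverge _ (In.gapsAt v) l (lastIn (ys ∷ʳ y))) (sym (lastIn-∷ʳ xs x))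
      (subst (λ l → Diverge _ (In.gapsAt v) (just (inPos x)) l) (sym (lastIn-∷ʳ ys y)) fork)
    where
    fork : Diverge (λ x y → y ℕ.≤ x) (In.gapsAt v) (just (inPos x)) (just (inPos y))
    fork with ℕₚ.<-cmp (inRank x) (inRank y)
    ... | tri< lt _ _ = fork₂ (subst (λ v → _ ∈ In.gapsAt v) ey (In.∈-gapsAt⁺ (x , trans ex (sym ey) , lt)))
                              (gap≤edge {inRank y} ℕₚ.≤-refl) (edge≤gap lt)
    ... | tri≈ _ eq _ = ⊥-elim (x≢y (inRank-inj x y (trans ex (sym ey)) eq))
    ... | tri> _ _ gt = fork₁ (subst (λ v → _ ∈ In.gapsAt v) ex (In.∈-gapsAt⁺ (y , trans ey (sym ex) , gt)))
                              (gap≤edge {inRank x} ℕₚ.≤-refl) (edge≤gap gt)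

module Concrete (G : FlowGraph) (Fr : Framing G) where
  open FlowGraph G
  open Framing Fr
  open Framed G Fr using (Walk)
  open Walks G Fr

  end-nothing : ∀ {p q l} → Occ p q l nothing → end p ≡ end q
  end-nothing (occ _ [] _ b _ _ _) = b
  end-nothing (occ _ (_ ∷ _) _ _ _ _ ())

  start-nothing : ∀ {p q r} → Occ p q nothing r → start q ≡ start p
  start-nothing (occ [] _ a _ _ _ _) = a
  start-nothing (occ (x ∷ xs) _ _ _ _ eq _) = ⊥-elim (lastIn-∷≢ x xs (sym eq))

  next-edge : ∀ {p q l h} → Occ p q l (just h) → ∃[ e ] (src e ≡ end p × h ≡ outPos e × end p Fin.< end q)
  next-edge (occ _ (e ∷ es) _ b@(eq , _) _ _ refl) = e , eq , refl , walk-< e es b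

  last-edge : ∀ {u} es {v h} → Walk u es v → just h ≡ lastIn es → ∃[ e ] (tgt e ≡ v × h ≡ inPos e × u Fin.< v)
  last-edge (e ∷ []) a@(_ , eq) refl = e , eq , refl , walk-< e [] a
  last-edge (e ∷ es@(e′ ∷ es′)) a@(refl , b) eq with last-edge es b (trans eq (drop (lastIn es) (lastIn-∷≢ e′ es′)))
    where
    drop : ∀ (m : Maybe ℕ) {k} → m ≢ nothing → m <∣> k ≡ m
    drop (just _) _ = refl
    drop nothing  n = ⊥-elim (n refl)
  ... | e″ , t , h , _ = e″ , t , h , walk-< e es a

  prev-edge : ∀ {p q h r} → Occ p q (just h) r → ∃[ e ] (tgt e ≡ start p × h ≡ inPos e × start q Fin.< start p)
  prev-edge (occ pre _ a _ _ eq _) = last-edge pre a eq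

  snoc : ∀ q e → src e ≡ end q → Snoc Occ (λ q → n ℕ.∸ toℕ (end q)) q (outPos e)
  snoc q e refl = record
    { ext = segment (start q) (tgt e) (edges q ∷ʳ e) (walk-++ (edges q) (walk q) (refl , refl))
    ; occ = occ [] (e ∷ []) refl (refl , refl) refl refl refl
    ; room< = ℕₚ.∸-monoʳ-< (forward e) (ℕₚ.<⇒≤ (Finₚ.toℕ<n (tgt e)))
    ; split = split }
    where
    split : ∀ {p l k} → Occ p (segment (start q) (tgt e) (edges q ∷ʳ e) _) l (just k) →
            Occ p q l (just k) ⊎ (Occ p q l nothing × k ≡ outPos e)
    split {p} (occ pre post a b eq l≡ r≡) with initLast post
    split (occ pre .[] a b eq l≡ ()) | List.[]
    split {p} (occ pre .(xs ∷ʳ x) a b eq l≡ r≡) | xs ∷ʳ′ x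
      with ∷ʳ-injective (edges q) (pre ++ (edges p ++ xs)) (trans eq
             (trans (cong (pre ++_) (sym (++-assoc (edges p) xs (x ∷ [])))) (sym (++-assoc pre (edges p ++ xs) (x ∷ [])))))
    ... | eq′ , refl = go xs (proj₁ (walk-∷ʳ xs b)) eq′ r≡
      where
      go : ∀ xs → Walk (end p) xs (src e) → edges q ≡ pre ++ (edges p ++ xs) → _ ≡ headOut (xs ∷ʳ e) → _
      go [] b′ eq′ refl = inj₂ (occ pre [] a b′ eq′ l≡ refl , refl)
      go (y ∷ ys) b′ eq′ refl = inj₁ (occ pre (y ∷ ys) a b′ eq′ l≡ refl)

  right : Half Seg Occ
  right = record
    { order = ≤-letters
    ; _⊴_ = λ p q → end p Fin.≤ end q
    ; ⊴-trans = ℕₚ.≤-trans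
    ; ⊴-total = λ p q → ℕₚ.≤-total (toℕ (end p)) (toℕ (end q))
    ; occ-⊴ = λ (occ _ post _ b _ _ _) → walk-≤ post b
    ; occ-end = λ o → ℕₚ.≤-reflexive (cong toℕ (sym (end-nothing o)))
    ; occ-inner = λ o le → let (_ , _ , _ , lt) = next-edge o in ℕₚ.<-irrefl refl (ℕₚ.<-≤-trans lt le)
    ; gaps = λ p → Out.gapsAt (end p)
    ; gaps-up = λ o → subst (λ v → _ ∈ Out.gapsAt v) (end-nothing o)
    ; gaps-down = λ o → subst (λ v → _ ∈ Out.gapsAt v) (sym (end-nothing o))
    ; gap-edge = λ {p} o h∈ → let (e , _ , eq , _) = next-edge o
                              in Out.edge∉gapsAt {end p} {outRank e} (subst (_∈ _) eq h∈)
    ; truncate = truncate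
    ; common = common
    ; Terminal = λ q → end q ≡ t
    ; terminal-up = λ o eq → trans (sym (end-nothing o)) eq
    ; terminal-down = λ o eq → trans (end-nothing o) eq
    ; terminal-max = λ eq o → let (e , s≡ , _) = next-edge o in t-sink e (trans s≡ eq)
    ; room = λ q → n ℕ.∸ toℕ (end q)
    ; extend = extend
    ; extend-≼ = λ {q} f∈ → let (e , s≡ , le , btw) = Out.edgeBelow f∈ in outPos e , snoc q e s≡ , le , btw
    ; extend-≽ = λ {q} f∈ → let (e , s≡ , le , btw) = Out.edgeAbove f∈ in outPos e , snoc q e s≡ , le , btw }
    where
    truncate : ∀ {p q l r} → Occ p q l r → ∃[ p′ ] (Occ p′ q nothing r × Occ p p′ l nothing)
    truncate {p} {q} (occ pre post a b eq l≡ r≡) =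
      segment (start q) (end p) (pre ++ edges p) (walk-++ pre a (walk p)) ,
      occ [] post refl b (trans eq (sym (++-assoc pre (edges p) post))) refl r≡ ,
      occ pre [] a refl (cong (pre ++_) (sym (++-identityʳ (edges p)))) l≡ refl
    common : ∀ {p q₁ q₂ l₁ r₁ l₂ r₂} → Occ p q₁ l₁ r₁ → Occ p q₂ l₂ r₂ →
             ∃[ p′ ] ∃[ r ] ∃[ s₁ ] ∃[ s₂ ] (Occ p p′ nothing r × Occ p′ q₁ l₁ s₁ × Occ p′ q₂ l₂ s₂ ×
               Diverge ℕ._≤_ (Out.gapsAt (end p′)) s₁ s₂)
    common {p} (occ pre₁ post₁ a₁ b₁ e₁ l₁ r₁) (occ pre₂ post₂ a₂ b₂ e₂ l₂ r₂) with common-prefix post₁ post₂ b₁ b₂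
    ... | c , xs , ys , w , refl , refl , wc , wx , wy , div =
      segment (start p) w (edges p ++ c) (walk-++ (edges p) (walk p) wc) , _ , _ , _ ,
      occ [] c refl wc refl refl refl ,
      occ pre₁ xs a₁ wx (trans e₁ (cong (pre₁ ++_) (sym (++-assoc (edges p) c xs)))) l₁ refl ,
      occ pre₂ ys a₂ wy (trans e₂ (cong (pre₂ ++_) (sym (++-assoc (edges p) c ys)))) l₂ refl , div
    extend : ∀ q → (end q ≡ t) ⊎ ∃[ h ] Snoc Occ (λ q → n ℕ.∸ toℕ (end q)) q h
    extend q with Finₚ.any? (λ e → src e Finₚ.≟ end q)
    ... | yes (e , eq) = inj₂ (_ , snoc q e eq)
    ... | no none = inj₁ (t-unique (end q) λ e eq → none (e , eq))

  Occᵒ : Occurrence Seg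
  Occᵒ p q l r = Occ p q r l

  cons : ∀ q e → tgt e ≡ start q → Snoc Occᵒ (λ q → toℕ (start q)) q (inPos e)
  cons q e refl = record
    { ext = segment (src e) (end q) (e ∷ edges q) (refl , walk q)
    ; occ = occ (e ∷ []) [] (refl , refl) refl (cong (e ∷_) (sym (++-identityʳ (edges q)))) refl refl
    ; room< = forward e
    ; split = split }
    where
    split : ∀ {p l k} → Occᵒ p (segment (src e) (end q) (e ∷ edges q) _) l (just k) →
            Occᵒ p q l (just k) ⊎ (Occᵒ p q l nothing × k ≡ inPos e)
    split {p} {l} (occ (x ∷ pre) post (_ , a) b eq l≡ r≡) with ∷-injective eq
    ... | refl , eq′ = go (lastIn pre) refl l≡
      where
      go : ∀ m {k} → m ≡ lastIn pre → just k ≡ m <∣> just (inPos e) →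
           Occᵒ p q l (just k) ⊎ (Occᵒ p q l nothing × k ≡ inPos e)
      go (just j) m≡ refl = inj₁ (occ pre post a b eq′ m≡ r≡)
      go nothing  m≡ refl = inj₂ (occ pre post a b eq′ m≡ r≡ , refl)

  left : Half Seg Occᵒ
  left = record
    -- Reversing the order on the left puts both halves of a downward crossing, entering above a gap
    -- and leaving below one, on the small side.
    { order = flipOrder ≤-letters
    ; _⊴_ = λ p q → start q Fin.≤ start p
    ; ⊴-trans = λ a b → ℕₚ.≤-trans b a
    ; ⊴-total = λ p q → ℕₚ.≤-total (toℕ (start q)) (toℕ (start p))
    ; occ-⊴ = λ (occ pre _ a _ _ _ _) → walk-≤ pre a
    ; occ-end = λ o → ℕₚ.≤-reflexive (cong toℕ (sym (start-nothing o)))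
    ; occ-inner = λ o le → let (_ , _ , _ , lt) = prev-edge o in ℕₚ.<-irrefl refl (ℕₚ.<-≤-trans lt le)
    ; gaps = λ p → In.gapsAt (start p)
    ; gaps-up = λ o → subst (λ v → _ ∈ In.gapsAt v) (sym (start-nothing o))
    ; gaps-down = λ o → subst (λ v → _ ∈ In.gapsAt v) (start-nothing o)
    ; gap-edge = λ {p} o h∈ → let (e , _ , eq , _) = prev-edge o
                              in In.edge∉gapsAt {start p} {inRank e} (subst (_∈ _) eq h∈)
    ; truncate = truncate
    ; common = common
    ; Terminal = λ q → start q ≡ s
    ; terminal-up = λ o eq → trans (start-nothing o) eq
    ; terminal-down = λ o eq → trans (sym (start-nothing o)) eq
    ; terminal-max = λ eq o → let (e , t≡ , _) = prev-edge o in s-source e (trans t≡ eq)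
    ; room = λ q → toℕ (start q)
    ; extend = extend
    ; extend-≼ = λ {q} f∈ → let (e , t≡ , le , btw) = In.edgeAbove f∈ in inPos e , cons q e t≡ , le , btw
    ; extend-≽ = λ {q} f∈ → let (e , t≡ , le , btw) = In.edgeBelow f∈ in inPos e , cons q e t≡ , le , btw }
    where
    truncate : ∀ {p q l r} → Occᵒ p q l r → ∃[ p′ ] (Occᵒ p′ q nothing r × Occᵒ p p′ l nothing)
    truncate {p} {q} (occ pre post a b eq l≡ r≡) =
      segment (start p) (end q) (edges p ++ post) (walk-++ (edges p) (walk p) b) ,
      occ pre [] a refl (trans eq (cong (pre ++_) (sym (++-identityʳ _)))) l≡ refl ,
      occ [] post refl b refl refl r≡
    common : ∀ {p q₁ q₂ l₁ r₁ l₂ r₂} → Occᵒ p q₁ l₁ r₁ → Occᵒ p q₂ l₂ r₂ →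
             ∃[ p′ ] ∃[ r ] ∃[ s₁ ] ∃[ s₂ ] (Occᵒ p p′ nothing r × Occᵒ p′ q₁ l₁ s₁ × Occᵒ p′ q₂ l₂ s₂ ×
               Diverge (λ x y → y ℕ.≤ x) (In.gapsAt (start p′)) s₁ s₂)
    common {p} (occ pre₁ post₁ a₁ b₁ e₁ l₁ r₁) (occ pre₂ post₂ a₂ b₂ e₂ l₂ r₂)
      with common-suffix pre₁ pre₂ (reverseView pre₁) (reverseView pre₂) a₁ a₂
    ... | c , xs , ys , w , refl , refl , wc , wx , wy , div =
      segment w (end p) (c ++ edges p) (walk-++ c wc (walk p)) , _ , _ , _ ,
      occ c [] wc refl (cong (c ++_) (sym (++-identityʳ (edges p)))) refl refl ,
      occ xs post₁ wx b₁ (trans e₁ (reassoc xs c (edges p) post₁)) refl r₁ ,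
      occ ys post₂ wy b₂ (trans e₂ (reassoc ys c (edges p) post₂)) refl r₂ , div
      where
      reassoc : ∀ (a b c d : List Edge) → (a ++ b) ++ (c ++ d) ≡ a ++ ((b ++ c) ++ d)
      reassoc a b c d = trans (++-assoc a b (c ++ d)) (cong (a ++_) (sym (++-assoc b c d)))
    extend : ∀ q → (start q ≡ s) ⊎ ∃[ h ] Snoc Occᵒ (λ q → toℕ (start q)) q h
    extend q with Finₚ.any? (λ e → tgt e Finₚ.≟ start q)
    ... | yes (e , eq) = inj₂ (_ , cons q e eq)
    ... | no none = inj₁ (s-unique (start q) λ e eq → none (e , eq))

  Raw : Set
  Raw = Edge × List Edge × Edge

  -- A string (e, p, f) stands for the path p between the gap below e and the gap below f.
  IsString : Raw → Set
  IsString (e , p , f) = In.NonMin e × Out.NonMin f × Walk (tgt e) p (src f)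

  IsString? : ∀ r → Dec (IsString r)
  IsString? (e , p , f) = In.NonMin? e ×-dec (Out.NonMin? f ×-dec Walk? (tgt e) p (src f))

  strings : Enumeration IsString (λ (e , p , f) → length p)
  strings = enumerate _ (×-≡-dec Finₚ._≟_ (×-≡-dec (≡-dec Finₚ._≟_) Finₚ._≟_)) IsString?
    (cartesianProduct (allFin m) (cartesianProduct (listsUpTo (allFin m) n) (allFin m)))
    (λ {(e , p , f)} (_ , _ , w) → ∈-cartesianProduct⁺ (∈-allFin e) (∈-cartesianProduct⁺
      (∈-listsUpTo ∈-allFin n p (walk-length≤n p w)) (∈-allFin f)))

  open Enumeration strings using (N; at; valid; at-injective; indexOf; at-mono)

  segOf : ∀ r → IsString r → Seg
  segOf (e , p , f) (_ , _ , w) = segment (tgt e) (src f) p w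

  geo : Geo N
  geo = record
    { Seg = Seg ; Occ = Occ ; occ-refl = occ-refl ; occ-trans = occ-trans ; occ-unique = occ-unique
    ; occ-antisym = occ-antisym ; occ? = occ? ; right = right ; left = left ; nest = nest
    ; seg = λ σ → segOf (at σ) (valid σ)
    ; lft = λ σ → gapPos (inRank (proj₁ (at σ)))
    ; rgt = λ σ → gapPos (outRank (proj₂ (proj₂ (at σ))))
    ; lft-gap = λ σ → In.∈-gapsAt⁺ (proj₁ (valid σ))
    ; rgt-gap = λ σ → Out.∈-gapsAt⁺ (proj₁ (proj₂ (valid σ)))
    ; string = string
    ; string-injective = string-injective
    ; shorter = shorter }
    where
    string : ∀ {p c d} → c ∈ In.gapsAt (start p) → d ∈ Out.gapsAt (end p) →
             ∃[ σ ] (segOf (at σ) (valid σ) ≡ p × gapPos (inRank (proj₁ (at σ))) ≡ c ×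
                     gapPos (outRank (proj₂ (proj₂ (at σ)))) ≡ d)
    string {p} c∈ d∈ with In.∈-gapsAt⁻ c∈ | Out.∈-gapsAt⁻ d∈
    ... | e , refl , nme , refl | f , refl , nmf , refl with indexOf (nme , nmf , walk p)
    ...   | σ , eq = σ , seg-≡ (cong (λ r → tgt (proj₁ r)) eq) (cong (λ r → proj₁ (proj₂ r)) eq) ,
                     cong (λ r → gapPos (inRank (proj₁ r))) eq , cong (λ r → gapPos (outRank (proj₂ (proj₂ r)))) eq
    string-injective : ∀ {σ τ} → segOf (at σ) (valid σ) ≡ segOf (at τ) (valid τ) →
      gapPos (inRank (proj₁ (at σ))) ≡ gapPos (inRank (proj₁ (at τ))) →
      gapPos (outRank (proj₂ (proj₂ (at σ)))) ≡ gapPos (outRank (proj₂ (proj₂ (at τ)))) → σ ≡ τ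
    string-injective {σ} {τ} eq l r = at-injective (cong₂ _,_
      (inRank-inj _ _ (cong start eq) (ℕₚ.*-cancelˡ-≡ _ _ 2 l))
      (cong₂ _,_ (cong edges eq) (outRank-inj _ _ (cong end eq) (ℕₚ.*-cancelˡ-≡ _ _ 2 r))))
    size : Fin N → ℕ
    size σ = length (proj₁ (proj₂ (at σ)))
    index-< : ∀ {σ τ} → size τ ℕ.< size σ → τ Fin.< σ
    index-< {σ} {τ} lt = ℕₚ.≰⇒> λ σ≤τ → ℕₚ.<-irrefl refl (ℕₚ.<-≤-trans lt (at-mono {σ} {τ} σ≤τ))
    lengths : ∀ σ τ pre post → proj₁ (proj₂ (at σ)) ≡ pre ++ (proj₁ (proj₂ (at τ)) ++ post) →
              length pre ℕ.+ (size τ ℕ.+ length post) ℕ.≤ size σ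
    lengths σ τ pre post eq = ℕₚ.≤-reflexive (sym (trans (cong length eq)
      (trans (length-++ pre) (cong (length pre ℕ.+_) (length-++ (proj₁ (proj₂ (at τ))))))))
    shorter : ∀ {σ τ l r} → Occ (segOf (at τ) (valid τ)) (segOf (at σ) (valid σ)) l r →
              τ Fin.< σ ⊎ segOf (at τ) (valid τ) ≡ segOf (at σ) (valid σ)
    shorter {σ} {τ} (occ [] [] a b eq _ _) = inj₂ (seg-≡ (sym a) (sym (trans eq (++-identityʳ _))))
    shorter {σ} {τ} (occ (x ∷ pre) post a b eq _ _) = inj₁ (index-< {σ} {τ}
      (ℕₚ.≤-trans (s≤s (ℕₚ.≤-trans (ℕₚ.m≤m+n _ _) (ℕₚ.m≤n+m _ (length pre)))) (lengths σ τ (x ∷ pre) post eq)))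
    shorter {σ} {τ} (occ [] (x ∷ post) a b eq _ _) = inj₁ (index-< {σ} {τ}
      (ℕₚ.≤-trans (ℕₚ.m<m+n _ (s≤s z≤n)) (lengths σ τ [] (x ∷ post) eq)))

-- Torsion pairs encoded by choice functions: c σ decides the side of σ where it is free.
module States {N : ℕ} (G : Geo N) where
  open Geo G
  open Crossings G

  Status : Set
  Status = Fin N → Bool × Bool

  InT InF : Status → Fin N → Set
  InT s σ = proj₁ (s σ) ≡ true
  InF s σ = proj₂ (s σ) ≡ true

  Q U : Fin N → Fin N → Set
  Q ρ σ = D̄ σ ρ × ρ Fin.< σ
  U ρ σ = Ū σ ρ × ρ Fin.< σ

  Q? : ∀ ρ σ → Dec (Q ρ σ)
  Q? ρ σ = Down? _ _ _ ρ ×-dec (ρ Finₚ.<? σ)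

  U? : ∀ ρ σ → Dec (U ρ σ)
  U? ρ σ = Crossings.Down? (flipGeo G) _ _ _ ρ ×-dec (ρ Finₚ.<? σ)

  allT? : ∀ s σ → Dec (∀ ρ → Q ρ σ → InT s ρ)
  allT? s σ = Finₚ.all? λ ρ → Q? ρ σ →-dec (proj₁ (s ρ) Bool.≟ true)

  allF? : ∀ s σ → Dec (∀ ρ → U ρ σ → InF s ρ)
  allF? s σ = Finₚ.all? λ ρ → U? ρ σ →-dec (proj₂ (s ρ) Bool.≟ true)

  -- With `q` (quotients in T) and `u` (subs in F) both true the string is free and `b` chooses;
  -- with just one of them the side is forced, and with neither the string is on no side.
  decide : Bool → Bool → Bool → Bool × Bool
  decide q u b = q ∧ (not u ∨ b) , u ∧ (not q ∨ not b)

  update : (Fin N → Bool) → Status → Status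
  update c s σ = decide (does (allT? s σ)) (does (allF? s σ)) (c σ)

  -- The round number serves as fuel: after `k` rounds the first `k` strings have their final
  -- status, since `update` looks only at smaller indices.
  table : (Fin N → Bool) → ℕ → Status
  table c zero    = λ _ → false , false
  table c (suc k) = update c (table c k)

  update-cong : ∀ c s s′ σ → (∀ ρ → ρ Fin.< σ → s ρ ≡ s′ ρ) → update c s σ ≡ update c s′ σ
  update-cong c s s′ σ eq = cong₂ (λ q u → decide q u (c σ))
    (does-⇔ (mk⇔ (λ h ρ q → trans (sym (cong proj₁ (eq ρ (proj₂ q)))) (h ρ q))
                 (λ h ρ q → trans (cong proj₁ (eq ρ (proj₂ q))) (h ρ q))) (allT? s σ) (allT? s′ σ))
    (does-⇔ (mk⇔ (λ h ρ u → trans (sym (cong proj₂ (eq ρ (proj₂ u)))) (h ρ u))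
                 (λ h ρ u → trans (cong proj₂ (eq ρ (proj₂ u))) (h ρ u))) (allF? s σ) (allF? s′ σ))

  table-stable : ∀ c k k′ σ → toℕ σ ℕ.< k → toℕ σ ℕ.< k′ → table c k σ ≡ table c k′ σ
  table-stable c (suc k) (suc k′) σ (s≤s σ≤k) (s≤s σ≤k′) = update-cong c _ _ σ λ ρ ρ<σ →
    table-stable c k k′ ρ (ℕₚ.<-≤-trans ρ<σ σ≤k) (ℕₚ.<-≤-trans ρ<σ σ≤k′)

  status : (Fin N → Bool) → Status
  status c = table c N

  unfold : ∀ c σ → status c σ ≡ update c (status c) σ
  unfold c σ = table-stable c N (suc N) σ (Finₚ.toℕ<n σ) (ℕₚ.m<n⇒m<1+n (Finₚ.toℕ<n σ))

  private
    true⇒ : ∀ {A : Set} (a? : Dec A) {b} → does a? ∧ b ≡ true → A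
    true⇒ (yes a) _ = a

    ¬both : ∀ q u b → proj₁ (decide q u b) ≡ true → proj₂ (decide q u b) ≡ true → ⊥
    ¬both true true true _ ()
    ¬both true true false ()

    some-T : ∀ {A : Set} (a? : Dec A) → A → ∀ u b →
             proj₁ (decide (does a?) u b) ≡ true ⊎ proj₂ (decide (does a?) u b) ≡ true
    some-T (yes _) _ false b = inj₁ refl
    some-T (yes _) _ true true = inj₁ refl
    some-T (yes _) _ true false = inj₂ refl
    some-T (no ¬a) a _ _ = ⊥-elim (¬a a)

    some-F : ∀ {A : Set} (a? : Dec A) → A → ∀ q b →
             proj₁ (decide q (does a?) b) ≡ true ⊎ proj₂ (decide q (does a?) b) ≡ true
    some-F a? a true  b = some-T (yes tt) tt (does a?) b
    some-F a? a false b = inj₂ (cong (_∧ true) (dec-true a? a))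

    chosen-T : ∀ {A : Set} (a? : Dec A) → A → ∀ u {b} → b ≡ true → proj₁ (decide (does a?) u b) ≡ true
    chosen-T (yes _) _ true refl = refl
    chosen-T (yes _) _ false refl = refl
    chosen-T (no ¬a) a _ _ = ⊥-elim (¬a a)

    chosen-F : ∀ {A : Set} (a? : Dec A) → A → ∀ q {b} → b ≡ false → proj₂ (decide q (does a?) b) ≡ true
    chosen-F (yes _) _ true refl = refl
    chosen-F (yes _) _ false refl = refl
    chosen-F (no ¬a) a _ _ = ⊥-elim (¬a a)

  -- At an end that is not shared, the edge of `σ` would lie on both sides of a gap of `ρ`. If both
  -- ends are shared, the inequalities between gaps are equalities and `ρ` is `σ`.
  QU⊥ : ∀ {ρ σ} → Q ρ σ → U ρ σ → ⊥
  QU⊥ {ρ} {σ} ((l , r , o , a , b) , ρ<σ) ((l′ , r′ , o′ , a′ , b′) , _) with occ-unique o o′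
  QU⊥ ((just k , r , o , a , b) , _) ((_ , _ , _ , a′ , _) , _) | refl , refl =
    L.gap-edge o (subst (_∈ L.gaps _) (L.≼-antisym a′ a) (lft-gap _))
  QU⊥ ((nothing , just k , o , a , b) , _) ((_ , _ , _ , _ , b′) , _) | refl , refl =
    R.gap-edge o (subst (_∈ R.gaps _) (R.≼-antisym b′ b) (rgt-gap _))
  QU⊥ {ρ} {σ} ((nothing , nothing , o , a , b) , ρ<σ) ((_ , _ , _ , a′ , b′) , _) | refl , refl =
    ℕₚ.<-irrefl (cong toℕ (string-injective (occ-antisym o) (L.≼-antisym a′ a) (R.≼-antisym b′ b))) ρ<σ

  system : System
  system = record
    { N = N ; X = Fin N → Bool ; Q = Q ; U = U ; Q? = Q? ; U? = U? ; Q-< = proj₂ ; U-< = proj₂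
    ; Q-trans = λ (d , lt) (d′ , lt′) → Down-trans d d′ , Finₚ.<-trans lt lt′
    ; U-trans = λ (d , lt) (d′ , lt′) → Crossings.Down-trans (flipGeo G) d d′ , Finₚ.<-trans lt lt′
    ; QU⊥ = QU⊥
    ; T = λ c → InT (status c) ; F = λ c → InF (status c)
    ; T? = λ c σ → proj₁ (status c σ) Bool.≟ true ; F? = λ c σ → proj₂ (status c σ) Bool.≟ true
    ; TF⊥ = λ {c} {σ} t f → ¬both (does (allT? (status c) σ)) (does (allF? (status c) σ)) (c σ)
              (trans (sym (cong proj₁ (unfold c σ))) t) (trans (sym (cong proj₂ (unfold c σ))) f)
    ; T-Q = λ {c} {ρ} {σ} t q → true⇒ (allT? (status c) σ) (trans (sym (cong proj₁ (unfold c σ))) t) ρ q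
    ; F-U = λ {c} {ρ} {σ} f u → true⇒ (allF? (status c) σ) (trans (sym (cong proj₂ (unfold c σ))) f) ρ u
    ; Q-TF = λ {c} {σ} h → subst (λ s → proj₁ s ≡ true ⊎ proj₂ s ≡ true) (sym (unfold c σ))
                             (some-T (allT? (status c) σ) h (does (allF? (status c) σ)) (c σ))
    ; U-TF = λ {c} {σ} h → subst (λ s → proj₁ s ≡ true ⊎ proj₂ s ≡ true) (sym (unfold c σ))
                             (some-F (allF? (status c) σ) h (does (allT? (status c) σ)) (c σ))
    ; mk = id
    ; mk-T = λ c {σ} eq h → trans (cong proj₁ (unfold c σ))
               (chosen-T (allT? (status c) σ) h (does (allF? (status c) σ)) eq)
    ; mk-F = λ c {σ} eq h → trans (cong proj₂ (unfold c σ))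
               (chosen-F (allF? (status c) σ) h (does (allT? (status c) σ)) eq) }

  linked : Linked
  linked = record { S = system ; G = G ; Q⇒ = proj₁ ; ⇒Q = _,_ ; U⇒ = proj₁ ; ⇒U = _,_ }

-- Incoherence of two routes at a vertex means that they cross some string in opposite directions.
module Incoherence (G : FlowGraph) (Fr : Framing G) where
  open FlowGraph G
  open Framing Fr
  open Framed G Fr using (Walk; IsRoute; splitAt; lexLT; _<cw[_]_)
  open Walks G Fr
  open Concrete G Fr
  open Geo geo using (seg; lft; rgt; Down; Up)
  module W = Words (States.linked geo)

  splitAt-sound : ∀ {v w} u es {a b} → Walk u es w → splitAt v u es ≡ just (a , b) →
                  es ≡ a ++ b × Walk u a v × Walk v b w
  splitAt-sound {v} u [] wk eq with u Finₚ.≟ v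
  splitAt-sound u [] wk refl | yes refl = refl , refl , wk
  splitAt-sound {v} u (e ∷ es) wk eq with u Finₚ.≟ v
  splitAt-sound u (e ∷ es) wk refl | yes refl = refl , refl , wk
  splitAt-sound {v} u (e ∷ es) (eu , wk) eq | no _ with splitAt v (tgt e) es in eq′
  splitAt-sound u (e ∷ es) (eu , wk) refl | no _ | just (a , b) with splitAt-sound (tgt e) es wk eq′
  ... | refl , wa , wb = refl , (eu , wa) , wb

  splitAt-complete : ∀ {v} u a b → Walk u a v → splitAt v u (a ++ b) ≡ just (a , b)
  splitAt-complete {v} u [] [] refl with u Finₚ.≟ u
  ... | yes _ = refl
  ... | no u≢ = ⊥-elim (u≢ refl)
  splitAt-complete {v} u [] (e ∷ b) refl with u Finₚ.≟ u
  ... | yes _ = refl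
  ... | no u≢ = ⊥-elim (u≢ refl)
  splitAt-complete {v} u (e ∷ a) b wk@(_ , wk′) with u Finₚ.≟ v
  ... | yes refl = ⊥-elim (ℕₚ.<-irrefl refl (walk-< e a wk))
  ... | no _ = cong (Maybe.map (map₁ (e ∷_))) (splitAt-complete (tgt e) a b wk′)

  lex⇒ : ∀ {rk} xs ys → lexLT rk xs ys →
         ∃[ c ] ∃[ a ] ∃[ b ] ∃[ xs′ ] ∃[ ys′ ] (xs ≡ c ++ a ∷ xs′ × ys ≡ c ++ b ∷ ys′ × rk a ℕ.< rk b)
  lex⇒ (a ∷ xs) (b ∷ ys) (inj₂ (_ , lt)) = [] , a , b , xs , ys , refl , refl , lt
  lex⇒ (a ∷ xs) (.a ∷ ys) (inj₁ (refl , l)) with lex⇒ xs ys l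
  ... | c , a′ , b′ , xs′ , ys′ , refl , refl , lt = a ∷ c , a′ , b′ , xs′ , ys′ , refl , refl , lt

  ⇒lex : ∀ {rk} c {a b xs ys} → rk a ℕ.< rk b → lexLT rk (c ++ a ∷ xs) (c ++ b ∷ ys)
  ⇒lex [] lt = inj₂ ((λ { refl → ℕₚ.<-irrefl refl lt }) , lt)
  ⇒lex (_ ∷ c) lt = inj₁ (refl , ⇒lex c lt)

  walk-start : ∀ es {u u′ w} → Walk u es w → Walk u′ es w → u ≡ u′
  walk-start [] refl refl = refl
  walk-start (_ ∷ _) (refl , _) (refl , _) = refl

  unreverse : ∀ xs c (a : Edge) zs → reverse xs ≡ c ++ a ∷ zs → xs ≡ (reverse zs ∷ʳ a) ++ reverse c
  unreverse xs c a zs eq = trans (sym (reverse-involutive xs)) (trans (cong reverse eq)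
    (trans (reverse-++ c (a ∷ zs)) (cong (_++ reverse c) (unfold-reverse a zs))))

  asSeg : ∀ R → IsRoute R → Seg
  asSeg R w = segment s t R w

  cw⇒crossing : ∀ {P Q v} (wP : IsRoute P) (wQ : IsRoute Q) → P <cw[ v ] Q →
                ∃[ σ ] (Up nothing (asSeg P wP) nothing σ × Down nothing (asSeg Q wQ) nothing σ)
  cw⇒crossing {P} {Q} {v} wP wQ (pP , sP , pQ , sQ , eqP , eqQ , _ , _ , _ , _ , lexI , lexO)
    with splitAt-sound s P wP eqP | splitAt-sound s Q wQ eqQ | lex⇒ (reverse pP) (reverse pQ) lexI | lex⇒ sQ sP lexO
  ... | refl , wpP , wsP | refl , wpQ , wsQ
      | c , a , b , xs , ys , eqa , eqb , a<b | d , f , g , xs′ , ys′ , refl , refl , f<g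
    with unreverse pP c a xs eqa | unreverse pQ c b ys eqb
  ... | refl | refl
    with walk-split (reverse xs ∷ʳ a) wpP | walk-split (reverse ys ∷ʳ b) wpQ | walk-split d wsP | walk-split d wsQ
  ... | u , wa , wc | u′ , wb , wc′ | w , wd , wg | w′ , wd′ , wf
    with walk-start (reverse c) wc wc′ | walk-end d wd wd′
  ... | refl | refl = St.name , St.up occP (edge≤gap a<b) (gap≤edge {outRank g} ℕₚ.≤-refl) ,
                      St.down occQ (gap≤edge {inRank b} ℕₚ.≤-refl) (edge≤gap f<g)
    where
    p : Seg
    p = segment u w (reverse c ++ d) (walk-++ (reverse c) wc wd)
    ta = proj₂ (walk-∷ʳ (reverse xs) wa)
    tb = proj₂ (walk-∷ʳ (reverse ys) wb)
    e∈ : gapPos (inRank b) ∈ In.gapsAt u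
    e∈ = subst (λ z → _ ∈ In.gapsAt z) tb (In.∈-gapsAt⁺ (a , trans ta (sym tb) , a<b))
    f∈ : gapPos (outRank g) ∈ Out.gapsAt w
    f∈ = subst (λ z → _ ∈ Out.gapsAt z) (proj₁ wg) (Out.∈-gapsAt⁺ (f , trans (proj₁ wf) (sym (proj₁ wg)) , f<g))
    module St = W.StringOn (W.stringOn {p} e∈ f∈)
    reassoc : ∀ (a b c d : List Edge) → (a ++ b) ++ (c ++ d) ≡ a ++ ((b ++ c) ++ d)
    reassoc a b c d = trans (++-assoc a b (c ++ d)) (cong (a ++_) (sym (++-assoc b c d)))
    occP : Occ p (asSeg _ wP) (just (inPos a)) (just (outPos g))
    occP = occ (reverse xs ∷ʳ a) (g ∷ ys′) wa wg (reassoc (reverse xs ∷ʳ a) (reverse c) d (g ∷ ys′))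
               (sym (lastIn-∷ʳ (reverse xs) a)) refl
    occQ : Occ p (asSeg _ wQ) (just (inPos b)) (just (outPos f))
    occQ = occ (reverse ys ∷ʳ b) (f ∷ xs′) wb wf (reassoc (reverse ys ∷ʳ b) (reverse c) d (f ∷ xs′))
               (sym (lastIn-∷ʳ (reverse ys) b)) refl

  just≢nothing : ∀ {k : ℕ} → just k ≢ nothing
  just≢nothing ()

  crossing⇒cw : ∀ {P Q σ} (wP : IsRoute P) (wQ : IsRoute Q) →
                Up nothing (asSeg P wP) nothing σ → Down nothing (asSeg Q wQ) nothing σ → ∃[ v ] P <cw[ v ] Q
  crossing⇒cw {P} {Q} {σ} wP wQ (just _ , just _ , occ pre post a b eq l≡ r≡ , x , y)
                                (just _ , just _ , occ pre′ post′ a′ b′ eq′ l≡′ r≡′ , x′ , y′)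
    with initLast pre | initLast pre′ | post | post′
  ... | xs ∷ʳ′ e | ys ∷ʳ′ f | g ∷ zs | h ∷ zs′ =
    -- The first vertex of the string serves as `v`: the routes enter it by different edges, so the
    -- left comparison is immediate.
    start (seg σ) , xs ∷ʳ e , edges (seg σ) ++ g ∷ zs , ys ∷ʳ f , edges (seg σ) ++ h ∷ zs′ ,
    trans (cong (splitAt _ s) eq) (splitAt-complete s (xs ∷ʳ e) _ a) ,
    trans (cong (splitAt _ s) eq′) (splitAt-complete s (ys ∷ʳ f) _ a′) ,
    ∷ʳ≢[] xs , ++∷≢[] (edges (seg σ)) , ∷ʳ≢[] ys , ++∷≢[] (edges (seg σ)) ,
    lexI , ⇒lex (edges (seg σ)) h<g
    where
    ∷ʳ≢[] : ∀ xs {x : Edge} → xs ∷ʳ x ≢ []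
    ∷ʳ≢[] [] ()
    ∷ʳ≢[] (_ ∷ _) ()
    ++∷≢[] : ∀ xs {x : Edge} {ys} → xs ++ x ∷ ys ≢ []
    ++∷≢[] [] ()
    ++∷≢[] (_ ∷ _) ()
    between : ∀ {i j k l m} → just k ≡ just (edgePos i) → k ℕ.≤ gapPos m → just l ≡ just (edgePos j) → gapPos m ℕ.≤ l →
              i ℕ.< j
    between {i} {j} {m = m} refl u refl v = ℕₚ.<-≤-trans (edge≤gap⁻¹ {i} {m} u) (gap≤edge⁻¹ {m} {j} v)
    e<f : inRank e ℕ.< inRank f
    e<f = between {m = inRank (proj₁ (Enumeration.at strings σ))} (trans l≡ (lastIn-∷ʳ xs e)) x (trans l≡′ (lastIn-∷ʳ ys f)) x′
    h<g : outRank h ℕ.< outRank g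
    h<g = between {m = outRank (proj₂ (proj₂ (Enumeration.at strings σ)))} r≡′ y′ r≡ y
    reverse-∷ʳ : ∀ xs (x : Edge) → reverse (xs ∷ʳ x) ≡ x ∷ reverse xs
    reverse-∷ʳ xs x = reverse-++ xs (x ∷ [])
    lexI : lexLT inRank (reverse (xs ∷ʳ e)) (reverse (ys ∷ʳ f))
    lexI = subst (λ z → lexLT inRank z (reverse (ys ∷ʳ f))) (sym (reverse-∷ʳ xs e))
             (subst (lexLT inRank (e ∷ reverse xs)) (sym (reverse-∷ʳ ys f)) (⇒lex [] e<f))
  ... | [] | _ | _ | _ = ⊥-elim (just≢nothing l≡)
  ... | _ ∷ʳ′ _ | [] | _ | _ = ⊥-elim (just≢nothing l≡′)
  ... | _ ∷ʳ′ _ | _ ∷ʳ′ _ | [] | _ = ⊥-elim (just≢nothing r≡)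
  ... | _ ∷ʳ′ _ | _ ∷ʳ′ _ | _ ∷ _ | [] = ⊥-elim (just≢nothing r≡′)

-- Maximal cliques as torsion pairs

module Cliques (G : FlowGraph) (Fr : Framing G) where
  open FlowGraph G
  open Framed G Fr using (IsRoute; _<cw[_]_; Coherent; MaxClique; _≈C_; Flip; _≤C_)
  open MaxClique
  open Walks G Fr
  open Concrete G Fr
  open Incoherence G Fr

  Λ₀ : Linked
  Λ₀ = States.linked geo

  Λ₀* : Linked
  Λ₀* = flipLinked Λ₀

  open Linked Λ₀ using (N; X; T; F; Q; U; Q-<; U-<; Q⇒; U⇒; mk-T; mk-F; TF⊥; Down; Up; _⊑_; _≋_; AllQ; AllU; T?; F?; Q-TF; ⊑⇒F; F⇒⊑)
  open Closure Λ₀ using (Down-trans; Down?; Downs⊆T?; leastBadF)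
  module C* = Closure Λ₀*
  open Extension Λ₀ using (Good; Route; route; crossing)
  module E* = Extension Λ₀*
  open Cover (States.system geo) using (disagree)

  asSeg-irrelevant : ∀ R (w w′ : IsRoute R) → asSeg R w ≡ asSeg R w′
  asSeg-irrelevant R w w′ = cong (asSeg R) (walk-irrelevant R w w′)

  onRoute? : ∀ {P : Seg → Set} → (∀ q → Dec (P q)) → ∀ R → Dec (Σ[ w ∈ IsRoute R ] P (asSeg R w))
  onRoute? {P} P? R with Walk? s R t
  ... | no ¬w = no λ (w , _) → ¬w w
  ... | yes w = map′ (w ,_) (λ (w′ , p) → subst P (asSeg-irrelevant R w′ w) p) (P? (asSeg R w))

  crossed? : ∀ C σ → Dec (Any (λ R → Σ[ w ∈ IsRoute R ] Down nothing (asSeg R w) nothing σ) (routes C))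
  crossed? C σ = any? (onRoute? (λ q → Down? nothing q nothing σ)) (routes C)

  choices : MaxClique → X
  choices C σ = does (crossed? C σ)

  -- A string crossed down by a member gets the choice true. One crossed up gets false, because
  -- coherence forbids another member to cross it down. The quotients and subs required by `mk-T`
  -- and `mk-F` are crossed by the same route.
  member⇒good : ∀ C σ →
    (∀ R w → R ∈ routes C → Down nothing (asSeg R w) nothing σ → T (choices C) σ) ×
    (∀ R w → R ∈ routes C → Up nothing (asSeg R w) nothing σ → F (choices C) σ)
  member⇒good C = strongInduction _ λ σ rec →
    (λ R w R∈ d → mk-T (choices C) (dec-true (crossed? C σ) (lose R∈ (w , d)))
      λ ρ q → proj₁ (rec ρ (Q-< q)) R w R∈ (Down-trans (Q⇒ q) d)) ,
    (λ R w R∈ u → mk-F (choices C) (dec-false (crossed? C σ) (uncrossed σ R w R∈ u))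
      λ ρ q → proj₂ (rec ρ (U-< q)) R w R∈ (C*.Down-trans (U⇒ q) u))
    where
    uncrossed : ∀ σ R w → R ∈ routes C → Up nothing (asSeg R w) nothing σ →
                ¬ Any (λ R → Σ[ w ∈ IsRoute R ] Down nothing (asSeg R w) nothing σ) (routes C)
    uncrossed σ R w R∈ u crossed with find crossed
    ... | R′ , R′∈ , w′ , d with crossing⇒cw {σ = σ} w w′ u d
    ...   | v , cw = proj₁ (coherent C R R′ R∈ R′∈ v) cw

  member⇒Route : ∀ C {R} w → R ∈ routes C → Route (choices C) (asSeg R w)
  member⇒Route C {R} w R∈ = route refl refl
    ((λ σ → proj₁ (member⇒good C σ) R w R∈) , (λ σ → proj₂ (member⇒good C σ) R w R∈))

  isRoute : ∀ C {R} → R ∈ routes C → IsRoute R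
  isRoute C = All.lookup (areRoutes C)

  good-coherent : ∀ {x R R′} w w′ → Route x (asSeg R w) → Route x (asSeg R′ w′) → Coherent R R′
  good-coherent w w′ (route _ _ (down , up)) (route _ _ (down′ , up′)) v =
    (λ cw → let (σ , u , d) = cw⇒crossing w w′ cw in TF⊥ (down′ σ d) (up σ u)) ,
    (λ cw → let (σ , u , d) = cw⇒crossing w′ w cw in TF⊥ (down σ d) (up′ σ u))

  Route⇒member : ∀ C {R} w → Route (choices C) (asSeg R w) → R ∈ routes C
  Route⇒member C w r = maximal C _ w λ R′ R′∈ → good-coherent w (isRoute C R′∈) r (member⇒Route C (isRoute C R′∈) R′∈)

  GoodList : X → List Edge → Set
  GoodList x R = Σ[ w ∈ IsRoute R ] Good x nothing (asSeg R w) nothing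

  goodList? : ∀ x R → Dec (GoodList x R)
  goodList? x = onRoute? λ q → Downs⊆T? x nothing q nothing ×-dec C*.Downs⊆T? x nothing q nothing

  goodRoutes : X → List (List Edge)
  goodRoutes x = filter (goodList? x) (listsUpTo (allFin m) n)

  ∈-goodRoutes : ∀ {x R} w → Good x nothing (asSeg R w) nothing → R ∈ goodRoutes x
  ∈-goodRoutes {x} {R} w g = ∈-filter⁺ (goodList? x) (∈-listsUpTo ∈-allFin n R (walk-length≤n R w)) (w , g)

  goodRoutes-good : ∀ {x R} → R ∈ goodRoutes x → GoodList x R
  goodRoutes-good {x} R∈ = proj₂ (∈-filter⁻ (goodList? x) {xs = listsUpTo (allFin m) n} R∈)

  clique : X → MaxClique
  clique x = record
    { routes = goodRoutes x
    ; areRoutes = All.map proj₁ (all-filter (goodList? x) (listsUpTo (allFin m) n))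
    ; coherent = λ P R P∈ R∈ → let (w , g) = goodRoutes-good P∈ ; (w′ , g′) = goodRoutes-good R∈
                               in good-coherent w w′ (route refl refl g) (route refl refl g′)
    ; maximal = λ P w coh → ∈-goodRoutes w (down P w coh , up P w coh) }
    where
    coherent-with : ∀ P → Set
    coherent-with P = ∀ R → R ∈ goodRoutes x → Coherent P R
    crossed-up : ∀ P w → coherent-with P → ∀ σ → Down nothing (asSeg P w) nothing σ →
                 ∃[ q ] (E*.Route x q × Up nothing q nothing σ) → ⊥
    crossed-up P w coh σ d (segment _ _ R w′ , E*.route refl refl (up , down) , u) =
      let (v , cw) = crossing⇒cw {σ = σ} w′ w u d in proj₂ (coh R (∈-goodRoutes w′ (down , up)) v) cw
    crossed-down : ∀ P w → coherent-with P → ∀ σ → Up nothing (asSeg P w) nothing σ →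
                   ∃[ q ] (Route x q × Down nothing q nothing σ) → ⊥
    crossed-down P w coh σ u (segment _ _ R w′ , route refl refl g , d) =
      let (v , cw) = crossing⇒cw {σ = σ} w w′ u d in proj₁ (coh R (∈-goodRoutes w′ g) v) cw
    -- A least bad string crossed by `P` is decided the wrong way with all its quotients in T; then
    -- `crossing` finds a route of `x` crossing it oppositely, which is incoherent with `P`.
    down : ∀ P w → coherent-with P → ∀ σ → Down nothing (asSeg P w) nothing σ → T x σ
    down P w coh = decidable-stable (Downs⊆T? x nothing (asSeg P w) nothing) λ ¬all →
      let (σ , d , f , allQ) = leastBadF ¬all in crossed-up P w coh σ d (E*.crossing σ f allQ)
    up : ∀ P w → coherent-with P → ∀ σ → Up nothing (asSeg P w) nothing σ → F x σ
    up P w coh = decidable-stable (C*.Downs⊆T? x nothing (asSeg P w) nothing) λ ¬all →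
      let (σ , u , t′ , allU) = C*.leastBadF ¬all in crossed-down P w coh σ u (crossing σ t′ allU)

  -- A string of `T x` in `F y` can be chosen with its subs in `F x`, so some route of `x` crosses
  -- it down; that route cannot belong to `y`. Hence the routes determine the torsion pair.
  routes⊆⇒⊑ : ∀ {x y} → (∀ {q} → Route x q → Route y q) → x ⊑ y
  routes⊆⇒⊑ {x} {y} h = decidable-stable (Order._⊑?_ (States.system geo) x y) λ ¬p → clash (disagree ¬p)
    where
    clash : ∃[ ρ ] (T x ρ × F y ρ × AllU x ρ × AllQ y ρ) → ⊥
    clash (ρ , tx , fy , allU , _) = let (q , r , d) = crossing ρ tx allU in
      TF⊥ (proj₁ (Route.good (h r)) ρ d) fy

  choices-clique : ∀ x → choices (clique x) ≋ x
  choices-clique x = routes⊆⇒⊑ to , routes⊆⇒⊑ from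
    where
    to : ∀ {q} → Route (choices (clique x)) q → Route x q
    to {segment _ _ R w} r@(route refl refl _) =
      let (w′ , g) = goodRoutes-good {x} (Route⇒member (clique x) w r)
      in subst (Route x) (asSeg-irrelevant R w′ w) (route refl refl g)
    from : ∀ {q} → Route x q → Route (choices (clique x)) q
    from {segment _ _ R w} (route refl refl g) = member⇒Route (clique x) w (∈-goodRoutes w g)

  S₁ : System
  S₁ = record
    { N = N ; X = MaxClique ; Q = Q ; U = U ; Q? = S.Q? ; U? = S.U? ; Q-< = S.Q-< ; U-< = S.U-<
    ; Q-trans = S.Q-trans ; U-trans = S.U-trans ; QU⊥ = S.QU⊥
    ; T = λ C → T (choices C) ; F = λ C → F (choices C)
    ; T? = λ C → T? (choices C) ; F? = λ C → F? (choices C)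
    ; TF⊥ = TF⊥ ; T-Q = λ {C} → S.T-Q {choices C} ; F-U = λ {C} → S.F-U {choices C}
    ; Q-TF = λ {C} → S.Q-TF {choices C} ; U-TF = λ {C} → S.U-TF {choices C}
    ; mk = clique
    ; mk-T = λ c {σ} eq h → proj₂ (choices-clique c) σ
               (mk-T c eq λ ρ q → proj₁ (choices-clique c) ρ (h ρ q))
    ; mk-F = λ c {σ} eq h → ⊑⇒F (proj₁ (choices-clique c)) σ
               (mk-F c eq λ ρ u → ⊑⇒F (proj₂ (choices-clique c)) ρ (h ρ u)) }
    where module S = System (States.system geo)

  Λ : Linked
  Λ = record { S = S₁ ; G = geo ; Q⇒ = proj₁ ; ⇒Q = _,_ ; U⇒ = proj₁ ; ⇒U = _,_ }

  open Order S₁ using () renaming (_⊑_ to _⊑₁_; _≋_ to _≋₁_)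

  ≈C⇒⊑ : ∀ {C C′} → C ≈C C′ → C ⊑₁ C′
  ≈C⇒⊑ {C} {C′} eq = routes⊆⇒⊑ h
    where
    h : ∀ {q} → Route (choices C) q → Route (choices C′) q
    h {segment _ _ R w} r@(route refl refl _) = member⇒Route C′ w (Equivalence.to (eq R) (Route⇒member C w r))

  Route-mono : ∀ {x y q} → x ≋ y → Route x q → Route y q
  Route-mono (p , p′) (route s t (down , up)) =
    route s t ((λ σ d → p σ (down σ d)) , (λ σ u → ⊑⇒F p′ σ (up σ u)))

  ≋⇒≈C : ∀ {C C′} → C ≋₁ C′ → C ≈C C′
  ≋⇒≈C {C} {C′} (p , p′) R = mk⇔ (half C C′ p p′) (half C′ C p′ p)
    where
    half : ∀ C C′ → C ⊑₁ C′ → C′ ⊑₁ C → R ∈ routes C → R ∈ routes C′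
    half C C′ p p′ R∈ = let w = isRoute C R∈
                        in Route⇒member C′ w (Route-mono (p , p′) (member⇒Route C w R∈))

-- Flips and covers

module Flips (G : FlowGraph) (Fr : Framing G) where
  open FlowGraph G
  open Framed G Fr using (IsRoute; _<cw[_]_; Coherent; MaxClique; _≈C_; Flip; _≤C_)
  open MaxClique
  open Walks G Fr
  open Concrete G Fr
  open Incoherence G Fr
  open Cliques G Fr public
  open Linked Λ₀ using (N; X; T; F; TF⊥; Down; Up; AllQ; AllU; F?)
  open Extension Λ₀ using (Good; Route; route; crossing)
  open Cover (States.system geo) using (disagree)
  open Order S₁ using () renaming (_⊑_ to _⊑₁_; _≋_ to _≋₁_)
  open Crossing Λ₀ using (unique-crossing; survives)
  open DoubleCrossing Λ₀ using (no-double-crossing; Route-flip; Route-unflip)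
  private
    module X* = Crossing Λ₀*
    S₀ = States.system geo

  Cov-choices : ∀ {C C′ σ} → Cov S₁ C C′ σ → Cov S₀ (choices C) (choices C′) σ
  Cov-choices c = record { Cov c }

  module _ {C C′ σ} (c : Cov S₀ (choices C) (choices C′) σ) where
    private
      x y : X
      x = choices C
      y = choices C′

    no-up : ∀ {q} → Route y q → ¬ Up nothing q nothing σ
    no-up r u = TF⊥ (Cov.Tσ c) (proj₂ (Route.good r) σ u)

    no-down : ∀ {q} → Route x q → ¬ Down nothing q nothing σ
    no-down r d = TF⊥ (proj₁ (Route.good r) σ d) (Cov.Fσ c)

    -- Exactly one route of `C` crosses the label up and exactly one of `C′` crosses it down, by
    -- `unique-crossing` and its flip; all others survive in both directions.
    exchanged : ∃[ q ] (E*.Route x q × Up nothing q nothing σ) → ∃[ q ] (Route y q × Down nothing q nothing σ) →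
                Flip C C′
    exchanged (segment _ _ R w , r*@(E*.route refl refl _) , u) (segment _ _ R′ w′ , r′@(route refl refl _) , d) =
      R , R′ , proj₁ cw , Route⇒member C w r , R≢R′ , proj₂ cw , λ P → mk⇔ (to P) (from P)
      where
      r : Route x (asSeg R w)
      r = Route-unflip r*
      cw : ∃[ v ] R <cw[ v ] R′
      cw = crossing⇒cw {σ = σ} w w′ u d
      R≢R′ : R ≢ R′
      R≢R′ refl = no-down r (subst (λ q → Down nothing q nothing σ) (asSeg-irrelevant R w′ w) d)
      to : ∀ P → P ∈ routes C′ → (P ∈ routes C × P ≢ R) ⊎ P ≡ R′
      to P P∈ = decided (Crossings.Down? geo nothing (asSeg P wP) nothing σ)
        where
        wP : IsRoute P
        wP = isRoute C′ P∈
        rP : Route y (asSeg P wP)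
        rP = member⇒Route C′ wP P∈
        decided : Dec (Down nothing (asSeg P wP) nothing σ) → (P ∈ routes C × P ≢ R) ⊎ P ≡ R′
        decided (yes dP) = inj₂ (cong edges (X*.unique-crossing (Cov-dual S₀ c) (Route-flip rP) (Route-flip r′) dP d))
        decided (no ¬d) = inj₁ (Route⇒member C wP (Route-unflip (X*.survives (Cov-dual S₀ c) (Route-flip rP) ¬d)) ,
          λ { refl → no-up rP (subst (λ q → Up nothing q nothing σ) (asSeg-irrelevant P w wP) u) })
      from : ∀ P → (P ∈ routes C × P ≢ R) ⊎ P ≡ R′ → P ∈ routes C′
      from P (inj₂ refl) = Route⇒member C′ w′ r′
      from P (inj₁ (P∈ , P≢R)) = Route⇒member C′ (isRoute C P∈)
        (survives c rP λ uP → P≢R (cong edges (unique-crossing c rP r uP u)))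
        where
        rP : Route x (asSeg P (isRoute C P∈))
        rP = member⇒Route C (isRoute C P∈) P∈

    Cov⇒Flip : Flip C C′
    Cov⇒Flip = exchanged (E*.crossing σ (Cov.Fσ c) (Cov.Qσ c)) (crossing σ (Cov.Tσ c) (Cov.Uσ c))

  -- Otherwise some string `ρ` is crossed down by a route of `C` and up by one of `C′`. A route
  -- common to both cliques cannot do this, so these are `R` and `R′`, which would then cross in
  -- both directions.
  Flip⇒⊑ : ∀ {C C′} → Flip C C′ → C ⊑₁ C′
  Flip⇒⊑ {C} {C′} (R , R′ , v , R∈ , R≢R′ , cw , swap) =
    decidable-stable (Order._⊑?_ S₁ C C′) λ ¬p → clash (disagree ¬p)
    where
    w : IsRoute R
    w = isRoute C R∈
    R′∈ : R′ ∈ routes C′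
    R′∈ = Equivalence.from (swap R′) (inj₂ refl)
    w′ : IsRoute R′
    w′ = isRoute C′ R′∈
    r : Route (choices C) (asSeg R w)
    r = member⇒Route C w R∈
    r′ : Route (choices C′) (asSeg R′ w′)
    r′ = member⇒Route C′ w′ R′∈
    forth : ∀ {q} → Route (choices C) q → q ≡ asSeg R w ⊎ Route (choices C′) q
    forth {segment _ _ P wP} rP@(route refl refl _) = decided (≡-dec Finₚ._≟_ P R)
      where
      decided : Dec (P ≡ R) → asSeg P wP ≡ asSeg R w ⊎ Route (choices C′) (asSeg P wP)
      decided (yes refl) = inj₁ (asSeg-irrelevant R wP w)
      decided (no P≢R) = inj₂ (member⇒Route C′ wP (Equivalence.from (swap P) (inj₁ (Route⇒member C wP rP , P≢R))))
    back : ∀ {q} → Route (choices C′) q → q ≡ asSeg R′ w′ ⊎ Route (choices C) q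
    back {segment _ _ P wP} rP@(route refl refl _) = decided (Equivalence.to (swap P) (Route⇒member C′ wP rP))
      where
      decided : (P ∈ routes C × P ≢ R) ⊎ P ≡ R′ → asSeg P wP ≡ asSeg R′ w′ ⊎ Route (choices C) (asSeg P wP)
      decided (inj₂ refl) = inj₁ (asSeg-irrelevant R′ wP w′)
      decided (inj₁ (P∈ , _)) = inj₂ (member⇒Route C wP P∈)
    clash : ∃[ ρ ] (T (choices C) ρ × F (choices C′) ρ × AllU (choices C) ρ × AllQ (choices C′) ρ) → ⊥
    clash (ρ , t , f , allU , allQ) =
      let (q , rq , d) = crossing ρ t allU
          (q′ , rq′ , u) = E*.crossing ρ f allQ
      in clash′ (forth rq) (back (Route-unflip rq′)) d u
      where
      clash′ : ∀ {q q′} → q ≡ asSeg R w ⊎ Route (choices C′) q → q′ ≡ asSeg R′ w′ ⊎ Route (choices C) q′ →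
               Down nothing q nothing ρ → Up nothing q′ nothing ρ → ⊥
      clash′ (inj₂ r″) _ d u = TF⊥ (proj₁ (Route.good r″) ρ d) f
      clash′ (inj₁ _) (inj₂ r″) d u = TF⊥ t (proj₂ (Route.good r″) ρ u)
      clash′ (inj₁ refl) (inj₁ refl) d u = let (σ , uσ , dσ) = cw⇒crossing w w′ cw in
        no-double-crossing {σ = σ} {ρ} r r′ forth uσ dσ d u

  ≤C⇒⊑ : ∀ {C C′} → C ≤C C′ → C ⊑₁ C′
  ≤C⇒⊑ ε σ t = t
  ≤C⇒⊑ {C} (_◅_ {j = D} (inj₁ eq) rest) σ t = ≤C⇒⊑ rest σ (≈C⇒⊑ {C} {D} eq σ t)
  ≤C⇒⊑ {C} (_◅_ {j = D} (inj₂ fl) rest) σ t = ≤C⇒⊑ rest σ (Flip⇒⊑ {C} {D} fl σ t)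

  ⊑⇒≤C : ∀ {C C′} → C ⊑₁ C′ → C ≤C C′
  ⊑⇒≤C p = Star.map
    (λ { {C} {D} (inj₁ eq) → inj₁ (≋⇒≈C {C} {D} eq) ; {C} {D} (inj₂ (σ , c)) → inj₂ (Cov⇒Flip {C} {D} (Cov-choices c)) })
    (Cover.⊑⇒Star S₁ p)

-- Labeling, polygons and the final lattice properties

firstTrue : ∀ {n} → (Fin n → Bool) → Maybe (Fin n)
firstTrue {zero} f = nothing
firstTrue {suc n} f = if f zero then just zero else Maybe.map suc (firstTrue (f ∘ suc))

firstTrue-cong : ∀ {n} {f g : Fin n → Bool} → (∀ i → f i ≡ g i) → firstTrue f ≡ firstTrue g
firstTrue-cong {zero} eq = refl
firstTrue-cong {suc n} eq = cong₂ (λ b m → if b then just zero else Maybe.map suc m)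
                                  (eq zero) (firstTrue-cong (eq ∘ suc))

firstTrue-unique : ∀ {n} {f : Fin n → Bool} σ → f σ ≡ true → (∀ ρ → f ρ ≡ true → ρ ≡ σ) → firstTrue f ≡ just σ
firstTrue-unique {suc n} {f} zero fσ uniq rewrite fσ = refl
firstTrue-unique {suc n} {f} (suc σ) fσ uniq with f zero in eq
... | true with () ← uniq zero eq
... | false = cong (Maybe.map suc) (firstTrue-unique σ fσ λ ρ t → Finₚ.suc-injective (uniq (suc ρ) t))

choiceCons : ∀ {n} → Bool → (Fin n → Bool) → Fin (suc n) → Bool
choiceCons b f zero = b
choiceCons b f (suc i) = f i

allChoices : ∀ n → List (Fin n → Bool)
allChoices zero = (λ ()) ∷ []
allChoices (suc n) = cartesianProductWith choiceCons (true ∷ false ∷ []) (allChoices n)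

∈-allChoices : ∀ {n} (f : Fin n → Bool) → ∃[ g ] (g ∈ allChoices n × ∀ i → g i ≡ f i)
∈-allChoices {zero} f = _ , here refl , λ ()
∈-allChoices {suc n} f with ∈-allChoices (f ∘ suc)
... | g , g∈ , eq = choiceCons (f zero) g , ∈-cartesianProductWith⁺ choiceCons (bool (f zero)) g∈ ,
                    λ { zero → refl ; (suc i) → eq i }
  where
  bool : ∀ b → b ∈ (true ∷ false ∷ [])
  bool true = here refl
  bool false = there (here refl)

record Presentation : Set₁ where
  field S : System
  open System S public
  open Joins S public
  open Lattice S public
  infix 4 _≤_ _≈_
  field
    _≤_ _≈_ : X → X → Set
    ≤⇒⊑ : ∀ {x y} → x ≤ y → x ⊑ y
    ⊑⇒≤ : ∀ {x y} → x ⊑ y → x ≤ y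
    ≈⇒≋ : ∀ {x y} → x ≈ y → x ≋ y
    ≋⇒≈ : ∀ {x y} → x ≋ y → x ≈ y
    inner-label-unique : ∀ (d : PolyData S) → let open PolyData d in ∀ {τ τ′} →
                         F y₁ τ → T m₁ τ → F y₁ τ′ → T m₁ τ′ → τ ≡ τ′

  pos : Pos
  pos = record { Carrier = X ; _≈_ = _≈_ ; _≤_ = _≤_ }

module HH (D : Presentation) where
  open Presentation D
  open PosNotions pos using (_⋖_; CoverPath; _∈≈_; Polygon; labelsAlong; RankCondition; Finite; IsHHLattice; PolygonsAreSmall)
  open Cover S hiding (separate)
  open Polygons S
  open Cov

  ⋖⇒cov : ∀ {x y} → x ⋖ y → ∃[ σ ] Cov S x y σ
  ⋖⇒cov ((x≤y , x≉y) , cover) = ⋖⇒Cov (≤⇒⊑ x≤y) (λ y⊑x → x≉y (≋⇒≈ (≤⇒⊑ x≤y , y⊑x)))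
    λ z x⊑z z⊑y → [ inj₁ ∘ ≈⇒≋ , inj₂ ∘ ≈⇒≋ ]′ (cover z (⊑⇒≤ x⊑z) (⊑⇒≤ z⊑y))

  cov⇒⋖ : ∀ {x y σ} → Cov S x y σ → x ⋖ y
  cov⇒⋖ c = (⊑⇒≤ (below c) , λ x≈y → Cov⇒⋢ c (proj₂ (≈⇒≋ x≈y))) ,
    λ z x≤z z≤y → [ inj₁ ∘ ≋⇒≈ , inj₂ ∘ ≋⇒≈ ]′ (Cov⇒⋖ c z (≤⇒⊑ x≤z) (≤⇒⊑ z≤y))

  ≋-refl : ∀ {x} → x ≋ x
  ≋-refl = (λ _ t → t) , (λ _ t → t)

  finite : Finite
  finite = List.map mk (allChoices N) , λ x → let (c , c∈ , eq) = ∈-allChoices (λ σ → does (T? x σ)) in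
    Anyₚ.map⁺ (lose c∈ (≋⇒≈ (⊑-mk c (λ σ t → trans (eq σ) (dec-true (T? x σ) t)) ,
                             mk-⊑ c (λ σ f → trans (eq σ) (dec-false (T? x σ) (λ t → TF⊥ t f))))))

  isLattice : IsLattice _≈_ _≤_ _⊔_ _⊓_
  isLattice = record
    { isPartialOrder = record
      { isPreorder = record
        { isEquivalence = record
          { refl = ≋⇒≈ ≋-refl
          ; sym = λ p → let (a , b) = ≈⇒≋ p in ≋⇒≈ (b , a)
          ; trans = λ p q → let (a , b) = ≈⇒≋ p ; (c , d) = ≈⇒≋ q in ≋⇒≈ (⊑-trans a c , ⊑-trans d b) }
        ; reflexive = λ p → ⊑⇒≤ (proj₁ (≈⇒≋ p))
        ; trans = λ p q → ⊑⇒≤ (⊑-trans (≤⇒⊑ p) (≤⇒⊑ q)) }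
      ; antisym = λ p q → ≋⇒≈ (≤⇒⊑ p , ≤⇒⊑ q) }
    ; supremum = λ x y → ⊑⇒≤ (⊔-ub₁ x y) , ⊑⇒≤ (⊔-ub₂ x y) , λ z p q → ⊑⇒≤ (⊔-lub (≤⇒⊑ p) (≤⇒⊑ q))
    ; infimum = λ x y → ⊑⇒≤ (⊓-lb₁ x y) , ⊑⇒≤ (⊓-lb₂ x y) , λ z p q → ⊑⇒≤ (⊓-glb (≤⇒⊑ p) (≤⇒⊑ q)) }

  ⊔-semidistributive : ∀ x y z → (x ⊔ y) ≈ (x ⊔ z) → (x ⊔ (y ⊓ z)) ≈ (x ⊔ y)
  ⊔-semidistributive x y z eq = ≋⇒≈ (⊔-lub (⊔-ub₁ x y) (⊑-trans (⊓-lb₁ y z) (⊔-ub₂ x y)) ,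
    F⇒⊑ λ σ f → semidistributive (⊔-ub₁ x y) (⊔-ub₂ x y) F-⊔ (⊔-ub₂ x z) F-⊔ (≈⇒≋ eq) T-⊓ σ
      (⊑⇒F (⊔-ub₁ x (y ⊓ z)) σ f) (⊑⇒F (⊔-ub₂ x (y ⊓ z)) σ f))

  ⊓-semidistributive : ∀ x y z → (x ⊓ y) ≈ (x ⊓ z) → (x ⊓ (y ⊔ z)) ≈ (x ⊓ y)
  ⊓-semidistributive x y z eq = ≋⇒≈ (
    (λ σ t → Joins.semidistributive (dual S) (⊑⇒F (⊓-lb₁ x y)) (⊑⇒F (⊓-lb₂ x y)) T-⊓
      (⊑⇒F (⊓-lb₂ x z)) T-⊓ (⊑⇒F (proj₂ (≈⇒≋ eq)) , ⊑⇒F (proj₁ (≈⇒≋ eq))) F-⊔ σ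
      (⊓-lb₁ x (y ⊔ z) σ t) (⊓-lb₂ x (y ⊔ z) σ t)) ,
    ⊓-glb (⊓-lb₁ x y) (⊑-trans (⊓-lb₂ x y) (⊔-ub₁ y z)))

  label? : ∀ x y σ → Dec (F x σ × T y σ)
  label? x y σ = F? x σ ×-dec T? y σ

  -- On covers F x ∩ T y has exactly one element.
  ℓ : X → X → Maybe (Fin N)
  ℓ x y = firstTrue (λ σ → does (label? x y σ))

  ℓ-cong : ∀ x x′ y y′ → x ≈ x′ → y ≈ y′ → ℓ x y ≡ ℓ x′ y′
  ℓ-cong x x′ y y′ p q = firstTrue-cong λ σ → does-⇔
    (mk⇔ (λ (f , t) → ⊑⇒F (proj₂ (≈⇒≋ p)) σ f , proj₁ (≈⇒≋ q) σ t)
         (λ (f , t) → ⊑⇒F (proj₁ (≈⇒≋ p)) σ f , proj₂ (≈⇒≋ q) σ t)) (label? x y σ) (label? x′ y′ σ)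

  ℓ-cov : ∀ {x y σ} → Cov S x y σ → ℓ x y ≡ just σ
  ℓ-cov {x} {y} {σ} c = firstTrue-unique σ (dec-true (label? x y σ) (Fσ c , Tσ c))
    λ ρ eq → let (f , t) = dec-true⁻¹ (label? x y ρ) eq in label-unique c ρ f t

  -- The index of the string serves as rank: an inner label has one bottom label as proper quotient
  -- and the other as proper sub, so its index exceeds both. The value at `nothing` never arises on
  -- covers.
  rank : Maybe (Fin N) → ℕ
  rank nothing = 0
  rank (just σ) = toℕ σ

  record Side (d : PolyData S) : Set where
    open PolyData d
    field
      inner    : List⁺ X
      chain    : CoverPath x (toList inner) y
      contains : ∀ z → y₁ ⊑ z → z ⊑ m₁ → z ∈≈ toList inner
      bounds   : ∀ a → a ∈ toList inner → y₁ ⊑ a × a ⊑ m₁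

  side : ∀ d → Side d
  side d with short (PolyData.y₁⊑m₁ d) (λ _ _ f t f′ t′ → inner-label-unique d f t f′ t′)
  ... | inj₁ m₁⊑y₁ = record
    { inner = y₁ ∷ []
    ; chain = cov⇒⋖ up₁ , cov⇒⋖ (Cov-resp (m₁⊑y₁ , y₁⊑m₁) ≋-refl down₁)
    ; contains = λ z a b → here (≋⇒≈ (⊑-trans b m₁⊑y₁ , a))
    ; bounds = λ { a (here refl) → (λ _ t → t) , y₁⊑m₁ } }
    where open PolyData d
  ... | inj₂ (τ , c) = record
    { inner = y₁ ∷ m₁ ∷ []
    ; chain = cov⇒⋖ up₁ , cov⇒⋖ c , cov⇒⋖ down₁
    ; contains = λ z a b → [ here ∘ ≋⇒≈ , there ∘ here ∘ ≋⇒≈ ]′ (Cov⇒⋖ c z a b)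
    ; bounds = λ { a (here refl) → (λ _ t → t) , y₁⊑m₁ ; a (there (here refl)) → y₁⊑m₁ , (λ _ t → t) } }
    where open PolyData d

  polygon : ∀ d → Polygon (PolyData.x d) (PolyData.y d)
  polygon d = record
    { inner₁ = S₁.inner ; inner₂ = S₂.inner ; chain₁ = S₁.chain ; chain₂ = S₂.chain
    ; union = λ z x≤z z≤y → located z (locate z (≤⇒⊑ x≤z) (≤⇒⊑ z≤y))
    ; disjoint = λ a b a∈ b∈ a≈b → apart₁ a∈ b∈ (proj₁ (≈⇒≋ a≈b))
    ; separate = λ a b a∈ b∈ → apart₁ a∈ b∈ ∘ ≤⇒⊑ , apart₂ a∈ b∈ ∘ ≤⇒⊑ }
    where
    open PolyData d
    open Poly d
    module S₁ = Side (side d)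
    module S₂ = Side (side (PolyData-swap d))
    located : ∀ z → (z ≋ x) ⊎ (z ≋ y) ⊎ (y₁ ⊑ z × z ⊑ m₁) ⊎ (y₂ ⊑ z × z ⊑ m₂) →
              (z ≈ x) ⊎ (z ≈ y) ⊎ (z ∈≈ toList S₁.inner) ⊎ (z ∈≈ toList S₂.inner)
    located z (inj₁ e) = inj₁ (≋⇒≈ e)
    located z (inj₂ (inj₁ e)) = inj₂ (inj₁ (≋⇒≈ e))
    located z (inj₂ (inj₂ (inj₁ (a , b)))) = inj₂ (inj₂ (inj₁ (S₁.contains z a b)))
    located z (inj₂ (inj₂ (inj₂ (a , b)))) = inj₂ (inj₂ (inj₂ (S₂.contains z a b)))
    apart₁ : ∀ {a b} → a ∈ toList S₁.inner → b ∈ toList S₂.inner → ¬ (a ⊑ b)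
    apart₁ {a} {b} a∈ b∈ a⊑b = TF⊥ (proj₂ (S₂.bounds b b∈) σ₁ (a⊑b σ₁ (proj₁ (S₁.bounds a a∈) σ₁ (Tσ up₁)))) (Fσ down₂)
    apart₂ : ∀ {a b} → a ∈ toList S₁.inner → b ∈ toList S₂.inner → ¬ (b ⊑ a)
    apart₂ {a} {b} a∈ b∈ b⊑a = TF⊥ (proj₂ (S₁.bounds a a∈) σ₂ (b⊑a σ₂ (proj₁ (S₂.bounds b b∈) σ₂ (Tσ up₂)))) (Fσ down₁)

  same-label⇒≋ : ∀ {x y₁ y₂ σ₁ σ₂} → Cov S x y₁ σ₁ → Cov S x y₂ σ₂ → ¬ (y₁ ≋ y₂) → σ₁ ≢ σ₂
  same-label⇒≋ c₁ c₂ y₁≉y₂ refl = y₁≉y₂ (above-cover c₁ (below c₂) (Tσ c₂) , above-cover c₂ (below c₁) (Tσ c₁))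

  polygonal-up : ∀ x y₁ y₂ → x ⋖ y₁ → x ⋖ y₂ → ¬ (y₁ ≈ y₂) → Polygon x (y₁ ⊔ y₂)
  polygonal-up x y₁ y₂ p q y₁≉y₂ with ⋖⇒cov p | ⋖⇒cov q
  ... | σ₁ , c₁ | σ₂ , c₂ = polygon (Up.polyData (same-label⇒≋ c₁ c₂ (y₁≉y₂ ∘ ≋⇒≈)) c₁ c₂
                                      (⊔-ub₁ y₁ y₂) (⊔-ub₂ y₁ y₂) F-⊔)

  polygonal-down : ∀ x y₁ y₂ → y₁ ⋖ x → y₂ ⋖ x → ¬ (y₁ ≈ y₂) → Polygon (y₁ ⊓ y₂) x
  polygonal-down x y₁ y₂ p q y₁≉y₂ with ⋖⇒cov p | ⋖⇒cov q
  ... | σ₁ , c₁ | σ₂ , c₂ = polygon (PolyData-undual S (Polygons.Up.polyData (dual S) different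
      (Cov-dual S c₁) (Cov-dual S c₂) (⊑⇒F (⊓-lb₁ y₁ y₂)) (⊑⇒F (⊓-lb₂ y₁ y₂)) T-⊓))
    where
    different : σ₁ ≢ σ₂
    different refl = y₁≉y₂ (≋⇒≈ (below-cover c₂ (below c₁) (λ t → TF⊥ t (Fσ c₁)) ,
                                 below-cover c₁ (below c₂) (λ t → TF⊥ t (Fσ c₂))))

  data SideShape (x y : X) (σ₁ σ₂ : Fin N) : List⁺ X → Set where
    two   : ∀ {a} → Cov S x a σ₁ → Cov S a y σ₂ → SideShape x y σ₁ σ₂ (a ∷ [])
    three : ∀ {a b τ} → Cov S x a σ₁ → Cov S a b τ → Cov S b y σ₂ → σ₁ Fin.< τ → σ₂ Fin.< τ →
            SideShape x y σ₁ σ₂ (a ∷ b ∷ [])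

  head-label : ∀ {x y σ₁ σ₂ as} → SideShape x y σ₁ σ₂ as → ℓ x (head as) ≡ just σ₁
  head-label (two c _) = ℓ-cov c
  head-label (three c _ _ _ _) = ℓ-cov c

  last-label : ∀ {x y σ₁ σ₂ as} → SideShape x y σ₁ σ₂ as → ℓ (last as) y ≡ just σ₂
  last-label (two _ c) = ℓ-cov c
  last-label (three _ _ c _ _) = ℓ-cov c

  small : ∀ {x y σ₁ σ₂ as} → SideShape x y σ₁ σ₂ as → List⁺.length as ≡ 1 ⊎ List⁺.length as ≡ 2
  small (two _ _) = inj₁ refl
  small (three _ _ _ _ _) = inj₂ refl

  rank-condition : ∀ {x y σ₁ σ₂ as} → SideShape x y σ₁ σ₂ as → RankCondition rank (labelsAlong ℓ x (toList as) y)
  rank-condition (two _ _) zero zero ()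
  rank-condition (two _ _) zero (suc zero) ()
  rank-condition (two _ _) (suc zero) zero ()
  rank-condition (two _ _) (suc zero) (suc zero) ()
  rank-condition (three c₁ c₂ _ lt _) zero (suc zero) _ =
    subst₂ (λ m k → rank m ℕ.< rank k) (sym (ℓ-cov c₁)) (sym (ℓ-cov c₂)) lt
  rank-condition (three _ c₂ c₃ _ lt) (suc (suc zero)) (suc zero) _ =
    subst₂ (λ m k → rank m ℕ.< rank k) (sym (ℓ-cov c₃)) (sym (ℓ-cov c₂)) lt
  rank-condition (three _ _ _ _ _) zero zero ()
  rank-condition (three _ _ _ _ _) zero (suc (suc zero)) ()
  rank-condition (three _ _ _ _ _) (suc zero) zero ()
  rank-condition (three _ _ _ _ _) (suc zero) (suc zero) (s≤s ())
  rank-condition (three _ _ _ _ _) (suc zero) (suc (suc zero)) ()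
  rank-condition (three _ _ _ _ _) (suc (suc zero)) zero ()
  rank-condition (three _ _ _ _ _) (suc (suc zero)) (suc (suc zero)) ()

  path-above : ∀ c cs y → CoverPath c cs y → c ⊑ y × (∀ {a} → a ∈ (c ∷ cs) → c ⊑ a)
  path-above c [] y c⋖y = below (proj₂ (⋖⇒cov c⋖y)) , λ { (here refl) _ t → t }
  path-above c (d ∷ cs) y (c⋖d , path) with path-above d cs y path
  ... | d⊑y , d⊑ = ⊑-trans c⊑d d⊑y , λ { (here refl) _ t → t ; (there a∈) → ⊑-trans c⊑d (d⊑ a∈) }
    where
    c⊑d : c ⊑ d
    c⊑d = below (proj₂ (⋖⇒cov c⋖d))

  path-below : ∀ {c y} cs → CoverPath c cs y → ∀ {a} → a ∈ cs → a ⊑ y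
  path-below {y = y} (c ∷ cs) (_ , path) (here refl) = proj₁ (path-above c cs y path)
  path-below (c ∷ cs) (_ , path) (there a∈) = path-below cs path a∈

  shape : ∀ (d : PolyData S) → let open PolyData d in ∀ as → CoverPath x (toList as) y → head as ≡ y₁ →
          (∀ a → a ∈ toList as → y₁ ⊑ a × a ⊑ m₁) → SideShape x y σ₁ σ₂ as
  shape d (.(PolyData.y₁ d) ∷ cs) (_ , path) refl bounds = go cs path (λ a a∈ → bounds a (there a∈))
    where
    open PolyData d
    open Poly d
    final : ∀ c → y₁ ⊑ c → c ⊑ m₁ → c ⋖ y → Cov S c y σ₂
    final c y₁⊑c c⊑m₁ ((c≤y , _) , cover) with cover m₁ (⊑⇒≤ c⊑m₁) (⊑⇒≤ (below down₁))
    ... | inj₁ m₁≈c = Cov-resp (≈⇒≋ m₁≈c) ≋-refl down₁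
    ... | inj₂ m₁≈y = ⊥-elim (Cov⇒⋢ down₁ (proj₂ (≈⇒≋ m₁≈y)))
    go : ∀ cs → CoverPath y₁ cs y → (∀ a → a ∈ cs → y₁ ⊑ a × a ⊑ m₁) → SideShape x y σ₁ σ₂ (y₁ ∷ cs)
    go [] y₁⋖y _ = two up₁ (final y₁ (λ _ t → t) y₁⊑m₁ y₁⋖y)
    go (c ∷ []) (y₁⋖c , c⋖y) bounds with ⋖⇒cov y₁⋖c | bounds c (here refl)
    ... | τ , cτ | y₁⊑c , c⊑m₁ = three up₁ cτ (final c y₁⊑c c⊑m₁ c⋖y) (Q-< (side-Q τ f t)) (U-< (side-U τ f t))
      where
      f = Fσ cτ
      t = c⊑m₁ τ (Tσ cτ)
    -- A third inner element would give two consecutive covers with the same inner label, which is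
    -- in T after the first and in F before the second.
    go (c ∷ c′ ∷ cs) (y₁⋖c , c⋖c′ , _) bounds
      with ⋖⇒cov y₁⋖c | ⋖⇒cov c⋖c′ | bounds c (here refl) | bounds c′ (there (here refl))
    ... | τ , cτ | τ′ , cτ′ | y₁⊑c , c⊑m₁ | _ , c′⊑m₁
      with inner-label-unique d (Fσ cτ) (c⊑m₁ τ (Tσ cτ)) (⊑⇒F y₁⊑c τ′ (Fσ cτ′)) (c′⊑m₁ τ′ (Tσ cτ′))
    ...   | refl = ⊥-elim (TF⊥ (Tσ cτ) (Fσ cτ′))

  record Shapes {x y : X} (p : Polygon x y) : Set where
    open Polygon p
    field
      {σ₁ σ₂} : Fin N
      shape₁  : SideShape x y σ₁ σ₂ inner₁
      shape₂  : SideShape x y σ₂ σ₁ inner₂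

  -- An arbitrary polygon is given by its chains only. Once its top is known to be the join of the
  -- two atoms, it is one of those described by `PolyData`.
  shapes : ∀ {x y} (p : Polygon x y) → Shapes p
  shapes {x} {y} p with Polygon.inner₁ p in eq₁ | Polygon.inner₂ p in eq₂
  ... | y₁ ∷ cs₁ | y₂ ∷ cs₂ = go (subst (λ as → CoverPath x (toList as) y) eq₁ chain₁)
                                 (subst (λ as → CoverPath x (toList as) y) eq₂ chain₂)
    where
    open Polygon p
    ∈₁ : ∀ {a} → a ∈ (y₁ ∷ cs₁) → a ∈ toList inner₁
    ∈₁ = subst (λ as → _ ∈ toList as) (sym eq₁)
    ∈₂ : ∀ {a} → a ∈ (y₂ ∷ cs₂) → a ∈ toList inner₂
    ∈₂ = subst (λ as → _ ∈ toList as) (sym eq₂)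
    go : CoverPath x (y₁ ∷ cs₁) y → CoverPath x (y₂ ∷ cs₂) y → Shapes p
    go (x⋖y₁ , path₁) (x⋖y₂ , path₂) with ⋖⇒cov x⋖y₁ | ⋖⇒cov x⋖y₂
    ... | σ₁ , c₁ | σ₂ , c₂ = record
      { shape₁ = subst (SideShape x y σ₁ σ₂) (sym eq₁) (shape d (y₁ ∷ cs₁) (x⋖y₁ , path₁) refl bounds₁)
      ; shape₂ = subst (SideShape x y σ₂ σ₁) (sym eq₂) (shape (PolyData-swap d) (y₂ ∷ cs₂) (x⋖y₂ , path₂) refl bounds₂) }
      where
      y₁⊑y = proj₁ (path-above y₁ cs₁ y path₁)
      y₂⊑y = proj₁ (path-above y₂ cs₂ y path₂)
      above₁ = proj₂ (path-above y₁ cs₁ y path₁)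
      above₂ = proj₂ (path-above y₂ cs₂ y path₂)
      not₂ : ∀ {a} → a ∈ toList inner₁ → ¬ (y₂ ⊑ a)
      not₂ {a} a∈ y₂⊑a = proj₂ (separate a y₂ a∈ (∈₂ (here refl))) (⊑⇒≤ y₂⊑a)
      not₁ : ∀ {a} → a ∈ toList inner₂ → ¬ (y₁ ⊑ a)
      not₁ {a} a∈ y₁⊑a = proj₁ (separate y₁ a (∈₁ (here refl)) a∈) (⊑⇒≤ y₁⊑a)
      join : X
      join = y₁ ⊔ y₂
      -- The join of the atoms lies in the polygon but on neither side, since no element of one side
      -- is above the atom of the other; so it is the top.
      y⊑join : y ⊑ join
      y⊑join with union join (⊑⇒≤ (⊑-trans (below c₁) (⊔-ub₁ y₁ y₂)))
                             (⊑⇒≤ (⊔-lub y₁⊑y y₂⊑y))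
      ... | inj₁ e = ⊥-elim (Cov⇒⋢ c₁ (⊑-trans (⊔-ub₁ y₁ y₂) (proj₁ (≈⇒≋ e))))
      ... | inj₂ (inj₁ e) = proj₂ (≈⇒≋ e)
      ... | inj₂ (inj₂ (inj₁ m)) = let (a , a∈ , e) = find m in
              ⊥-elim (not₂ a∈ (⊑-trans (⊔-ub₂ y₁ y₂) (proj₁ (≈⇒≋ e))))
      ... | inj₂ (inj₂ (inj₂ m)) = let (a , a∈ , e) = find m in
              ⊥-elim (not₁ a∈ (⊑-trans (⊔-ub₁ y₁ y₂) (proj₁ (≈⇒≋ e))))
      d : PolyData S
      d = Up.polyData (same-label⇒≋ c₁ c₂ λ e → disjoint y₁ y₂ (∈₁ (here refl)) (∈₂ (here refl)) (≋⇒≈ e)) c₁ c₂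
            y₁⊑y y₂⊑y (λ ρ f g → ⊑⇒F y⊑join ρ (F-⊔ ρ f g))
      module d = PolyData d
      bounds₁ : ∀ a → a ∈ (y₁ ∷ cs₁) → y₁ ⊑ a × a ⊑ d.m₁
      bounds₁ a a∈ = above₁ a∈ , below-cover d.down₁ (path-below (y₁ ∷ cs₁) (x⋖y₁ , path₁) a∈)
        (λ t → not₂ (∈₁ a∈) (above-cover c₂ (⊑-trans (below c₁) (above₁ a∈)) t))
      bounds₂ : ∀ a → a ∈ (y₂ ∷ cs₂) → y₂ ⊑ a × a ⊑ d.m₂
      bounds₂ a a∈ = above₂ a∈ , below-cover d.down₂ (path-below (y₂ ∷ cs₂) (x⋖y₂ , path₂) a∈)
        (λ t → not₁ (∈₂ a∈) (above-cover c₁ (⊑-trans (below c₂) (above₂ a∈)) t))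

  isHHLattice : IsHHLattice
  isHHLattice = record
    { finite = finite ; _∨_ = _⊔_ ; _∧_ = _⊓_ ; isLattice = isLattice
    ; join-semidistrib = ⊔-semidistributive ; meet-semidistrib = ⊓-semidistributive
    ; polygonal-up = polygonal-up ; polygonal-down = polygonal-down
    ; Label = Maybe (Fin N) ; ℓ = ℓ ; ℓ-cong = ℓ-cong ; r = rank
    ; hh1 = λ x y p → let open Shapes (shapes p) in
        trans (head-label shape₁) (sym (last-label shape₂)) ,
        trans (head-label shape₂) (sym (last-label shape₁))
    ; hh2 = λ x y p → let open Shapes (shapes p) in rank-condition shape₁ , rank-condition shape₂ }

  polygonsAreSmall : PolygonsAreSmall
  polygonsAreSmall x y p = let open Shapes (shapes p) in small shape₁ , small shape₂

  congruenceUniform : CongruenceUniform pos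
  congruenceUniform = P , doublings , record
    { to = ι ; from = π
    ; to-cong = λ {z} {w} e → let (p , q) = Equivalence.to (≈⇔ z w) e in ≋⇒≈ (⊑ₙ⇒⊑ p , ⊑ₙ⇒⊑ q)
    ; from-cong = λ {x} {y} e → let (p , q) = ≈⇒≋ e in Equivalence.from (≈⇔ (π x) (π y))
        (trunc (⊑-trans (⊑ₙ⇒⊑ (proj₁ (ιπ x))) (⊑-trans p (⊑ₙ⇒⊑ (proj₂ (ιπ y))))) ,
         trunc (⊑-trans (⊑ₙ⇒⊑ (proj₁ (ιπ y))) (⊑-trans q (⊑ₙ⇒⊑ (proj₂ (ιπ x))))))
    ; to-from = λ x → ≋⇒≈ (⊑ₙ⇒⊑ (proj₁ (ιπ x)) , ⊑ₙ⇒⊑ (proj₂ (ιπ x)))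
    ; from-to = λ z → Equivalence.from (≈⇔ (π (ι z)) z) (ιπ (ι z))
    ; order = λ z w → mk⇔ (λ p → ⊑⇒≤ (⊑ₙ⇒⊑ (Equivalence.to (≤⇔ z w) p)))
                          (λ p → Equivalence.from (≤⇔ z w) (trunc (≤⇒⊑ p))) }
    where
    open Doubling S using (full; ⊑ₙ⇒⊑)
    open Doubling.Stage full
    trunc : ∀ {x y} → x ⊑ y → Truncated._⊑ₖ_ S N x y
    trunc p ρ _ = p ρ

presentation : (G : FlowGraph) (F : Framing G) → Presentation
presentation G F = record
  { S = S₁ ; _≤_ = Framed._≤C_ G F ; _≈_ = Framed._≈C_ G F
  ; ≤⇒⊑ = ≤C⇒⊑ ; ⊑⇒≤ = ⊑⇒≤C
  ; ≈⇒≋ = λ {C} {C′} e → ≈C⇒⊑ {C} {C′} e ,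
      ≈C⇒⊑ {C′} {C} (λ P → mk⇔ (Equivalence.from (e P)) (Equivalence.to (e P)))
  ; ≋⇒≈ = λ {C} {C′} → ≋⇒≈C {C} {C′}
  ; inner-label-unique = λ d → PolygonLabels.inner-label-unique Λ d }
  where
  open Flips G F


theoremA : (G : FlowGraph) (F : Framing G) →
    PosNotions.IsHHLattice (FramingPoset G F) ×
    CongruenceUniform (FramingPoset G F) ×
    PosNotions.PolygonsAreSmall (FramingPoset G F)
theoremA G F = isHHLattice , congruenceUniform , polygonsAreSmall
  where open HH (presentation G F)
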